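{- There exists an absolute constant $c>0$ such that for every positive integer $n$, \[\frac{1}{8\sqrt{d(n)}}\cdot\min_{r\mid n}\left(\frac{n}{r}+\sqrt{r}\right)\le \operatorname{disc}(\mathcal A_n)\le \min_{r\mid n}\left(\frac{n}{r}+c\sqrt{r}\cdot 2^{\omega(r)}\right),\] where the minima are over positive divisors $r$ of $n$.
   Context: For a positive integer $n$, $\mathbb{Z}_n$ denotes the integers modulo $n$. An arithmetic progression in $\mathbb{Z}_n$ is a set of the form $\{a+kd: 0\le k<l\}$ with $a,d\in\mathbb{Z}_n$ and $l$ an integer with $0\le l\le n/\gcd(n,d)$ (so that no element is repeated); $\mathcal A_n$ is the family of all arithmetic progressions in $\mathbb{Z}_n$. For a function $\chi$ and a finite set $A$, $\chi(A)=\sum_{x\in A}\chi(x)$. The discrepancy is $\operatorname{disc}(\mathcal A_n)=\min_{\chi:\mathbb{Z}_n\to\{1,-1\}}\max_{A\in\mathcal A_n}|\chi(A)|$. $d(n)$ is the number of positive divisors of $n$ and $\omega(r)$ is the number of distinct prime factors of $r$. -}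

module Defs where

open import Data.Nat using (ℕ; zero; suc; _+_; _*_; _∸_; _^_; _≤_; _⊓_; _⊔_; NonZero)
open import Data.Nat.DivMod using (_/_; _%_)
open import Data.Nat.GCD using (gcd)
open import Data.Nat.Divisibility using (_∣?_)
open import Data.Nat.Primality using (prime?)
open import Data.Bool using (Bool; true; false; if_then_else_)
open import Data.Fin using (Fin; toℕ)
open import Data.Vec using (Vec; []; _∷_; lookup; replicate)
open import Data.List using (List; []; _∷_; map; foldr; filter; length; concatMap; upTo; allFin; _++_)
open import Data.Integer using (ℤ; ∣_∣) renaming (_+_ to _+ℤ_)
import Data.Integer as ℤ
open import Data.Product using (_×_; _,_)
open import Data.Sum using (_⊎_)
open import Relation.Nullary.Decidable using (_×-dec_)

-- ±1 colourings of ℤ_n, encoded as Bool vectors (true ↦ +1, false ↦ -1)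
sign : Bool → ℤ
sign true  = ℤ.+ 1
sign false = ℤ.- (ℤ.+ 1)

allVecs : (n : ℕ) → List (Vec Bool n)
allVecs zero    = [] ∷ []
allVecs (suc n) = map (true ∷_) (allVecs n) ++ map (false ∷_) (allVecs n)

module _ (m : ℕ) where
  private n = suc m

  elt : ℕ → ℕ → ℕ → Fin n
  elt a d k = Data.Fin.fromℕ< (Data.Nat.DivMod.m%n<n (a + k * d) n)

  χAP : Vec Bool n → ℕ → ℕ → ℕ → ℤ
  χAP χ a d zero    = ℤ.+ 0
  χAP χ a d (suc l) = χAP χ a d l +ℤ sign (lookup χ (elt a d l))

  allAPs : List (ℕ × ℕ × ℕ)
  allAPs = concatMap (λ a → concatMap (λ d → map (λ l → a , d , l)
             (upTo (suc (_/_ n (gcd n d) {{gcdNZ d}})))) (upTo n)) (upTo n)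
    where
    gcdNZ : (d : ℕ) → NonZero (gcd n d)
    gcdNZ d = Data.Nat.≢-nonZero (Data.Nat.GCD.gcd[m,n]≢0 n d (Data.Sum.inj₁ (λ ())))

  maxAP : Vec Bool n → ℕ
  maxAP χ = foldr (λ { (a , d , l) acc → ∣ χAP χ a d l ∣ ⊔ acc }) 0 allAPs

  -- disc(𝒜_n) = min over colourings χ of maxAP χ
  -- (seeded with the all-(+1) colouring, which itself belongs to the list)
  discSuc : ℕ
  discSuc = foldr (λ χ acc → maxAP χ ⊓ acc) (maxAP (replicate n true)) (allVecs n)

-- disc(𝒜_n) for positive n (value at n = 0 is irrelevant; set to 0)
disc : ℕ → ℕ
disc zero    = 0
disc (suc m) = discSuc m

numDiv : ℕ → ℕ
numDiv n = length (filter (λ r → suc r ∣? n) (upTo n))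

omega : ℕ → ℕ
omega r = length (filter (λ p → prime? p ×-dec (p ∣? r)) (upTo (suc r)))

-- Comparisons involving square roots of naturals, expressed exactly in ℕ.
-- SumSqrtLe a b c  means  a + √b ≤ √c  (squaring; both sides nonnegative):
--   a + √b ≤ √c  ⇔  a² + b ≤ c  and  (2a√b)² ≤ (c - a² - b)²
SumSqrtLe : ℕ → ℕ → ℕ → Set
SumSqrtLe a b c = (a * a + b ≤ c) × (4 * (a * a) * b ≤ (c ∸ (a * a + b)) * (c ∸ (a * a + b)))

-- LeSumSqrt x a b  means  x ≤ a + √b :
--   either x ≤ a, or (x - a)² ≤ b
LeSumSqrt : ℕ → ℕ → ℕ → Set
LeSumSqrt x a b = (x ≤ a) ⊎ ((x ∸ a) * (x ∸ a) ≤ b)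

{-# OPTIONS --safe #-}
module Submission where

-- Lower bound.  Let E_t be the projection of functions on ℤ_n onto the t-periodic ones.  Gram–Schmidt over
-- the divisors r of n splits a colouring f into orthogonal components F_r that are r-periodic and sum to
-- zero over the cosets of every nontrivial subgroup of ℤ_r.  If all progressions have |f(A)| ≤ D, the full
-- cosets of rℤ_n give (n/r)² ‖F_r‖² ≤ n D².  Averaging ‖Σ_{k<l} F_r(· + kd)‖² over all d mod r, all
-- correlations with different k cancel, leaving l r ‖F_r‖²; for l = r/2 the trivial d = 0 accounts for only
-- half of this, so r ‖F_r‖² ≤ 6 n D².  Since Σ_r ‖F_r‖² = n, some r has (n/r)² + r ≤ 7 D² d(n).
--
-- Upper bound.  Colour ℤ_n periodically modulo r.  A progression then consists of at most n/r full cosets of a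
-- subgroup of ℤ_r and a partial one.  Pairing the digits l and p - 1 - l in every prime power coordinate
-- forces all coset sums to be 0 or ±1 and still leaves free colours, each used at most 2^ω(r) times.  These
-- are chosen by Beck's partial colouring method: for each d the elements of ℤ_r are listed in the order of
-- the walk x ↦ x + d, the lists are cut into chunks of length 64^i, and a weighted pigeonhole argument, with
-- the fourth moment as the only probabilistic input, yields two colourings that nearly agree on all chunks
-- but differ at an eighth or more of the points; half their difference is a partial colouring.  The
-- tolerances form a geometric series over scales and iterations, so no logarithm is lost.

open import Defs
open import Data.Bool using (Bool; true; false)
open import Data.Empty using (⊥-elim)
open import Data.Fin using (Fin; fromℕ<; zero; suc; combine; toℕ)
import Data.Fin.Properties as Fin
open import Data.Fin.Properties using (fromℕ<-cong)
import Data.Integer as ℤ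
open import Data.Integer using (ℤ; +_; -[1+_]; ∣_∣; 0ℤ; 1ℤ; +≤+; drop‿+≤+) renaming (_+_ to _+ᶻ_; _*_ to _*ᶻ_; -_ to -ᶻ_; _-_ to _-ᶻ_; _≤_ to _≤ᶻ_)
import Data.Integer.Properties as ℤ
open import Data.Integer.Tactic.RingSolver renaming (solve-∀ to ℤ-ring)
open import Data.List using (length; filter; upTo; [_]; _++_; List; []; _∷_; foldr; map; concatMap; take; drop)
open import Data.List.Membership.Propositional using (_∈_; find; lose)
open import Data.List.Membership.Propositional.Properties using (∈-map⁺; ∈-map⁻; ∈-++⁺ˡ; ∈-++⁺ʳ; ∈-concat⁺′; ∈-concatMap⁻; ∈-upTo⁺; ∈-upTo⁻; ∈-filter⁻)
import Data.List.Properties as List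
open import Data.List.Relation.Unary.All as All using (All; []; _∷_; all?)
open import Data.List.Relation.Unary.Any using (here; there; any?)
open import Data.Maybe as Maybe using (Maybe; just; nothing)
import Data.Nat as ℕ
open import Data.Nat using (ℕ; zero; suc; _+_; _*_; _∸_; _^_; _<_; _≤_; z≤n; s≤s; NonZero; _≤?_; _⊓_; _⊔_; _<?_)
open import Data.Nat.Coprimality using (Coprime; coprime⇒gcd≡1; gcd≡1⇒coprime; coprime-divisor)
open import Data.Nat.DivMod using (_/_; _%_; m≡m%n+[m/n]*n; m%n<n; m/n*n≤m; m*n/n≡m; /-monoˡ-≤; [m+n]%n≡m%n; [m+kn]%n≡m%n; m<n⇒m%n≡m; m<n⇒m/n≡0; +-distrib-/-∣ʳ)
open import Data.Nat.Divisibility using (divides; _∣_; _∣?_; ∣⇒≤; n∣m*n; ∣-trans; ∣-antisym; ∣n∣m%n⇒∣m; %-presˡ-∣; ∣1⇒≡1)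
open import Data.Nat.GCD using (gcd; gcd[m,n]∣n; gcd-GCD; module Bézout; gcd[m,n]∣m; gcd-greatest; c*gcd[m,n]≡gcd[cm,cn]; gcd[m,n]≢0; gcd-comm)
open import Data.Nat.Induction using (<-rec)
open import Data.Nat.ListAction using (product)
open import Data.Nat.Primality using (Prime; prime?; prime⇒nonZero; prime⇒nonTrivial; prime⇒irreducible)
open import Data.Nat.Primality.Factorisation using (factorise)
import Data.Nat.Properties as ℕ
open import Data.Nat.Tactic.RingSolver renaming (solve-∀ to ℕ-ring)
open import Data.Product using (Σ; _×_; ∃; _,_; proj₁; proj₂; ∃₂)
open import Data.Sum using (inj₁; inj₂; _⊎_)
open import Data.Vec using (Vec; []; _∷_; lookup; replicate; tabulate)
import Data.Vec.Properties as Vec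
open import Relation.Binary.PropositionalEquality hiding ([_])
open import Relation.Nullary using (¬_; Dec; yes; no)
open import Relation.Nullary.Decidable using (_×-dec_)
open import Algebra.Properties.AbelianGroup ℤ.+-0-abelianGroup using () renaming (∙-cancelˡ to +ᶻ-cancelˡ)

-- The cancellation over full cosets cannot be left to the partial colouring. Its errors have order
-- √r, while a single progression may contain n/r full cosets, so a coset sum must be bounded by 1
-- outright. This is why the symmetry is built into the variables beforehand; the factor 2^ω(r) is
-- the price, because a variable used up to K times enlarges every random sum.
--
-- The base 64 and the fourth moment belong together. At scale i a chunk has standard deviation
-- about `s * 8 ^ i`, while the tolerances must decay geometrically towards small scales, here by 2
-- per scale. With t = L - i the tolerance is then 8·4^t standard deviations. A second moment would
-- bound the expected quotient only by 16^-t, too weak against 64^t chunks per point; the fourth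
-- gives 256^-t, and the product 4^-t is summable even with weights that grow linearly in t.
--
-- All quantities are integers: projections carry a factor n, energies powers of n^2,
-- half-differences a factor 2, and fractional exponents are removed by raising both sides to a
-- common power.

-- Finite integer sums, periodic functions and sums over cycles.

module Sums where

  open ≡-Reasoning

  ∑ : ℕ → (ℕ → ℤ) → ℤ
  ∑ zero    f = 0ℤ
  ∑ (suc n) f = ∑ n f +ᶻ f n

  ∑-cong< : ∀ n {f g : ℕ → ℤ} → (∀ k → k < n → f k ≡ g k) → ∑ n f ≡ ∑ n g
  ∑-cong< zero    h = refl
  ∑-cong< (suc n) h = cong₂ _+ᶻ_ (∑-cong< n (λ k k<n → h k (ℕ.m<n⇒m<1+n k<n))) (h n (ℕ.n<1+n n))

  ∑-cong : ∀ n {f g : ℕ → ℤ} → (∀ k → f k ≡ g k) → ∑ n f ≡ ∑ n g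
  ∑-cong n h = ∑-cong< n (λ k _ → h k)

  +ᶻ-interchange : ∀ a b c d → (a +ᶻ b) +ᶻ (c +ᶻ d) ≡ (a +ᶻ c) +ᶻ (b +ᶻ d)
  +ᶻ-interchange = ℤ-ring

  ∑-+ : ∀ n f g → ∑ n (λ k → f k +ᶻ g k) ≡ ∑ n f +ᶻ ∑ n g
  ∑-+ zero    f g = refl
  ∑-+ (suc n) f g = trans (cong (_+ᶻ (f n +ᶻ g n)) (∑-+ n f g)) (+ᶻ-interchange (∑ n f) (∑ n g) (f n) (g n))

  ∑-*ˡ : ∀ n c f → ∑ n (λ k → c *ᶻ f k) ≡ c *ᶻ ∑ n f
  ∑-*ˡ zero    c f = sym (ℤ.*-zeroʳ c)
  ∑-*ˡ (suc n) c f = trans (cong (_+ᶻ c *ᶻ f n) (∑-*ˡ n c f)) (sym (ℤ.*-distribˡ-+ c (∑ n f) (f n)))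

  ∑-*ʳ : ∀ n c f → ∑ n (λ k → f k *ᶻ c) ≡ ∑ n f *ᶻ c
  ∑-*ʳ n c f = trans (∑-cong n (λ k → ℤ.*-comm (f k) c)) (trans (∑-*ˡ n c f) (ℤ.*-comm c (∑ n f)))

  ∑-0 : ∀ n → ∑ n (λ _ → 0ℤ) ≡ 0ℤ
  ∑-0 zero    = refl
  ∑-0 (suc n) = trans (ℤ.+-identityʳ _) (∑-0 n)

  ∑-const : ∀ n c → ∑ n (λ _ → c) ≡ + n *ᶻ c
  ∑-const zero    c = refl
  ∑-const (suc n) c = trans (cong (_+ᶻ c) (∑-const n c)) (lem (+ n) c)
    where
    lem : ∀ a c → a *ᶻ c +ᶻ c ≡ (1ℤ +ᶻ a) *ᶻ c
    lem = ℤ-ring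

  ∑-swap : ∀ m n (f : ℕ → ℕ → ℤ) → ∑ m (λ i → ∑ n (f i)) ≡ ∑ n (λ j → ∑ m (λ i → f i j))
  ∑-swap zero    n f = sym (∑-0 n)
  ∑-swap (suc m) n f = trans (cong (_+ᶻ ∑ n (f m)) (∑-swap m n f)) (sym (∑-+ n _ _))

  ∑-split : ∀ m n f → ∑ (m + n) f ≡ ∑ m f +ᶻ ∑ n (λ k → f (m + k))
  ∑-split m zero    f = trans (cong (λ z → ∑ z f) (ℕ.+-identityʳ m)) (sym (ℤ.+-identityʳ _))
  ∑-split m (suc n) f = trans (cong (λ z → ∑ z f) (ℕ.+-suc m n))
    (trans (cong (_+ᶻ f (m + n)) (∑-split m n f)) (ℤ.+-assoc (∑ m f) _ _))

  ∑-cons : ∀ n f → ∑ (suc n) f ≡ f 0 +ᶻ ∑ n (λ k → f (suc k))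
  ∑-cons n f = trans (∑-split 1 n f) (cong (_+ᶻ ∑ n (λ k → f (suc k))) (ℤ.+-identityˡ (f 0)))

  ∑-blocks : ∀ m n f → ∑ (m * n) f ≡ ∑ m (λ i → ∑ n (λ j → f (i * n + j)))
  ∑-blocks zero    n f = refl
  ∑-blocks (suc m) n f = trans (cong (λ z → ∑ z f) (ℕ.+-comm n (m * n)))
    (trans (∑-split (m * n) n f) (cong (_+ᶻ ∑ n (λ j → f (m * n + j))) (∑-blocks m n f)))

  ∑-reverse : ∀ n f → ∑ n (λ k → f (n ∸ suc k)) ≡ ∑ n f
  ∑-reverse zero    f = refl
  ∑-reverse (suc n) f = trans (∑-cons n (λ k → f (suc n ∸ suc k)))
    (trans (cong (f n +ᶻ_) (∑-reverse n f)) (ℤ.+-comm (f n) (∑ n f)))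

  ∑-mono< : ∀ n {f g : ℕ → ℤ} → (∀ k → k < n → f k ≤ᶻ g k) → ∑ n f ≤ᶻ ∑ n g
  ∑-mono< zero    h = ℤ.≤-refl
  ∑-mono< (suc n) h = ℤ.+-mono-≤ (∑-mono< n (λ k k<n → h k (ℕ.m<n⇒m<1+n k<n))) (h n (ℕ.n<1+n n))

  Periodic : ℕ → (ℕ → ℤ) → Set
  Periodic n f = ∀ x → f (x + n) ≡ f x

  periodic-* : ∀ {n f} → Periodic n f → ∀ m → Periodic (m * n) f
  periodic-* {n} {f} p zero    x = cong f (ℕ.+-identityʳ x)
  periodic-* {n} {f} p (suc m) x = trans (cong f (sym (ℕ.+-assoc x n (m * n))))
    (trans (periodic-* p m (x + n)) (p x))

  ∑-shift : ∀ n f → Periodic n f → ∀ a → ∑ n (λ x → f (x + a)) ≡ ∑ n f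
  ∑-shift n f p zero    = ∑-cong n (λ x → cong f (ℕ.+-identityʳ x))
  ∑-shift n f p (suc a) = begin
    ∑ n (λ x → f (x + suc a)) ≡⟨ ∑-cong n (λ x → cong f (ℕ.+-suc x a)) ⟩
    ∑ n (λ x → g (suc x)) ≡⟨ cancel ⟩
    ∑ n g ≡⟨ ∑-shift n f p a ⟩
    ∑ n f ∎
    where
    g : ℕ → ℤ
    g x = f (x + a)
    last≡first : g n ≡ g 0
    last≡first = trans (cong f (ℕ.+-comm n a)) (p a)
    cancel : ∑ n (λ x → g (suc x)) ≡ ∑ n g
    cancel = +ᶻ-cancelˡ (g 0) _ _ (trans (sym (∑-cons n g))
      (trans (cong (∑ n g +ᶻ_) last≡first) (ℤ.+-comm (∑ n g) (g 0))))

  -- Advancing `x` by `d` only rotates the `m` terms, because the term with index `m` equals the one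
  -- with index 0.
  ∑-step-periodic : ∀ m d f → Periodic (m * d) f → Periodic d (λ x → ∑ m (λ k → f (x + k * d)))
  ∑-step-periodic m d f p x = begin
    ∑ m (λ k → f (x + d + k * d)) ≡⟨ ∑-cong m (λ k → cong f (eq x d k)) ⟩
    ∑ m (λ k → g (k + 1)) ≡⟨ ∑-shift m g (λ k → trans (cong f (eq' x d k m)) (p (x + k * d))) 1 ⟩
    ∑ m g ∎
    where
    g : ℕ → ℤ
    g k = f (x + k * d)
    eq : ∀ x d k → x + d + k * d ≡ x + (k + 1) * d
    eq = ℕ-ring
    eq' : ∀ x d k m → x + (k + m) * d ≡ x + k * d + m * d
    eq' = ℕ-ring

  periodic-gcd : ∀ m n {f} → Periodic m f → Periodic n f → Periodic (gcd m n) f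
  periodic-gcd m n {f} pm pn x with Bézout.identity (gcd-GCD m n)
  ... | Bézout.+- a b eq = begin
    f (x + gcd m n) ≡⟨ periodic-* pn b (x + gcd m n) ⟨
    f (x + gcd m n + b * n) ≡⟨ cong f (trans (ℕ.+-assoc x _ _) (cong (λ z → x + z) eq)) ⟩
    f (x + a * m) ≡⟨ periodic-* pm a x ⟩
    f x ∎
  ... | Bézout.-+ a b eq = begin
    f (x + gcd m n) ≡⟨ periodic-* pm a (x + gcd m n) ⟨
    f (x + gcd m n + a * m) ≡⟨ cong f (trans (ℕ.+-assoc x _ _) (cong (λ z → x + z) eq)) ⟩
    f (x + b * n) ≡⟨ periodic-* pn b x ⟩
    f x ∎

  -- Both sides are g-periodic in c, so averaging one over the shifts of the other identifies them.
  cycle-sum : ∀ π g d .{{_ : NonZero π}} → gcd (π * g) d ≡ g → ∀ F → Periodic (π * g) F → ∀ c →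
    ∑ π (λ k → F (c + k * d)) ≡ ∑ π (λ j → F (c + j * g))
  cycle-sum π@(suc _) g d gcd≡ F p c with subst (Data.Nat.Divisibility._∣ d) gcd≡ (gcd[m,n]∣n (π * g) d)
  ... | divides d' d≡ = ℤ.*-cancelˡ-≡ (+ π) (B c) (E c) (begin
    + π *ᶻ B c ≡⟨ ∑-const π (B c) ⟨
    ∑ π (λ j → B c) ≡⟨ ∑-cong π (λ j → periodic-* B-per j c) ⟨
    ∑ π (λ j → ∑ π (λ k → F (c + j * g + k * d))) ≡⟨ ∑-swap π π _ ⟩
    ∑ π (λ k → ∑ π (λ j → F (c + j * g + k * d))) ≡⟨ ∑-cong π (λ k → ∑-cong π (λ j → cong F (eq c (j * g) (k * d)))) ⟩
    ∑ π (λ k → E (c + k * d)) ≡⟨ ∑-cong π (λ k → trans (cong (λ z → E (c + z)) (eq₂ k)) (periodic-* E-per (k * d') c)) ⟩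
    ∑ π (λ k → E c) ≡⟨ ∑-const π (E c) ⟩
    + π *ᶻ E c ∎)
    where
    B E : ℕ → ℤ
    B x = ∑ π (λ k → F (x + k * d))
    E x = ∑ π (λ j → F (x + j * g))
    eq : ∀ a b c → a + b + c ≡ a + c + b
    eq = ℕ-ring
    eq₂ : ∀ k → k * d ≡ k * d' * g
    eq₂ k = trans (cong (k *_) d≡) (sym (ℕ.*-assoc k d' g))
    eq₃ : ∀ a b c → a * (b * c) ≡ b * (a * c)
    eq₃ = ℕ-ring
    πd : π * d ≡ d' * (π * g)
    πd = trans (cong (π *_) d≡) (eq₃ π d' g)
    E-per : Periodic g E
    E-per = ∑-step-periodic π g F p
    B-per : Periodic g B
    B-per = subst (λ z → Periodic z B) gcd≡ (periodic-gcd (π * g) d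
      (λ x → ∑-cong π (λ k → trans (cong F (eq x (π * g) (k * d))) (p (x + k * d))))
      (∑-step-periodic π d F (subst (λ z → Periodic z F) (sym πd) (periodic-* p d'))))

-- Counting the solutions of a decidable predicate below a bound.

module Counting where

  module _ {P : ℕ → Set} (P? : ∀ x → Dec (P x)) where

    #upTo : ℕ → ℕ
    #upTo n = length (filter P? (upTo n))

    #upTo-snoc : ∀ n → #upTo (suc n) ≡ #upTo n + length (filter P? [ n ])
    #upTo-snoc n = trans (cong (λ z → length (filter P? z)) (sym (List.upTo-∷ʳ n)))
      (trans (cong length (List.filter-++ P? (upTo n) [ n ])) (List.length-++ (filter P? (upTo n))))

    #upTo-yes : ∀ n → P n → #upTo (suc n) ≡ suc (#upTo n)
    #upTo-yes n h = trans (#upTo-snoc n) (trans (cong (λ z → #upTo n + length z) (List.filter-accept P? h)) (ℕ.+-comm (#upTo n) 1))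

    #upTo-no : ∀ n → ¬ P n → #upTo (suc n) ≡ #upTo n
    #upTo-no n h = trans (#upTo-snoc n) (trans (cong (λ z → #upTo n + length z) (List.filter-reject P? h)) (ℕ.+-identityʳ (#upTo n)))

    #upTo-mono : ∀ {m n} → m ≤ n → #upTo m ≤ #upTo n
    #upTo-mono {m} {n} m≤n with ℕ.m≤n⇒∃[o]m+o≡n m≤n
    ... | o , refl = go o
      where
      go : ∀ o → #upTo m ≤ #upTo (m + o)
      go zero    = ℕ.≤-reflexive (cong #upTo (sym (ℕ.+-identityʳ m)))
      go (suc o) = ℕ.≤-trans (go o) (ℕ.≤-trans (ℕ.m≤m+n _ _) (ℕ.≤-reflexive (trans (sym (#upTo-snoc (m + o))) (cong #upTo (sym (ℕ.+-suc m o))))))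

  module _ {P Q : ℕ → Set} (P? : ∀ x → Dec (P x)) (Q? : ∀ x → Dec (Q x)) (P⇒Q : ∀ x → P x → Q x) where

    #upTo-⊆ : ∀ n → #upTo P? n ≤ #upTo Q? n
    #upTo-⊆ zero    = z≤n
    #upTo-⊆ (suc n) with P? n | Q? n
    ... | yes p | _     = subst₂ _≤_ (sym (#upTo-yes P? n p)) (sym (#upTo-yes Q? n (P⇒Q n p))) (s≤s (#upTo-⊆ n))
    ... | no ¬p | _     = ℕ.≤-trans (ℕ.≤-reflexive (#upTo-no P? n ¬p)) (ℕ.≤-trans (#upTo-⊆ n) (#upTo-mono Q? (ℕ.n≤1+n n)))

    -- The witness `w` is seen by the larger count only. This makes `omega` drop when a prime is
    -- divided out.
    #upTo-⊂ : ∀ w → Q w → ¬ P w → ∀ n → w < n → suc (#upTo P? n) ≤ #upTo Q? n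
    #upTo-⊂ w qw ¬pw (suc n) (s≤s w≤n) with ℕ.m≤n⇒m<n∨m≡n w≤n
    ... | inj₂ refl = subst₂ _≤_ (cong suc (sym (#upTo-no P? n ¬pw))) (sym (#upTo-yes Q? n qw)) (s≤s (#upTo-⊆ n))
    ... | inj₁ w<n with P? n
    ...   | yes p = subst₂ _≤_ (cong suc (sym (#upTo-yes P? n p))) (sym (#upTo-yes Q? n (P⇒Q n p))) (s≤s (#upTo-⊂ w qw ¬pw n w<n))
    ...   | no ¬p = ℕ.≤-trans (ℕ.≤-reflexive (cong suc (#upTo-no P? n ¬p))) (ℕ.≤-trans (#upTo-⊂ w qw ¬pw n w<n) (#upTo-mono Q? (ℕ.n≤1+n n)))

-- Lower bound: orthogonal decomposition over the divisors of n.

module Lower where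

  open Sums
  open Counting

  -- Bookkeeping for a proof by contradiction: after `k` removals at least the fraction (d - k)/d of
  -- the total energy `c * n` is left, and the next component `b` takes less than 1/d of the
  -- rescaled total. The bare summand `k` collects one unit of strictness per removal; these units
  -- alone produce the contradiction at the end.
  potential-step : ∀ n N c d k a a' b → 0 < N → a' + b ≡ N * a → d * (c * n) + k ≤ d * a + k * (c * n) → d * b < N * (c * n) →
    d * (N * c * n) + suc k ≤ d * a' + suc k * (N * c * n)
  potential-step n N@(suc N') c d k a a' b _ eq IH lt = begin
    d * (N * c * n) + suc k ≤⟨ ℕ.+-monoʳ-≤ _ (s≤s (ℕ.m≤n*m k N)) ⟩
    d * (N * c * n) + suc (N * k) ≡⟨ lem₁ d N c n k ⟩
    N * (d * (c * n) + k) + 1 ≤⟨ ℕ.+-monoˡ-≤ 1 (ℕ.*-monoʳ-≤ N IH) ⟩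
    N * (d * a + k * (c * n)) + 1 ≡⟨ lem₂ N d a k c n ⟩
    d * (N * a) + k * (N * c * n) + 1 ≡⟨ cong (λ z → d * z + k * (N * c * n) + 1) eq ⟨
    d * (a' + b) + k * (N * c * n) + 1 ≡⟨ lem₃ d a' b (k * (N * c * n)) ⟩
    d * a' + (suc (d * b) + k * (N * c * n)) ≤⟨ ℕ.+-monoʳ-≤ (d * a') (ℕ.+-monoˡ-≤ (k * (N * c * n)) lt) ⟩
    d * a' + (N * (c * n) + k * (N * c * n)) ≡⟨ cong (λ z → d * a' + (z + k * (N * c * n))) (ℕ.*-assoc N c n) ⟨
    d * a' + suc k * (N * c * n) ∎
    where
    open ℕ.≤-Reasoning
    lem₁ : ∀ d N c n k → d * (N * c * n) + suc (N * k) ≡ N * (d * (c * n) + k) + 1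
    lem₁ = ℕ-ring
    lem₂ : ∀ N d a k c n → N * (d * a + k * (c * n)) + 1 ≡ d * (N * a) + k * (N * c * n) + 1
    lem₂ = ℕ-ring
    lem₃ : ∀ d a b z → d * (a + b) + z + 1 ≡ d * a + (suc (d * b) + z)
    lem₃ = ℕ-ring

  open ≡-Reasoning

  A : ℕ → ℕ → (ℕ → ℤ) → ℕ → ℤ
  A l d f x = ∑ l (λ k → f (x + k * d))

  A-cong : ∀ l d {f g : ℕ → ℤ} → (∀ x → f x ≡ g x) → ∀ x → A l d f x ≡ A l d g x
  A-cong l d h x = ∑-cong l (λ k → h (x + k * d))

  +-swapʳ : ∀ a b c → a + b + c ≡ a + c + b
  +-swapʳ = ℕ-ring

  -- Commutation of all progression operators takes the place of a common eigenbasis of characters.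
  -- It lets projections and residuals be exchanged freely with sums over progressions.
  A-comm : ∀ l d l' d' f x → A l d (A l' d' f) x ≡ A l' d' (A l d f) x
  A-comm l d l' d' f x = trans (∑-swap l l' _)
    (∑-cong l' (λ j → ∑-cong l (λ k → cong f (+-swapʳ x (k * d) (j * d')))))

  A-*ˡ : ∀ l d c f x → A l d (λ y → c *ᶻ f y) x ≡ c *ᶻ A l d f x
  A-*ˡ l d c f x = ∑-*ˡ l c (λ k → f (x + k * d))

  A-periodic : ∀ {n} l d f → Periodic n f → Periodic n (A l d f)
  A-periodic {n} l d f p x = ∑-cong l (λ k → trans (cong f (+-swapʳ x n (k * d))) (p (x + k * d)))

  A-- : ∀ l d f g x → A l d (λ y → f y -ᶻ g y) x ≡ A l d f x -ᶻ A l d g x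
  A-- l d f g x = begin
    ∑ l (λ k → f (x + k * d) -ᶻ g (x + k * d)) ≡⟨ ∑-cong l (λ k → lem (f (x + k * d)) (g (x + k * d))) ⟩
    ∑ l (λ k → f (x + k * d) +ᶻ ℤ.-1ℤ *ᶻ g (x + k * d)) ≡⟨ ∑-+ l _ _ ⟩
    A l d f x +ᶻ ∑ l (λ k → ℤ.-1ℤ *ᶻ g (x + k * d)) ≡⟨ cong (A l d f x +ᶻ_) (∑-*ˡ l ℤ.-1ℤ _) ⟩
    A l d f x +ᶻ ℤ.-1ℤ *ᶻ A l d g x ≡⟨ lem (A l d f x) (A l d g x) ⟨
    A l d f x -ᶻ A l d g x ∎
    where
    lem : ∀ a b → a -ᶻ b ≡ a +ᶻ ℤ.-1ℤ *ᶻ b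
    lem = ℤ-ring

  A-drop : ∀ d F m π l → (∀ x → A π d F x ≡ 0ℤ) → ∀ x → A (l + m * π) d F x ≡ A l d F x
  A-drop d F m π l z x = begin
    A (l + m * π) d F x ≡⟨ ∑-split l (m * π) _ ⟩
    A l d F x +ᶻ ∑ (m * π) (λ k → F (x + (l + k) * d)) ≡⟨ cong (A l d F x +ᶻ_) (∑-blocks m π _) ⟩
    A l d F x +ᶻ ∑ m (λ i → ∑ π (λ j → F (x + (l + (i * π + j)) * d))) ≡⟨ cong (A l d F x +ᶻ_) (∑-cong m (λ i → trans (∑-cong π (λ j → cong F (lem x l (i * π) j d))) (z _))) ⟩
    A l d F x +ᶻ ∑ m (λ i → 0ℤ) ≡⟨ cong (A l d F x +ᶻ_) (∑-0 m) ⟩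
    A l d F x +ᶻ 0ℤ ≡⟨ ℤ.+-identityʳ _ ⟩
    A l d F x ∎
    where
    lem : ∀ x l i j d → x + (l + (i + j)) * d ≡ x + (l + i) * d + j * d
    lem = ℕ-ring

  square≥0 : ∀ z → 0ℤ ≤ᶻ z *ᶻ z
  square≥0 (+ n)    = subst (0ℤ ≤ᶻ_) (ℤ.pos-* n n) (+≤+ z≤n)
  square≥0 -[1+ n ] = +≤+ z≤n

  -- Projections onto periodic functions and energy estimates.

  module Spectral (n : ℕ) {{n≢0 : NonZero n}} where

    inner : (ℕ → ℤ) → (ℕ → ℤ) → ℤ
    inner f g = ∑ n (λ x → f x *ᶻ g x)

    norm : (ℕ → ℤ) → ℕ
    norm f = ∣ inner f f ∣

    norm-inner : ∀ f → + norm f ≡ inner f f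
    norm-inner f = ℤ.0≤i⇒+∣i∣≡i (subst (_≤ᶻ inner f f) (∑-0 n) (∑-mono< n (λ k _ → square≥0 (f k))))

    norm-cong : ∀ {f g} → (∀ x → f x ≡ g x) → norm f ≡ norm g
    norm-cong h = cong ∣_∣ (∑-cong n (λ x → cong₂ _*ᶻ_ (h x) (h x)))

    -- n times the projection onto t-periodic functions when u * t ≡ n.
    e : ℕ → ℕ → (ℕ → ℤ) → ℕ → ℤ
    e t u f x = + t *ᶻ A u t f x

    e-cong : ∀ t u {f g} → (∀ x → f x ≡ g x) → ∀ x → e t u f x ≡ e t u g x
    e-cong t u h x = cong (+ t *ᶻ_) (A-cong u t h x)

    e-comm : ∀ t u t' u' f x → e t u (e t' u' f) x ≡ e t' u' (e t u f) x
    e-comm t u t' u' f x = begin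
      + t *ᶻ A u t (e t' u' f) x ≡⟨ cong (+ t *ᶻ_) (A-*ˡ u t (+ t') (A u' t' f) x) ⟩
      + t *ᶻ (+ t' *ᶻ A u t (A u' t' f) x) ≡⟨ cong (λ z → + t *ᶻ (+ t' *ᶻ z)) (A-comm u t u' t' f x) ⟩
      + t *ᶻ (+ t' *ᶻ A u' t' (A u t f) x) ≡⟨ lem (+ t) (+ t') _ ⟩
      + t' *ᶻ (+ t *ᶻ A u' t' (A u t f) x) ≡⟨ cong (+ t' *ᶻ_) (A-*ˡ u' t' (+ t) (A u t f) x) ⟨
      + t' *ᶻ A u' t' (e t u f) x ∎
      where
      lem : ∀ a b c → a *ᶻ (b *ᶻ c) ≡ b *ᶻ (a *ᶻ c)
      lem = ℤ-ring

    e-A-comm : ∀ t u l d f x → e t u (A l d f) x ≡ A l d (e t u f) x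
    e-A-comm t u l d f x = trans (cong (+ t *ᶻ_) (A-comm u t l d f x)) (sym (A-*ˡ l d (+ t) (A u t f) x))

    e-period : ∀ t u → u * t ≡ n → ∀ f → Periodic n f → Periodic t (e t u f)
    e-period t u ut f p x = cong (+ t *ᶻ_) (∑-step-periodic u t f (subst (λ z → Periodic z f) (sym ut) p) x)

    e-periodic : ∀ t u f → Periodic n f → Periodic n (e t u f)
    e-periodic t u f p x = cong (+ t *ᶻ_) (A-periodic u t f p x)

    e-fix : ∀ t u → u * t ≡ n → ∀ f → Periodic t f → ∀ x → e t u f x ≡ + n *ᶻ f x
    e-fix t u ut f p x = begin
      + t *ᶻ ∑ u (λ k → f (x + k * t)) ≡⟨ cong (+ t *ᶻ_) (trans (∑-cong u (λ k → periodic-* p k x)) (∑-const u (f x))) ⟩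
      + t *ᶻ (+ u *ᶻ f x) ≡⟨ lem (+ t) (+ u) (f x) ⟩
      + u *ᶻ + t *ᶻ f x ≡⟨ cong (_*ᶻ f x) (trans (sym (ℤ.pos-* u t)) (cong +_ ut)) ⟩
      + n *ᶻ f x ∎
      where
      lem : ∀ a b c → a *ᶻ (b *ᶻ c) ≡ b *ᶻ a *ᶻ c
      lem = ℤ-ring

    -- Self-adjointness and idempotence of a projection in one formula. One copy of the projection
    -- is opened, `E x` becomes `E (x + k * t)` by periodicity, and translation invariance makes all
    -- `u` summands equal.
    e-inner : ∀ t u → u * t ≡ n → ∀ f → Periodic n f → inner (e t u f) (e t u f) ≡ + n *ᶻ inner (e t u f) f
    e-inner t u ut f p = begin
      ∑ n (λ x → E x *ᶻ (+ t *ᶻ A u t f x)) ≡⟨ ∑-cong n (λ x → trans (lem (E x) (+ t) (A u t f x)) (cong (+ t *ᶻ_) (sym (∑-*ˡ u (E x) _)))) ⟩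
      ∑ n (λ x → + t *ᶻ ∑ u (λ k → E x *ᶻ f (x + k * t))) ≡⟨ ∑-*ˡ n (+ t) _ ⟩
      + t *ᶻ ∑ n (λ x → ∑ u (λ k → E x *ᶻ f (x + k * t))) ≡⟨ cong (+ t *ᶻ_) (∑-swap n u _) ⟩
      + t *ᶻ ∑ u (λ k → ∑ n (λ x → E x *ᶻ f (x + k * t))) ≡⟨ cong (+ t *ᶻ_) (∑-cong u (λ k → ∑-cong n (λ x → cong (_*ᶻ f (x + k * t)) (sym (periodic-* (e-period t u ut f p) k x))))) ⟩
      + t *ᶻ ∑ u (λ k → ∑ n (λ x → E (x + k * t) *ᶻ f (x + k * t))) ≡⟨ cong (+ t *ᶻ_) (∑-cong u (λ k → ∑-shift n (λ x → E x *ᶻ f x) (λ x → cong₂ _*ᶻ_ (e-periodic t u f p x) (p x)) (k * t))) ⟩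
      + t *ᶻ ∑ u (λ k → inner E f) ≡⟨ cong (+ t *ᶻ_) (∑-const u (inner E f)) ⟩
      + t *ᶻ (+ u *ᶻ inner E f) ≡⟨ lem₂ (+ t) (+ u) (inner E f) ⟩
      + u *ᶻ + t *ᶻ inner E f ≡⟨ cong (_*ᶻ inner E f) (trans (sym (ℤ.pos-* u t)) (cong +_ ut)) ⟩
      + n *ᶻ inner E f ∎
      where
      E : ℕ → ℤ
      E = e t u f
      lem : ∀ a b c → a *ᶻ (b *ᶻ c) ≡ b *ᶻ (a *ᶻ c)
      lem = ℤ-ring
      lem₂ : ∀ a b c → a *ᶻ (b *ᶻ c) ≡ b *ᶻ a *ᶻ c
      lem₂ = ℤ-ring

    pythagoras : ∀ t u → u * t ≡ n → ∀ f → Periodic n f →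
      norm (λ x → + n *ᶻ f x -ᶻ e t u f x) + norm (e t u f) ≡ n * n * norm f
    pythagoras t u ut f p = ℤ.+-injective (begin
      + (norm R + norm E) ≡⟨ ℤ.pos-+ (norm R) (norm E) ⟩
      + norm R +ᶻ + norm E ≡⟨ cong₂ _+ᶻ_ (norm-inner R) (norm-inner E) ⟩
      inner R R +ᶻ inner E E ≡⟨ cong (_+ᶻ inner E E) expand ⟩
      + n *ᶻ + n *ᶻ inner f f +ᶻ ((ℤ.- (+ 2) *ᶻ + n) *ᶻ inner E f +ᶻ inner E E) +ᶻ inner E E
                                                             ≡⟨ cong (λ z → + n *ᶻ + n *ᶻ inner f f +ᶻ ((ℤ.- (+ 2) *ᶻ + n) *ᶻ inner E f +ᶻ z) +ᶻ z) (e-inner t u ut f p) ⟩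
      _ ≡⟨ lem₂ (+ n) (inner f f) (inner E f) ⟩
      + n *ᶻ + n *ᶻ inner f f ≡⟨ cong₂ _*ᶻ_ (sym (ℤ.pos-* n n)) (sym (norm-inner f)) ⟩
      + (n * n) *ᶻ + norm f ≡⟨ ℤ.pos-* (n * n) (norm f) ⟨
      + (n * n * norm f) ∎)
      where
      E R : ℕ → ℤ
      E = e t u f
      R x = + n *ᶻ f x -ᶻ e t u f x
      lem : ∀ N a b → (N *ᶻ a -ᶻ b) *ᶻ (N *ᶻ a -ᶻ b) ≡ N *ᶻ N *ᶻ (a *ᶻ a) +ᶻ ((ℤ.- (+ 2) *ᶻ N) *ᶻ (b *ᶻ a) +ᶻ b *ᶻ b)
      lem = ℤ-ring
      lem₂ : ∀ N a b → N *ᶻ N *ᶻ a +ᶻ ((ℤ.- (+ 2) *ᶻ N) *ᶻ b +ᶻ N *ᶻ b) +ᶻ N *ᶻ b ≡ N *ᶻ N *ᶻ a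
      lem₂ = ℤ-ring
      expand : inner R R ≡ + n *ᶻ + n *ᶻ inner f f +ᶻ ((ℤ.- (+ 2) *ᶻ + n) *ᶻ inner E f +ᶻ inner E E)
      expand = begin
        inner R R ≡⟨ ∑-cong n (λ x → lem (+ n) (f x) (E x)) ⟩
        ∑ n (λ x → f² x +ᶻ (Ef x +ᶻ E² x)) ≡⟨ ∑-+ n f² (λ x → Ef x +ᶻ E² x) ⟩
        ∑ n f² +ᶻ ∑ n (λ x → Ef x +ᶻ E² x) ≡⟨ cong₂ _+ᶻ_ (∑-*ˡ n (+ n *ᶻ + n) (λ x → f x *ᶻ f x)) (trans (∑-+ n Ef E²) (cong (_+ᶻ inner E E) (∑-*ˡ n (ℤ.- (+ 2) *ᶻ + n) (λ x → E x *ᶻ f x)))) ⟩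
        + n *ᶻ + n *ᶻ inner f f +ᶻ ((ℤ.- (+ 2) *ᶻ + n) *ᶻ inner E f +ᶻ inner E E) ∎
        where
        f² Ef E² : ℕ → ℤ
        f² x = + n *ᶻ + n *ᶻ (f x *ᶻ f x)
        Ef x = (ℤ.- (+ 2) *ᶻ + n) *ᶻ (E x *ᶻ f x)
        E² x = E x *ᶻ E x

    norm-e≤ : ∀ t u → u * t ≡ n → ∀ f → Periodic n f → norm (e t u f) ≤ n * n * norm f
    norm-e≤ t u ut f p = subst (norm (e t u f) ≤_) (pythagoras t u ut f p) (ℕ.m≤n+m _ _)

    norm-res≤ : ∀ t u → u * t ≡ n → ∀ f → Periodic n f → norm (λ x → + n *ᶻ f x -ᶻ e t u f x) ≤ n * n * norm f
    norm-res≤ t u ut f p = subst (norm (λ x → + n *ᶻ f x -ᶻ e t u f x) ≤_) (pythagoras t u ut f p) (ℕ.m≤m+n _ _)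

    -- Up to a power of n, the product of (1 - E_t) over the divisors t ≤ j of n, applied to f.
    Res : ℕ → (ℕ → ℤ) → ℕ → ℤ
    Res zero    f = f
    Res (suc j) f with suc j ∣? n
    ... | yes (divides u _) = λ x → + n *ᶻ Res j f x -ᶻ e (suc j) u (Res j f) x
    ... | no _              = Res j f

    Res-cong : ∀ j {f g} → (∀ x → f x ≡ g x) → ∀ x → Res j f x ≡ Res j g x
    Res-cong zero    h x = h x
    Res-cong (suc j) h x with suc j ∣? n
    ... | yes (divides u _) = cong₂ (λ a b → + n *ᶻ a -ᶻ b) (Res-cong j h x) (e-cong (suc j) u (Res-cong j h) x)
    ... | no _              = Res-cong j h x

    Res-A-comm : ∀ j l d f x → Res j (A l d f) x ≡ A l d (Res j f) x
    Res-A-comm zero    l d f x = refl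
    Res-A-comm (suc j) l d f x with suc j ∣? n
    ... | yes (divides u _) = begin
      + n *ᶻ Res j (A l d f) x -ᶻ e (suc j) u (Res j (A l d f)) x ≡⟨ cong₂ (λ a b → + n *ᶻ a -ᶻ b) (Res-A-comm j l d f x) (e-cong (suc j) u (Res-A-comm j l d f) x) ⟩
      + n *ᶻ A l d (Res j f) x -ᶻ e (suc j) u (A l d (Res j f)) x ≡⟨ cong₂ _-ᶻ_ (sym (A-*ˡ l d (+ n) (Res j f) x)) (e-A-comm (suc j) u l d (Res j f) x) ⟩
      A l d (λ y → + n *ᶻ Res j f y) x -ᶻ A l d (e (suc j) u (Res j f)) x ≡⟨ A-- l d (λ y → + n *ᶻ Res j f y) (e (suc j) u (Res j f)) x ⟨
      A l d (λ y → + n *ᶻ Res j f y -ᶻ e (suc j) u (Res j f) y) x ∎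
    ... | no _ = Res-A-comm j l d f x

    Res-periodic : ∀ j f → Periodic n f → Periodic n (Res j f)
    Res-periodic zero    f p x = p x
    Res-periodic (suc j) f p x with suc j ∣? n
    ... | yes (divides u _) = cong₂ (λ a b → + n *ᶻ a -ᶻ b) (Res-periodic j f p x) (e-periodic (suc j) u (Res j f) (Res-periodic j f p) x)
    ... | no _              = Res-periodic j f p x

    e-- : ∀ t u c f g x → e t u (λ y → c *ᶻ f y -ᶻ g y) x ≡ c *ᶻ e t u f x -ᶻ e t u g x
    e-- t u c f g x = trans (cong (+ t *ᶻ_) (trans (A-- u t (λ y → c *ᶻ f y) g x) (cong (_-ᶻ A u t g x) (A-*ˡ u t c f x)))) (lem (+ t) c (A u t f x) (A u t g x))
      where
      lem : ∀ t c a b → t *ᶻ (c *ᶻ a -ᶻ b) ≡ c *ᶻ (t *ᶻ a) -ᶻ t *ᶻ b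
      lem = ℤ-ring

    e-0 : ∀ t u {f} → (∀ x → f x ≡ 0ℤ) → ∀ x → e t u f x ≡ 0ℤ
    e-0 t u h x = trans (cong (+ t *ᶻ_) (trans (∑-cong u (λ k → h _)) (∑-0 u))) (ℤ.*-zeroʳ (+ t))

    -- The factor belonging to `s` itself produces n E - E E for E = `e s u`, which vanishes because
    -- E multiplies `s`-periodic functions by n. Every later factor commutes with E and so preserves
    -- the vanishing.
    Res-annihilate : ∀ j s u → u * s ≡ n → s ≤ j → 0 < s → ∀ f → Periodic n f → ∀ x → e s u (Res j f) x ≡ 0ℤ
    Res-annihilate zero    zero    u us s≤j () f p x
    Res-annihilate (suc j) s u us s≤j 0<s f p x with suc j ∣? n | ℕ.m≤n⇒m<n∨m≡n s≤j
    ... | yes (divides v eq) | inj₁ (s≤s s≤j') = begin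
      e s u (λ y → + n *ᶻ Res j f y -ᶻ e (suc j) v (Res j f) y) x ≡⟨ e-- s u (+ n) (Res j f) (e (suc j) v (Res j f)) x ⟩
      + n *ᶻ e s u (Res j f) x -ᶻ e s u (e (suc j) v (Res j f)) x ≡⟨ cong₂ (λ a b → + n *ᶻ a -ᶻ b) (IH x) (trans (e-comm s u (suc j) v (Res j f) x) (e-0 (suc j) v IH x)) ⟩
      + n *ᶻ 0ℤ -ᶻ 0ℤ ≡⟨ cong (_-ᶻ 0ℤ) (ℤ.*-zeroʳ (+ n)) ⟩
      0ℤ ∎
      where
      IH : ∀ x → e s u (Res j f) x ≡ 0ℤ
      IH = Res-annihilate j s u us s≤j' 0<s f p
    ... | yes (divides v eq) | inj₂ refl = begin
      e s u (λ y → + n *ᶻ Res j f y -ᶻ e s v (Res j f) y) x ≡⟨ cong (λ w → e s u (λ y → + n *ᶻ Res j f y -ᶻ e s w (Res j f) y) x) v≡u ⟩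
      e s u (λ y → + n *ᶻ Res j f y -ᶻ e s u (Res j f) y) x ≡⟨ e-- s u (+ n) (Res j f) (e s u (Res j f)) x ⟩
      + n *ᶻ e s u (Res j f) x -ᶻ e s u (e s u (Res j f)) x ≡⟨ cong (λ z → + n *ᶻ e s u (Res j f) x -ᶻ z) (e-fix s u us _ (e-period s u us _ (Res-periodic j f p)) x) ⟩
      + n *ᶻ e s u (Res j f) x -ᶻ + n *ᶻ e s u (Res j f) x ≡⟨ ℤ.+-inverseʳ (+ n *ᶻ e s u (Res j f) x) ⟩
      0ℤ ∎
      where
      v≡u : v ≡ u
      v≡u = ℕ.*-cancelʳ-≡ v u s (trans (sym eq) (sym us))
    ... | no ¬d | inj₁ (s≤s s≤j') = Res-annihilate j s u us s≤j' 0<s f p x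
    ... | no ¬d | inj₂ refl = ⊥-elim (¬d (divides u (sym us)))

    count : ℕ → ℕ
    count = #upTo (λ r → suc r ∣? n)

    -- Each factor of `Res` carries a multiplier n, hence n^2 on squared norms; this is the
    -- accumulated normalisation.
    scale : ℕ → ℕ
    scale j = (n * n) ^ count j

    norm-Res≤ : ∀ j f → Periodic n f → norm (Res j f) ≤ scale j * norm f
    norm-Res≤ zero    f p = ℕ.≤-reflexive (sym (ℕ.*-identityˡ _))
    norm-Res≤ (suc j) f p with suc j ∣? n
    ... | yes d@(divides u eq) = ℕ.≤-trans (norm-res≤ (suc j) u (sym eq) (Res j f) (Res-periodic j f p))
      (ℕ.≤-trans (ℕ.*-monoʳ-≤ (n * n) (norm-Res≤ j f p))
      (ℕ.≤-reflexive (trans (sym (ℕ.*-assoc (n * n) (scale j) (norm f))) (cong (λ z → (n * n) ^ z * norm f) (sym (#upTo-yes (λ r → suc r ∣? n) j d))))))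
    ... | no ¬d = ℕ.≤-trans (norm-Res≤ j f p) (ℕ.≤-reflexive (cong (λ z → (n * n) ^ z * norm f) (sym (#upTo-no (λ r → suc r ∣? n) j ¬d))))

    norm-bounded : ∀ g D → (∀ a → ∣ g a ∣ ≤ D) → norm g ≤ n * (D * D)
    norm-bounded g D h = drop‿+≤+ (subst₂ _≤ᶻ_ (sym (norm-inner g)) (trans (∑-const n (+ (D * D))) (sym (ℤ.pos-* n (D * D))))
      (∑-mono< n (λ k _ → subst (_≤ᶻ + (D * D)) (sym (sq (g k))) (+≤+ (ℕ.*-mono-≤ (h k) (h k))))))
      where
      sq : ∀ z → z *ᶻ z ≡ + (∣ z ∣ * ∣ z ∣)
      sq (+ m)    = sym (ℤ.pos-* m m)
      sq -[1+ m ] = refl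

    norm-scale : ∀ c g → norm (λ x → + c *ᶻ g x) ≡ c * c * norm g
    norm-scale c g = ℤ.+-injective (begin
      + norm (λ x → + c *ᶻ g x) ≡⟨ norm-inner (λ x → + c *ᶻ g x) ⟩
      ∑ n (λ x → + c *ᶻ g x *ᶻ (+ c *ᶻ g x)) ≡⟨ ∑-cong n (λ x → lem (+ c) (g x)) ⟩
      ∑ n (λ x → + c *ᶻ + c *ᶻ (g x *ᶻ g x)) ≡⟨ ∑-*ˡ n (+ c *ᶻ + c) (λ x → g x *ᶻ g x) ⟩
      + c *ᶻ + c *ᶻ inner g g ≡⟨ cong₂ _*ᶻ_ (sym (ℤ.pos-* c c)) (sym (norm-inner g)) ⟩
      + (c * c) *ᶻ + norm g ≡⟨ ℤ.pos-* (c * c) (norm g) ⟨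
      + (c * c * norm g) ∎)
      where
      lem : ∀ c a → c *ᶻ a *ᶻ (c *ᶻ a) ≡ c *ᶻ c *ᶻ (a *ᶻ a)
      lem = ℤ-ring

    -- F is spanned by the characters of exact order r.
    record Primitive (r u : ℕ) (F : ℕ → ℤ) : Set where
      field
        r*u     : u * r ≡ n
        period  : Periodic r F
        killed  : ∀ s v → v * s ≡ n → 0 < s → s < r → ∀ x → e s v F x ≡ 0ℤ

      u≢0 : u ≢ 0
      u≢0 refl = ℕ.≢-nonZero⁻¹ n (sym r*u)

      -- `killed` speaks of a coset in ℤ_n, with `u * π` terms. By `r`-periodicity that sum consists
      -- of `u` copies of the coset sum in ℤ_r, and `u` is nonzero.
      coset-sum-0 : ∀ g π → π * g ≡ r → 0 < g → g < r → ∀ x → A π g F x ≡ 0ℤ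
      coset-sum-0 g π πg 0<g g<r x with ℤ.i*j≡0⇒i≡0∨j≡0 (+ g) (killed g (u * π) (trans (ℕ.*-assoc u π g) (trans (cong (u *_) πg) r*u)) 0<g g<r x)
      ... | inj₁ g≡0 = ⊥-elim (ℕ.<⇒≢ 0<g (sym (ℤ.+-injective g≡0)))
      ... | inj₂ eq with ℤ.i*j≡0⇒i≡0∨j≡0 (+ u) (trans (sym fold) eq)
        where
        lem : ∀ x i π j g → x + (i * π + j) * g ≡ x + j * g + i * (π * g)
        lem = ℕ-ring
        fold : A (u * π) g F x ≡ + u *ᶻ A π g F x
        fold = begin
          A (u * π) g F x ≡⟨ ∑-blocks u π _ ⟩
          ∑ u (λ i → ∑ π (λ j → F (x + (i * π + j) * g))) ≡⟨ ∑-cong u (λ i → ∑-cong π (λ j → trans (cong F (trans (lem x i π j g) (cong (λ z → x + j * g + i * z) πg))) (periodic-* period i _))) ⟩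
          ∑ u (λ i → A π g F x) ≡⟨ ∑-const u _ ⟩
          + u *ᶻ A π g F x ∎
      ...   | inj₁ u≡0 = ⊥-elim (u≢0 (ℤ.+-injective u≡0))
      ...   | inj₂ r₀  = r₀

      cycle-sum-0 : ∀ d → 0 < d → d < r → Σ ℕ λ π → (π * gcd r d ≡ r) × (∀ x → A π d F x ≡ 0ℤ)
      cycle-sum-0 d@(suc _) 0<d d<r with gcd[m,n]∣m r d
      ... | divides π r≡ = π , sym r≡ , λ x →
        trans (cycle-sum π g d {{π≢0}} gcd≡ F (subst (λ z → Periodic z F) r≡ period) x)
          (coset-sum-0 g π (sym r≡) 0<g (ℕ.≤-<-trans (∣⇒≤ (gcd[m,n]∣n r d)) d<r) x)
        where
        g : ℕ
        g = gcd r d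
        gcd≡ : gcd (π * g) d ≡ g
        gcd≡ = cong (λ z → gcd z d) (sym r≡)
        π≢0 : NonZero π
        π≢0 = ℕ.≢-nonZero (λ { refl → ℕ.<⇒≢ (ℕ.<-trans 0<d d<r) (sym r≡) })
        0<g : 0 < g
        0<g = ℕ.n≢0⇒n>0 (gcd[m,n]≢0 r d (inj₂ λ ()))

      -- The `r` steps make up `gcd r j` complete cycles, each with sum zero.
      all-steps-0 : ∀ j → 0 < j → j < r → ∀ x → A r j F x ≡ 0ℤ
      all-steps-0 j 0<j j<r x with cycle-sum-0 j 0<j j<r
      ... | π , πg , z = trans (cong (λ y → A y j F x) (trans (sym πg) (ℕ.*-comm π (gcd r j)))) (A-drop j F (gcd r j) π 0 z x)

      -- Translation by `k * d` leaves only the offset j = l - k. For a fixed `x` the sum over all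
      -- `d` of `F (x + d * j)` is a walk with the fixed step `j`: difference and index exchange
      -- their roles, and `all-steps-0` applies.
      correlation-0 : ∀ k l → k < l → l < r → ∑ r (λ d → inner (λ x → F (x + k * d)) (λ x → F (x + l * d))) ≡ 0ℤ
      correlation-0 k l k<l l<r = begin
        ∑ r (λ d → ∑ n (λ x → F (x + k * d) *ᶻ F (x + l * d))) ≡⟨ ∑-cong r (λ d → ∑-cong n (λ x → cong (λ z → F (x + k * d) *ᶻ F z) (eq x d))) ⟩
        ∑ r (λ d → ∑ n (λ x → F (x + k * d) *ᶻ F (x + k * d + d * j))) ≡⟨ ∑-cong r (λ d → ∑-shift n (λ x → F x *ᶻ F (x + d * j)) (λ x → cong₂ _*ᶻ_ (periodₙ x) (trans (cong F (+-swapʳ x n (d * j))) (periodₙ _))) (k * d)) ⟩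
        ∑ r (λ d → ∑ n (λ x → F x *ᶻ F (x + d * j))) ≡⟨ ∑-swap r n _ ⟩
        ∑ n (λ x → ∑ r (λ d → F x *ᶻ F (x + d * j))) ≡⟨ ∑-cong n (λ x → trans (∑-*ˡ r (F x) (λ d → F (x + d * j))) (trans (cong (F x *ᶻ_) (all-steps-0 j 0<j j<r x)) (ℤ.*-zeroʳ (F x)))) ⟩
        ∑ n (λ x → 0ℤ) ≡⟨ ∑-0 n ⟩
        0ℤ ∎
        where
        j : ℕ
        j = l ∸ k
        0<j : 0 < j
        0<j = ℕ.m<n⇒0<n∸m k<l
        j<r : j < r
        j<r = ℕ.≤-<-trans (ℕ.m∸n≤m l k) l<r
        periodₙ : Periodic n F
        periodₙ = subst (λ z → Periodic z F) r*u (periodic-* period u)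
        lem : ∀ x k d j → x + (k + j) * d ≡ x + k * d + d * j
        lem = ℕ-ring
        eq : ∀ x d → x + l * d ≡ x + k * d + d * j
        eq x d = trans (cong (λ z → x + z * d) (sym (ℕ.m+[n∸m]≡n (ℕ.<⇒≤ k<l)))) (lem x k d j)

      total-energy : ∀ l → l ≤ r → ∑ r (λ d → inner (A l d F) (A l d F)) ≡ + l *ᶻ (+ r *ᶻ inner F F)
      total-energy zero    _   = trans (∑-cong r (λ d → ∑-0 n)) (∑-0 r)
      total-energy (suc l) l<r = begin
        ∑ r (λ d → inner (A (suc l) d F) (A (suc l) d F))
          ≡⟨ ∑-cong r (λ d → trans (∑-cong n (λ x → binomial (A l d F x) (F (x + l * d))))
               (trans (∑-+ n (λ x → A l d F x *ᶻ A l d F x) (λ x → + 2 *ᶻ (A l d F x *ᶻ F (x + l * d)) +ᶻ F (x + l * d) *ᶻ F (x + l * d)))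
               (cong (inner (A l d F) (A l d F) +ᶻ_) (trans (∑-+ n (λ x → + 2 *ᶻ (A l d F x *ᶻ F (x + l * d))) (λ x → F (x + l * d) *ᶻ F (x + l * d)))
                 (cong₂ _+ᶻ_ (∑-*ˡ n (+ 2) (λ x → A l d F x *ᶻ F (x + l * d))) (∑-shift n (λ x → F x *ᶻ F x) (λ x → cong₂ _*ᶻ_ (periodₙ x) (periodₙ x)) (l * d))))))) ⟩
        ∑ r (λ d → inner (A l d F) (A l d F) +ᶻ (+ 2 *ᶻ cross d +ᶻ inner F F))
          ≡⟨ trans (∑-+ r (λ d → inner (A l d F) (A l d F)) (λ d → + 2 *ᶻ cross d +ᶻ inner F F)) (cong (∑ r (λ d → inner (A l d F) (A l d F)) +ᶻ_) (trans (∑-+ r (λ d → + 2 *ᶻ cross d) (λ d → inner F F)) (cong₂ _+ᶻ_ (∑-*ˡ r (+ 2) cross) (∑-const r (inner F F))))) ⟩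
        ∑ r (λ d → inner (A l d F) (A l d F)) +ᶻ (+ 2 *ᶻ ∑ r cross +ᶻ + r *ᶻ inner F F)
          ≡⟨ cong₂ (λ a b → a +ᶻ (+ 2 *ᶻ b +ᶻ + r *ᶻ inner F F)) (total-energy l (ℕ.<⇒≤ l<r)) cross-0 ⟩
        + l *ᶻ (+ r *ᶻ inner F F) +ᶻ (+ 2 *ᶻ 0ℤ +ᶻ + r *ᶻ inner F F)
          ≡⟨ lem (+ l) (+ r *ᶻ inner F F) ⟩
        + suc l *ᶻ (+ r *ᶻ inner F F) ∎
        where
        binomial : ∀ a b → (a +ᶻ b) *ᶻ (a +ᶻ b) ≡ a *ᶻ a +ᶻ (+ 2 *ᶻ (a *ᶻ b) +ᶻ b *ᶻ b)
        binomial = ℤ-ring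
        lem : ∀ a b → a *ᶻ b +ᶻ (+ 2 *ᶻ 0ℤ +ᶻ b) ≡ (1ℤ +ᶻ a) *ᶻ b
        lem = ℤ-ring
        periodₙ : Periodic n F
        periodₙ = subst (λ z → Periodic z F) r*u (periodic-* period u)
        cross : ℕ → ℤ
        cross d = inner (A l d F) (λ x → F (x + l * d))
        cross-0 : ∑ r cross ≡ 0ℤ
        cross-0 = begin
          ∑ r (λ d → ∑ n (λ x → A l d F x *ᶻ F (x + l * d))) ≡⟨ ∑-cong r (λ d → trans (∑-cong n (λ x → sym (∑-*ʳ l (F (x + l * d)) (λ k → F (x + k * d))))) (∑-swap n l _)) ⟩
          ∑ r (λ d → ∑ l (λ k → ∑ n (λ x → F (x + k * d) *ᶻ F (x + l * d)))) ≡⟨ ∑-swap r l _ ⟩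
          ∑ l (λ k → ∑ r (λ d → ∑ n (λ x → F (x + k * d) *ᶻ F (x + l * d)))) ≡⟨ ∑-cong< l (λ k k<l → correlation-0 k l k<l l<r) ⟩
          ∑ l (λ k → 0ℤ) ≡⟨ ∑-0 l ⟩
          0ℤ ∎

      energy-bound : ∀ l B → 0 < r → l ≤ r → (∀ d → 0 < d → d < r → norm (A l d F) ≤ B) → l * (r * norm F) ≤ l * l * norm F + r * B
      energy-bound l B 0<r l≤r h = ℕ.≤-trans (drop‿+≤+ (subst₂ _≤ᶻ_ lhs rhs
          (ℤ.+-monoʳ-≤ (inner (A l 0 F) (A l 0 F)) (∑-mono< j (λ i i<j → subst (_≤ᶻ + B) (norm-inner (A l (suc i) F)) (+≤+ (h (suc i) (s≤s z≤n) (subst (suc i <_) sj≡r (s≤s i<j)))))))))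
          (ℕ.+-monoʳ-≤ (l * l * norm F) (ℕ.*-monoˡ-≤ B (subst (j ≤_) sj≡r (ℕ.n≤1+n j))))
        where
        j : ℕ
        j = ℕ.pred r
        sj≡r : suc j ≡ r
        sj≡r = ℕ.suc-pred r {{ℕ.>-nonZero 0<r}}
        lhs : inner (A l 0 F) (A l 0 F) +ᶻ ∑ j (λ i → inner (A l (suc i) F) (A l (suc i) F)) ≡ + (l * (r * norm F))
        lhs = begin
          inner (A l 0 F) (A l 0 F) +ᶻ ∑ j (λ i → inner (A l (suc i) F) (A l (suc i) F)) ≡⟨ ∑-cons j (λ d → inner (A l d F) (A l d F)) ⟨
          ∑ (suc j) (λ d → inner (A l d F) (A l d F)) ≡⟨ cong (λ z → ∑ z (λ d → inner (A l d F) (A l d F))) sj≡r ⟩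
          ∑ r (λ d → inner (A l d F) (A l d F)) ≡⟨ total-energy l l≤r ⟩
          + l *ᶻ (+ r *ᶻ inner F F) ≡⟨ cong (λ z → + l *ᶻ (+ r *ᶻ z)) (norm-inner F) ⟨
          + l *ᶻ (+ r *ᶻ + norm F) ≡⟨ cong (+ l *ᶻ_) (ℤ.pos-* r (norm F)) ⟨
          + l *ᶻ + (r * norm F) ≡⟨ ℤ.pos-* l (r * norm F) ⟨
          + (l * (r * norm F)) ∎
        zero-step : ∀ x → A l 0 F x ≡ + l *ᶻ F x
        zero-step x = trans (∑-cong l (λ k → cong F (trans (cong (λ z → x + z) (ℕ.*-zeroʳ k)) (ℕ.+-identityʳ x)))) (∑-const l (F x))
        rhs : inner (A l 0 F) (A l 0 F) +ᶻ ∑ j (λ i → + B) ≡ + (l * l * norm F + j * B)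
        rhs = begin
          inner (A l 0 F) (A l 0 F) +ᶻ ∑ j (λ i → + B) ≡⟨ cong₂ _+ᶻ_ (trans (sym (norm-inner (A l 0 F))) (cong +_ (trans (norm-cong zero-step) (norm-scale l F)))) (trans (∑-const j (+ B)) (sym (ℤ.pos-* j B))) ⟩
          + (l * l * norm F) +ᶻ + (j * B) ≡⟨ ℤ.pos-+ (l * l * norm F) (j * B) ⟨
          + (l * l * norm F + j * B) ∎

    -- With l and m the lower and upper half of `r`, removing the contribution of the zero
    -- difference leaves l m x ≤ r B. The constant is 3 times 2, from r ≤ 3 l (sharp at r = 3) and r
    -- ≤ 2 m.
    half-energy : ∀ r x B → 2 ≤ r → ℕ.⌊ r /2⌋ * (r * x) ≤ ℕ.⌊ r /2⌋ * ℕ.⌊ r /2⌋ * x + r * B → r * x ≤ 6 * B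
    half-energy (suc zero) x B (s≤s ())
    half-energy r@(suc (suc i)) x B _ h = ℕ.*-cancelˡ-≤ r (ℕ.≤-trans (ℕ.≤-trans
        (ℕ.≤-reflexive (sym (ℕ.*-assoc r r x)))
        (ℕ.*-monoˡ-≤ x (ℕ.*-mono-≤ r≤3l r≤2m)))
        (ℕ.≤-trans (ℕ.≤-reflexive (lem₁ l m x)) (ℕ.≤-trans (ℕ.*-monoʳ-≤ 6 lmx≤rB) (ℕ.≤-reflexive (lem₂ r B)))))
      where
      l m : ℕ
      l = ℕ.⌊ r /2⌋
      m = ℕ.⌈ r /2⌉
      l+m : l + m ≡ r
      l+m = ℕ.⌊n/2⌋+⌈n/2⌉≡n r
      lem₁ : ∀ l m x → 3 * l * (2 * m) * x ≡ 6 * (l * m * x)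
      lem₁ = ℕ-ring
      lem₂ : ∀ r B → 6 * (r * B) ≡ r * (6 * B)
      lem₂ = ℕ-ring
      lem₃ : ∀ l m x → l * ((l + m) * x) ≡ l * l * x + l * m * x
      lem₃ = ℕ-ring
      lem₄ : ∀ l → l + 2 * l ≡ 3 * l
      lem₄ = ℕ-ring
      r≤2m : r ≤ 2 * m
      r≤2m = subst₂ _≤_ l+m (cong (λ z → m + z) (sym (ℕ.+-identityʳ m))) (ℕ.+-monoˡ-≤ m (ℕ.⌊n/2⌋≤⌈n/2⌉ r))
      m≤2l : m ≤ 2 * l
      m≤2l = ℕ.≤-trans (ℕ.⌊n/2⌋-mono (ℕ.n≤1+n (suc r))) (ℕ.≤-trans (ℕ.≤-reflexive (ℕ.+-comm 1 l)) (ℕ.+-monoʳ-≤ l (s≤s z≤n)))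
      r≤3l : r ≤ 3 * l
      r≤3l = subst₂ _≤_ l+m (lem₄ l) (ℕ.+-monoʳ-≤ l m≤2l)
      lmx≤rB : l * m * x ≤ r * B
      lmx≤rB = ℕ.+-cancelˡ-≤ (l * l * x) _ _ (subst (_≤ l * l * x + r * B) (trans (cong (λ z → l * (z * x)) (sym l+m)) (lem₃ l m x)) h)

    module Bounded (f : ℕ → ℤ) (per : Periodic n f) (D : ℕ) (HD : ∀ a d l → l * gcd n d ≤ n → ∣ A l d f a ∣ ≤ D) where

      module _ (j u : ℕ) (u*r : u * suc j ≡ n) where

        r : ℕ
        r = suc j

        F : ℕ → ℤ
        F = e r u (Res j f)

        B : ℕ
        B = n * n * (scale j * (n * (D * D)))

        F-primitive : Primitive r u F
        F-primitive = record
          { r*u    = u*r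
          ; period = e-period r u u*r (Res j f) (Res-periodic j f per)
          ; killed = λ { s v vs 0<s (s≤s s≤j) x → trans (e-comm s v r u (Res j f) x) (e-0 r u (Res-annihilate j s v vs s≤j 0<s f per) x) }
          }

        open Primitive F-primitive hiding (r*u)

        -- `F` is `r` times the residual of the coset sum `A u r f`, which is bounded by `D`
        -- pointwise; u r = n turns the product u^2 r^2 into the n^2 of `B`.
        coset-bound : u * u * norm F ≤ B
        coset-bound = ℕ.≤-trans (ℕ.*-monoʳ-≤ (u * u) norm-F≤) (ℕ.≤-reflexive (trans (lem u r _) (cong (λ z → z * z * (scale j * (n * (D * D)))) u*r)))
          where
          lem : ∀ u r z → u * u * (r * r * z) ≡ u * r * (u * r) * z
          lem = ℕ-ring
          norm-F≤ : norm F ≤ r * r * (scale j * (n * (D * D)))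
          norm-F≤ = ℕ.≤-trans
            (ℕ.≤-reflexive (trans (norm-cong (λ x → cong (+ r *ᶻ_) (sym (Res-A-comm j u r f x)))) (norm-scale r (Res j (A u r f)))))
            (ℕ.*-monoʳ-≤ (r * r) (ℕ.≤-trans (norm-Res≤ j (A u r f) (A-periodic u r f per)) (ℕ.*-monoʳ-≤ (scale j)
              (norm-bounded (A u r f) D (λ a → HD a r u (ℕ.≤-trans (ℕ.*-monoʳ-≤ u (∣⇒≤ (gcd[m,n]∣n n r))) (ℕ.≤-reflexive u*r)))))))

        -- By commutation the progression operator acts on `f` first, where `HD` bounds it at every
        -- point; projection and residual then increase the norm by no more than their scaling.
        norm-AF≤ : ∀ l d → l * gcd n d ≤ n → norm (A l d F) ≤ B
        norm-AF≤ l d h = ℕ.≤-trans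
          (ℕ.≤-reflexive (norm-cong (λ x → trans (sym (e-A-comm r u l d (Res j f) x)) (e-cong r u (λ y → sym (Res-A-comm j l d f y)) x))))
          (ℕ.≤-trans (norm-e≤ r u u*r (Res j (A l d f)) (Res-periodic j (A l d f) (A-periodic l d f per)))
          (ℕ.*-monoʳ-≤ (n * n) (ℕ.≤-trans (norm-Res≤ j (A l d f) (A-periodic l d f per)) (ℕ.*-monoʳ-≤ (scale j)
            (norm-bounded (A l d f) D (λ a → HD a d l h))))))

        -- A long progression may run over itself in ℤ_n, where `HD` says nothing. Complete cycles
        -- of `F` vanish, so only `l % π` terms matter, and these fit because `gcd n d` divides
        -- `u * gcd r d`.
        step-bound : ∀ l d → 0 < d → d < r → norm (A l d F) ≤ B
        step-bound l d 0<d d<r with cycle-sum-0 d 0<d d<r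
        ... | zero  , () , z
        ... | π@(suc _) , πg , z = ℕ.≤-trans
          (ℕ.≤-reflexive (norm-cong (λ x → trans (cong (λ y → A y d F x) (m≡m%n+[m/n]*n l π)) (A-drop d F (l / π) π (l % π) z x))))
          (norm-AF≤ (l % π) d (ℕ.≤-trans (ℕ.*-mono-≤ (ℕ.<⇒≤ (m%n<n l π)) gcd≤) (ℕ.≤-reflexive (trans (lem π u (gcd r d)) (trans (cong (u *_) πg) u*r)))))
          where
          lem : ∀ a b c → a * (b * c) ≡ b * (a * c)
          lem = ℕ-ring
          u*g≢0 : NonZero (u * gcd r d)
          u*g≢0 = ℕ.m*n≢0 u (gcd r d) {{ℕ.≢-nonZero u≢0}} {{ℕ.≢-nonZero (gcd[m,n]≢0 r d (inj₁ λ ()))}}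
          gcd≤ : gcd n d ≤ u * gcd r d
          gcd≤ = ∣⇒≤ {{u*g≢0}} (subst (gcd n d ∣_) (sym (trans (c*gcd[m,n]≡gcd[cm,cn] u r d) (cong (λ z → gcd z (u * d)) u*r)))
            (gcd-greatest (gcd[m,n]∣m n d) (∣-trans (gcd[m,n]∣n n d) (n∣m*n u))))

        norm-F≤ : norm F ≤ B
        norm-F≤ = subst (_≤ B) (norm-cong (λ x → trans (ℤ.+-identityˡ _) (cong F (ℕ.+-identityʳ x)))) (norm-AF≤ 1 0 (ℕ.≤-reflexive (trans (ℕ.*-identityˡ _) (Data.Nat.GCD.gcd-identityʳ n))))

        r-bound : r * norm F ≤ 6 * B
        r-bound with ℕ._≤?_ 2 r
        ... | yes 2≤r = half-energy r (norm F) B 2≤r (energy-bound ℕ.⌊ r /2⌋ B (s≤s z≤n) (ℕ.⌊n/2⌋≤n r) (λ d 0<d d<r → step-bound ℕ.⌊ r /2⌋ d 0<d d<r))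
        ... | no  2≰r = ℕ.*-mono-≤ {r} {6} (ℕ.≤-trans (ℕ.≤-pred (ℕ.≰⇒> 2≰r)) (s≤s z≤n)) norm-F≤

        divisor-bound : (u * u + r) * norm F ≤ 7 * B
        divisor-bound = ℕ.≤-trans (ℕ.≤-reflexive (ℕ.*-distribʳ-+ (norm F) (u * u) r)) (ℕ.+-mono-≤ coset-bound r-bound)

      exists-divisor : n ≤ norm f → Σ ℕ λ q → Σ ℕ λ r → (q * r ≡ n) × (q * q + r ≤ 7 * (D * D * numDiv n))
      exists-divisor n≤norm with ℕ.anyUpTo? P? n
        where
        P? : (j : ℕ) → Dec ((suc j ∣ n) × ((n / suc j) * (n / suc j) + suc j ≤ 7 * (D * D * numDiv n)))
        P? j = (suc j ∣? n) ×-dec (_ ≤? _)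
      ... | yes (j , _ , divides q eq , le) = q , suc j , sym eq ,
        subst (λ z → z * z + suc j ≤ 7 * (D * D * numDiv n)) (trans (cong (_/ suc j) eq) (m*n/n≡m q (suc j))) le
      -- After all d divisors the residual is 0, so the potential inequality reads d E + d ≤ d E
      -- with E = `scale n * n`.
      ... | no none = ⊥-elim (ℕ.n≮n (d * (scale n * n)) (ℕ.<-≤-trans (ℕ.m<m+n _ 0<d)
          (ℕ.≤-trans (potential n ℕ.≤-refl) (ℕ.≤-reflexive (cong (_+ d * (scale n * n)) (trans (cong (d *_) Res-n-0) (ℕ.*-zeroʳ d)))))))
        where
        d : ℕ
        d = numDiv n

        X : ℕ → ℕ
        X j = n * n * (scale j * n)

        X>0 : ∀ j → 0 < X j
        X>0 j = ℕ.n≢0⇒n>0 (ℕ.≢-nonZero⁻¹ (X j) {{ℕ.m*n≢0 (n * n) (scale j * n) {{ℕ.m*n≢0 n n}} {{ℕ.m*n≢0 (scale j) n {{ℕ.m^n≢0 (n * n) (count j) {{ℕ.m*n≢0 n n}}}}}}}})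

        -- A component with at least 1/d of the energy contradicts the failure of this divisor:
        -- `big` and `divisor-bound` would give (7 D^2 d + 1) b ≤ 7 D^2 d b, so b = 0, although
        -- `X j` is positive.
        strict : ∀ j u (eq : u * suc j ≡ n) → j < n → d * norm (e (suc j) u (Res j f)) < X j
        strict j u eq j<n = ℕ.≰⇒> λ X≤db → ℕ.<⇒≱ (X>0 j) (ℕ.≤-trans X≤db (ℕ.≤-reflexive (trans (cong (d *_) (b≡0 X≤db)) (ℕ.*-zeroʳ d))))
          where
          b : ℕ
          b = norm (e (suc j) u (Res j f))
          big : 7 * (D * D * d) < u * u + suc j
          big = ℕ.≰⇒> λ le → none (j , j<n , divides u (sym eq) ,
            subst (λ z → z * z + suc j ≤ 7 * (D * D * d)) (sym (trans (cong (_/ suc j) (sym eq)) (m*n/n≡m u (suc j)))) le)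
          lem : ∀ N c n E → 7 * (N * (c * (n * E))) ≡ 7 * E * (N * (c * n))
          lem = ℕ-ring
          lem₂ : ∀ E d b → 7 * E * (d * b) ≡ 7 * (E * d) * b
          lem₂ = ℕ-ring
          b≡0 : X j ≤ d * b → b ≡ 0
          b≡0 X≤db = ℕ.n≤0⇒n≡0 (ℕ.+-cancelʳ-≤ (7 * (D * D * d) * b) b 0 (ℕ.≤-trans (ℕ.*-monoˡ-≤ b big)
            (ℕ.≤-trans (divisor-bound j u eq) (ℕ.≤-trans (ℕ.≤-reflexive (lem (n * n) (scale j) n (D * D)))
            (ℕ.≤-trans (ℕ.*-monoʳ-≤ (7 * (D * D)) X≤db) (ℕ.≤-reflexive (lem₂ (D * D) d b)))))))

        potential : ∀ j → j ≤ n → d * (scale j * n) + count j ≤ d * norm (Res j f) + count j * (scale j * n)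
        potential zero    _   = ℕ.+-monoˡ-≤ 0 (ℕ.*-monoʳ-≤ d (ℕ.≤-trans (ℕ.≤-reflexive (ℕ.*-identityˡ n)) n≤norm))
        potential (suc j) j<n with suc j ∣? n
        ... | yes dv@(divides u eq) = subst (λ z → d * ((n * n) ^ z * n) + z ≤ d * norm (λ x → + n *ᶻ Res j f x -ᶻ e (suc j) u (Res j f) x) + z * ((n * n) ^ z * n)) (sym (#upTo-yes (λ r → suc r ∣? n) j dv))
          (potential-step n (n * n) (scale j) d (count j) (norm (Res j f)) _ (norm (e (suc j) u (Res j f)))
            (ℕ.n≢0⇒n>0 (ℕ.≢-nonZero⁻¹ (n * n) {{ℕ.m*n≢0 n n}}))
            (pythagoras (suc j) u (sym eq) (Res j f) (Res-periodic j f per)) (potential j (ℕ.<⇒≤ j<n)) (strict j u (sym eq) j<n))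
        ... | no ¬dv = subst (λ z → d * ((n * n) ^ z * n) + z ≤ d * norm (Res j f) + z * ((n * n) ^ z * n)) (sym (#upTo-no (λ r → suc r ∣? n) j ¬dv)) (potential j (ℕ.<⇒≤ j<n))

        0<n : 0 < n
        0<n = ℕ.n≢0⇒n>0 (ℕ.≢-nonZero⁻¹ n)

        0<d : 0 < d
        0<d = subst (0 <_) (trans (sym (#upTo-yes (λ r → suc r ∣? n) (ℕ.pred n) (subst (_∣ n) (sym (ℕ.suc-pred n)) (divides 1 (sym (ℕ.*-identityˡ n)))))) (cong count (ℕ.suc-pred n))) (s≤s z≤n)

        -- For the divisor n itself the cofactor is 1 and `e n 1` is multiplication by n, so being
        -- annihilated by it means being zero.
        Res-n-0 : norm (Res n f) ≡ 0
        Res-n-0 = trans (norm-cong vanish) (cong ∣_∣ (∑-0 n))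
          where
          vanish : ∀ x → Res n f x ≡ 0ℤ
          vanish x with ℤ.i*j≡0⇒i≡0∨j≡0 (+ n) (Res-annihilate n n 1 (ℕ.*-identityˡ n) ℕ.≤-refl 0<n f per x)
          ... | inj₁ n≡0 = ⊥-elim (ℕ.≢-nonZero⁻¹ n (ℤ.+-injective n≡0))
          ... | inj₂ eq  = trans (sym (trans (ℤ.+-identityˡ _) (cong (Res n f) (ℕ.+-identityʳ x)))) eq

-- The discrepancy as a minimum of maxima, and the lower bound in squared form.

module Disc where

  open Sums
  open Lower

  ∈-allVecs : ∀ {n} (χ : Vec Bool n) → χ ∈ allVecs n
  ∈-allVecs []          = here refl
  ∈-allVecs (true  ∷ χ) = ∈-++⁺ˡ (∈-map⁺ (true ∷_) (∈-allVecs χ))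
  ∈-allVecs (false ∷ χ) = ∈-++⁺ʳ _ (∈-map⁺ (false ∷_) (∈-allVecs χ))

  module _ {X : Set} (h : X → ℕ) where

    min-lower : ∀ z xs {x} → x ∈ xs → foldr (λ y acc → h y ⊓ acc) z xs ≤ h x
    min-lower z (y ∷ xs) (here refl) = ℕ.m⊓n≤m (h y) _
    min-lower z (y ∷ xs) (there x∈)  = ℕ.≤-trans (ℕ.m⊓n≤n (h y) _) (min-lower z xs x∈)

    min-attained : ∀ x₀ xs → ∃ λ x → h x ≤ foldr (λ y acc → h y ⊓ acc) (h x₀) xs
    min-attained x₀ []       = x₀ , ℕ.≤-refl
    min-attained x₀ (y ∷ xs) with ℕ.⊓-sel (h y) (foldr (λ y acc → h y ⊓ acc) (h x₀) xs)
    ... | inj₁ eq = y , ℕ.≤-reflexive (sym eq)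
    ... | inj₂ eq with min-attained x₀ xs
    ...   | x , le = x , ℕ.≤-trans le (ℕ.≤-reflexive (sym eq))

  gcd-mod : ∀ n d .{{_ : NonZero n}} → gcd n (d % n) ≡ gcd n d
  gcd-mod n d = ∣-antisym
    (gcd-greatest (gcd[m,n]∣m n (d % n)) (∣n∣m%n⇒∣m {n} {gcd n (d % n)} {d} (gcd[m,n]∣m n (d % n)) (gcd[m,n]∣n n (d % n))))
    (gcd-greatest (gcd[m,n]∣m n d) (%-presˡ-∣ {n} {gcd n d} {d} (gcd[m,n]∣n n d) (gcd[m,n]∣m n d)))

  A-mod : ∀ n .{{_ : NonZero n}} f → Periodic n f → ∀ l d a → A l (d % n) f (a % n) ≡ A l d f a
  A-mod n f p l d a = ∑-cong l λ k → trans (sym (periodic-* p (a / n + k * (d / n)) (a % n + k * (d % n))))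
    (cong f (trans (lem (a % n) (a / n) (d % n) (d / n) k n) (cong₂ (λ x y → x + k * y) (sym (m≡m%n+[m/n]*n a n)) (sym (m≡m%n+[m/n]*n d n)))))
    where
    lem : ∀ a a' d d' k n → a + k * d + (a' + k * d') * n ≡ a + a' * n + k * (d + d' * n)
    lem = ℕ-ring

  module _ (m : ℕ) where

    private
      n : ℕ
      n = suc m

    gcd≢0 : ∀ d → NonZero (gcd n d)
    gcd≢0 d = ℕ.≢-nonZero (gcd[m,n]≢0 n d (inj₁ λ ()))

    colour : Vec Bool n → ℕ → ℤ
    colour χ x = sign (lookup χ (fromℕ< (m%n<n x n)))

    colour-periodic : ∀ χ → Periodic n (colour χ)
    colour-periodic χ x = cong (λ i → sign (lookup χ i)) (fromℕ<-cong _ _ ([m+n]%n≡m%n x n) (m%n<n (x + n) n) (m%n<n x n))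

    χAP-A : ∀ χ a d l → χAP m χ a d l ≡ A l d (colour χ) a
    χAP-A χ a d zero    = refl
    χAP-A χ a d (suc l) = cong (_+ᶻ colour χ (a + l * d)) (χAP-A χ a d l)

    private
      len : ℕ → ℕ
      len d = _/_ n (gcd n d) {{gcd≢0 d}}

      APsOf : ℕ → ℕ → List (ℕ × ℕ × ℕ)
      APsOf a d = map (λ l → a , d , l) (upTo (suc (len d)))

      APsFrom : ℕ → List (ℕ × ℕ × ℕ)
      APsFrom a = concatMap (λ d → APsOf a d) (upTo n)

    ∈-allAPs : ∀ {a d l} → a < n → d < n → l * gcd n d ≤ n → (a , d , l) ∈ allAPs m
    ∈-allAPs {a} {d} {l} a<n d<n lg≤n = ∈-concat⁺′ (∈-concat⁺′ (∈-map⁺ (λ l → a , d , l) (∈-upTo⁺ (s≤s l≤))) (∈-map⁺ (λ d → APsOf a d) (∈-upTo⁺ d<n))) (∈-map⁺ APsFrom (∈-upTo⁺ a<n))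
      where
      l≤ : l ≤ len d
      l≤ = subst (_≤ len d) (m*n/n≡m l (gcd n d) {{gcd≢0 d}}) (/-monoˡ-≤ (gcd n d) {{gcd≢0 d}} lg≤n)

    allAPs-length : ∀ {a d l} → (a , d , l) ∈ allAPs m → l * gcd n d ≤ n
    allAPs-length {a} {d} {l} p with find (∈-concatMap⁻ APsFrom {xs = upTo n} p)
    ... | a' , _ , p₁ with find (∈-concatMap⁻ (λ d → APsOf a' d) {xs = upTo n} p₁)
    ... | d' , _ , p₂ with ∈-map⁻ (λ l → a' , d' , l) {xs = upTo (suc (len d'))} p₂
    ... | l' , l'∈ , refl = ℕ.≤-trans (ℕ.*-monoˡ-≤ (gcd n d) (ℕ.≤-pred (∈-upTo⁻ {suc (len d)} l'∈))) (m/n*n≤m n (gcd n d) {{gcd≢0 d}})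

    maxAP-upper : ∀ χ {a d l} → (a , d , l) ∈ allAPs m → ∣ χAP m χ a d l ∣ ≤ maxAP m χ
    maxAP-upper χ = go (allAPs m)
      where
      go : ∀ xs {a d l} → (a , d , l) ∈ xs → ∣ χAP m χ a d l ∣ ≤ foldr (λ { (a , d , l) acc → ∣ χAP m χ a d l ∣ ⊔ acc }) 0 xs
      go (_ ∷ xs) (here refl) = ℕ.m≤m⊔n _ _
      go (_ ∷ xs) (there p)   = ℕ.≤-trans (go xs p) (ℕ.m≤n⊔m _ _)

    maxAP-least : ∀ χ B → (∀ {a d l} → (a , d , l) ∈ allAPs m → ∣ χAP m χ a d l ∣ ≤ B) → maxAP m χ ≤ B
    maxAP-least χ B = go (allAPs m)
      where
      go : ∀ xs → (∀ {a d l} → (a , d , l) ∈ xs → ∣ χAP m χ a d l ∣ ≤ B) → foldr (λ { (a , d , l) acc → ∣ χAP m χ a d l ∣ ⊔ acc }) 0 xs ≤ B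
      go []       h = z≤n
      go (_ ∷ xs) h = ℕ.⊔-lub (h (here refl)) (go xs (λ p → h (there p)))

    maxAP-bounds : ∀ χ a d l → l * gcd n d ≤ n → ∣ A l d (colour χ) a ∣ ≤ maxAP m χ
    maxAP-bounds χ a d l le = subst (λ z → ∣ z ∣ ≤ maxAP m χ) (trans (χAP-A χ (a % n) (d % n) l) (A-mod n (colour χ) (colour-periodic χ) l d a))
      (maxAP-upper χ {a % n} {d % n} {l} (∈-allAPs {a % n} {d % n} {l} (m%n<n a n) (m%n<n d n) (subst (λ z → l * z ≤ n) (sym (gcd-mod n d)) le)))

  sign-square : ∀ b → sign b *ᶻ sign b ≡ 1ℤ
  sign-square true  = refl
  sign-square false = refl

  disc-lower : ∀ n → 0 < n → Σ ℕ λ q → Σ ℕ λ r → (q * r ≡ n) × (q * q + r ≤ 7 * (disc n * disc n * numDiv n))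
  disc-lower n@(suc m) _ with min-attained (maxAP m) (replicate n true) (allVecs n)
  ... | χ , le = Bounded.exists-divisor (colour m χ) (colour-periodic m χ) (disc n)
      (λ a d l h → ℕ.≤-trans (maxAP-bounds m χ a d l h) le) (ℕ.≤-reflexive (sym norm≡))
    where
    open Spectral n
    norm≡ : norm (colour m χ) ≡ n
    norm≡ = cong ∣_∣ (trans (∑-cong n (λ x → sign-square (lookup χ (fromℕ< (m%n<n x n))))) (trans (∑-const n 1ℤ) (ℤ.*-identityʳ (+ n))))

  -- (q + √r)^2 ≤ 2 (q^2 + r) ≤ 14 X, well below 64 X. After squaring, this is the inequality of
  -- arithmetic and geometric means 4 q^2 r ≤ S^2 together with S ≤ 64 X - S.
  sumSqrt-bound : ∀ q r X → q * q + r ≤ 7 * X → SumSqrtLe q r (64 * X)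
  sumSqrt-bound q r X h = ℕ.≤-trans h (ℕ.*-monoˡ-≤ X (ℕ.m≤m+n 7 57)) ,
    ℕ.≤-trans am-gm (ℕ.*-mono-≤ S≤ S≤)
    where
    S : ℕ
    S = q * q + r
    S≤ : S ≤ 64 * X ∸ S
    S≤ = ℕ.≤-trans (ℕ.≤-reflexive (sym (ℕ.m+n∸n≡m S S))) (ℕ.∸-monoˡ-≤ S (ℕ.≤-trans (ℕ.+-mono-≤ h h)
      (ℕ.≤-trans (ℕ.≤-reflexive (sym (ℕ.*-distribʳ-+ X 7 7))) (ℕ.*-monoˡ-≤ X (ℕ.m≤m+n 14 50)))))
    am-gm′ : ∀ a b → a ≤ b → 4 * a * b ≤ (a + b) * (a + b)
    am-gm′ a b a≤b with ℕ.m≤n⇒∃[o]m+o≡n a≤b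
    ... | c , refl = ℕ.≤-trans (ℕ.m≤m+n _ (c * c)) (ℕ.≤-reflexive (lem a c))
      where
      lem : ∀ a c → 4 * a * (a + c) + c * c ≡ (a + (a + c)) * (a + (a + c))
      lem = ℕ-ring
    am-gm : 4 * (q * q) * r ≤ S * S
    am-gm with ℕ.≤-total (q * q) r
    ... | inj₁ le = am-gm′ (q * q) r le
    ... | inj₂ le = subst₂ _≤_ (lem₁ r (q * q)) (cong (λ z → z * z) (ℕ.+-comm r (q * q))) (am-gm′ r (q * q) le)
      where
      lem₁ : ∀ a b → 4 * a * b ≡ 4 * b * a
      lem₁ = ℕ-ring

  lower-bound : (n : ℕ) → 0 < n → Σ ℕ (λ q → Σ ℕ (λ r → (q * r ≡ n) × SumSqrtLe q r (64 * (disc n * disc n) * numDiv n)))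
  lower-bound n 0<n with disc-lower n 0<n
  ... | q , r , qr , le = q , r , qr , subst (SumSqrtLe q r) (sym (ℕ.*-assoc 64 (disc n * disc n) (numDiv n))) (sumSqrt-bound q r (disc n * disc n * numDiv n) le)

-- Weighted pigeonhole principle and pairs of distant sign vectors.

module Pigeon where

  open Disc using (∈-allVecs)

  open ℕ.≤-Reasoning

  ∑ᴸ : {X : Set} → (X → ℕ) → List X → ℕ
  ∑ᴸ f []       = 0
  ∑ᴸ f (x ∷ xs) = f x + ∑ᴸ f xs

  ∏ᴸ : {X : Set} → (X → ℕ) → List X → ℕ
  ∏ᴸ f []       = 1
  ∏ᴸ f (x ∷ xs) = f x * ∏ᴸ f xs

  module _ {X : Set} where

    ∑ᴸ-cong : ∀ {f g : X → ℕ} → (∀ x → f x ≡ g x) → ∀ xs → ∑ᴸ f xs ≡ ∑ᴸ g xs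
    ∑ᴸ-cong h []       = refl
    ∑ᴸ-cong h (x ∷ xs) = cong₂ _+_ (h x) (∑ᴸ-cong h xs)

    ∑ᴸ-mono : ∀ {f g : X → ℕ} xs → (∀ x → x ∈ xs → f x ≤ g x) → ∑ᴸ f xs ≤ ∑ᴸ g xs
    ∑ᴸ-mono []       h = z≤n
    ∑ᴸ-mono (x ∷ xs) h = ℕ.+-mono-≤ (h x (here refl)) (∑ᴸ-mono xs (λ y p → h y (there p)))

    ∑ᴸ-+ : ∀ (f g : X → ℕ) xs → ∑ᴸ (λ x → f x + g x) xs ≡ ∑ᴸ f xs + ∑ᴸ g xs
    ∑ᴸ-+ f g []       = refl
    ∑ᴸ-+ f g (x ∷ xs) = trans (cong (λ z → f x + g x + z) (∑ᴸ-+ f g xs)) (lem (f x) (g x) (∑ᴸ f xs) (∑ᴸ g xs))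
      where
      lem : ∀ a b c d → a + b + (c + d) ≡ a + c + (b + d)
      lem = ℕ-ring

    ∑ᴸ-*ˡ : ∀ c (f : X → ℕ) xs → ∑ᴸ (λ x → c * f x) xs ≡ c * ∑ᴸ f xs
    ∑ᴸ-*ˡ c f []       = sym (ℕ.*-zeroʳ c)
    ∑ᴸ-*ˡ c f (x ∷ xs) = trans (cong (λ z → c * f x + z) (∑ᴸ-*ˡ c f xs)) (sym (ℕ.*-distribˡ-+ c (f x) (∑ᴸ f xs)))

    ∑ᴸ-const : ∀ c (xs : List X) → ∑ᴸ (λ _ → c) xs ≡ length xs * c
    ∑ᴸ-const c []       = refl
    ∑ᴸ-const c (x ∷ xs) = cong (λ z → c + z) (∑ᴸ-const c xs)

    ∑ᴸ-++ : ∀ (f : X → ℕ) xs ys → ∑ᴸ f (xs ++ ys) ≡ ∑ᴸ f xs + ∑ᴸ f ys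
    ∑ᴸ-++ f []       ys = refl
    ∑ᴸ-++ f (x ∷ xs) ys = trans (cong (λ z → f x + z) (∑ᴸ-++ f xs ys)) (sym (ℕ.+-assoc (f x) _ _))

    ∏ᴸ-++ : ∀ (f : X → ℕ) xs ys → ∏ᴸ f (xs ++ ys) ≡ ∏ᴸ f xs * ∏ᴸ f ys
    ∏ᴸ-++ f []       ys = sym (ℕ.*-identityˡ _)
    ∏ᴸ-++ f (x ∷ xs) ys = trans (cong (f x *_) (∏ᴸ-++ f xs ys)) (sym (ℕ.*-assoc (f x) _ _))

  ∑ᴸ-map : ∀ {X Y : Set} (f : Y → ℕ) (g : X → Y) xs → ∑ᴸ f (map g xs) ≡ ∑ᴸ (λ x → f (g x)) xs
  ∑ᴸ-map f g []       = refl
  ∑ᴸ-map f g (x ∷ xs) = cong (λ z → f (g x) + z) (∑ᴸ-map f g xs)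

  ∑ᴸ-swap : ∀ {X Y : Set} (f : X → Y → ℕ) xs ys → ∑ᴸ (λ x → ∑ᴸ (f x) ys) xs ≡ ∑ᴸ (λ y → ∑ᴸ (λ x → f x y) xs) ys
  ∑ᴸ-swap f []       ys = sym (trans (∑ᴸ-const 0 ys) (ℕ.*-zeroʳ (length ys)))
  ∑ᴸ-swap f (x ∷ xs) ys = trans (cong (λ z → ∑ᴸ (f x) ys + z) (∑ᴸ-swap f xs ys)) (sym (∑ᴸ-+ (f x) _ ys))

  ∑ᴸ-filter≤ : ∀ {X : Set} {P : X → Set} (P? : ∀ x → Dec (P x)) (g : X → ℕ) xs → ∑ᴸ g (filter P? xs) ≤ ∑ᴸ g xs
  ∑ᴸ-filter≤ P? g [] = z≤n
  ∑ᴸ-filter≤ P? g (x ∷ xs) with P? x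
  ... | yes _ = ℕ.+-monoʳ-≤ (g x) (∑ᴸ-filter≤ P? g xs)
  ... | no _  = ℕ.≤-trans (∑ᴸ-filter≤ P? g xs) (ℕ.m≤n+m _ (g x))

  member≤∑ᴸ : ∀ {X : Set} (f : X → ℕ) {x xs} → x ∈ xs → f x ≤ ∑ᴸ f xs
  member≤∑ᴸ f (here refl) = ℕ.m≤m+n _ _
  member≤∑ᴸ f (there p)   = ℕ.≤-trans (member≤∑ᴸ f p) (ℕ.m≤n+m _ _)

  keys : ℕ → List ℤ
  keys zero    = 0ℤ ∷ []
  keys (suc R) = + suc R ∷ -[1+ R ] ∷ keys R

  ∈-keys : ∀ R z → ∣ z ∣ ≤ R → z ∈ keys R
  ∈-keys zero    (+ zero) _ = here refl
  ∈-keys (suc R) z h with ∣ z ∣ ℕ.≟ suc R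
  ∈-keys (suc R) (+ _)     h | yes refl = here refl
  ∈-keys (suc R) -[1+ _ ]  h | yes refl = there (here refl)
  ... | no ≢ = there (there (∈-keys R z (ℕ.≤-pred (ℕ.≤∧≢⇒< h ≢))))

  keys-bounded : ∀ R v → v ∈ keys R → ∣ v ∣ ≤ R
  keys-bounded zero    v (here refl)         = z≤n
  keys-bounded (suc R) v (here refl)         = ℕ.≤-refl
  keys-bounded (suc R) v (there (here refl)) = ℕ.≤-refl
  keys-bounded (suc R) v (there (there p))   = ℕ.m≤n⇒m≤1+n (keys-bounded R v p)

  -- The weight 2^(-κ ∣ v ∣), scaled by 2^(κ R) to be an integer.
  weight : ℕ → ℕ → ℤ → ℕ
  weight κ R v = 2 ^ (κ * (R ∸ ∣ v ∣))

  -- Normalised, this is the geometric estimate Σ 2^(-κ ∣v∣) ≤ 1 + 4·2^-κ. The summand 4 on the left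
  -- is the slack of the induction: from 2 ≤ 2^κ it pays for the two new keys.
  weight-sum : ∀ κ R → 1 ≤ κ → 2 ^ κ * ∑ᴸ (weight κ R) (keys R) + 4 ≤ 2 ^ (κ * R) * (2 ^ κ + 4)
  weight-sum κ zero    1≤κ = ℕ.≤-reflexive (trans (cong (λ z → 2 ^ κ * (2 ^ z + 0) + 4) (ℕ.*-zeroʳ κ)) (trans (lem (2 ^ κ)) (cong (λ z → 2 ^ z * (2 ^ κ + 4)) (sym (ℕ.*-zeroʳ κ)))))
    where
    lem : ∀ y → y * 1 + 4 ≡ 1 * (y + 4)
    lem = ℕ-ring
  weight-sum κ (suc R) 1≤κ = begin
    y * (w₁ + (w₁ + ∑ᴸ (weight κ (suc R)) (keys R))) + 4 ≡⟨ cong₂ (λ a b → y * (a + (a + b)) + 4) w₁≡1 rest ⟩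
    y * (1 + (1 + y * W)) + 4 ≡⟨ lem₁ y W ⟩
    (y * (y * W) + 2 * y) + 4 ≤⟨ ℕ.+-monoʳ-≤ (y * (y * W) + 2 * y) (ℕ.*-monoʳ-≤ 2 2≤y) ⟩
    (y * (y * W) + 2 * y) + 2 * y ≡⟨ lem₂ y W ⟩
    y * (y * W + 4) ≤⟨ ℕ.*-monoʳ-≤ y (weight-sum κ R 1≤κ) ⟩
    y * (2 ^ (κ * R) * (y + 4)) ≡⟨ ℕ.*-assoc y (2 ^ (κ * R)) (y + 4) ⟨
    y * 2 ^ (κ * R) * (y + 4) ≡⟨ cong (_* (y + 4)) (sym (trans (cong (2 ^_) (ℕ.*-suc κ R)) (ℕ.^-distribˡ-+-* 2 κ (κ * R)))) ⟩
    2 ^ (κ * suc R) * (y + 4) ∎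
    where
    y W w₁ : ℕ
    y  = 2 ^ κ
    W  = ∑ᴸ (weight κ R) (keys R)
    w₁ = weight κ (suc R) (+ suc R)
    2≤y : 2 ≤ y
    2≤y = ℕ.^-monoʳ-≤ 2 1≤κ
    w₁≡1 : w₁ ≡ 1
    w₁≡1 = cong (2 ^_) (trans (cong (κ *_) (ℕ.n∸n≡0 R)) (ℕ.*-zeroʳ κ))
    lem₁ : ∀ y W → y * (1 + (1 + y * W)) + 4 ≡ (y * (y * W) + 2 * y) + 4
    lem₁ = ℕ-ring
    lem₂ : ∀ y W → (y * (y * W) + 2 * y) + 2 * y ≡ y * (y * W + 4)
    lem₂ = ℕ-ring
    rest : ∑ᴸ (weight κ (suc R)) (keys R) ≡ y * W
    rest = trans (∑ᴸ-cong∈ (keys R) (λ v v∈ → trans (cong (2 ^_) (trans (cong (κ *_) (ℕ.+-∸-assoc 1 (keys-bounded R v v∈))) (ℕ.*-suc κ _))) (ℕ.^-distribˡ-+-* 2 κ _))) (∑ᴸ-*ˡ y (weight κ R) (keys R))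
      where
      ∑ᴸ-cong∈ : ∀ {f g : ℤ → ℕ} xs → (∀ x → x ∈ xs → f x ≡ g x) → ∑ᴸ f xs ≡ ∑ᴸ g xs
      ∑ᴸ-cong∈ xs h = ℕ.≤-antisym (∑ᴸ-mono xs (λ x p → ℕ.≤-reflexive (h x p))) (∑ᴸ-mono xs (λ x p → ℕ.≤-reflexive (sym (h x p))))

  1+n≤2^n : ∀ n → suc n ≤ 2 ^ n
  1+n≤2^n zero    = s≤s z≤n
  1+n≤2^n (suc n) = ℕ.+-mono-≤ (ℕ.m^n>0 2 n) (ℕ.≤-trans (1+n≤2^n n) (ℕ.m≤m+n (2 ^ n) 0))

  module Weighted {X C : Set} (b : C → X → ℤ) (κ R : C → ℕ) (b≤R : ∀ c x → ∣ b c x ∣ ≤ R c) (κ≥1 : ∀ c → 1 ≤ κ c) where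

    fibre : C → ℤ → List X → List X
    fibre c v = filter (λ x → b c x ℤ.≟ v)

    -- Fixing the values one constraint at a time avoids vectors of values. When the list is
    -- exhausted, the remaining list is one joint fibre, of size at most γ/β.
    Fibres≤ : ℕ → ℕ → List C → List X → Set
    Fibres≤ β γ []       Ω = β * length Ω ≤ γ
    Fibres≤ β γ (c ∷ cs) Ω = ∀ v → Fibres≤ β γ cs (fibre c v Ω)

    W : List C → X → ℕ
    W cs x = ∏ᴸ (λ c → weight (κ c) (R c) (b c x)) cs

    split-fibres : ∀ c (g : X → ℕ) Ω → ∑ᴸ g Ω ≤ ∑ᴸ (λ v → ∑ᴸ g (fibre c v Ω)) (keys (R c))
    split-fibres c g []      = z≤n
    split-fibres c g (x ∷ Ω) = begin
      g x + ∑ᴸ g Ω ≤⟨ ℕ.+-mono-≤ (ℕ.≤-trans (ℕ.≤-reflexive (sym hit)) (member≤∑ᴸ ind (∈-keys (R c) (b c x) (b≤R c x)))) (split-fibres c g Ω) ⟩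
      ∑ᴸ ind (keys (R c)) + ∑ᴸ (λ v → ∑ᴸ g (fibre c v Ω)) (keys (R c)) ≡⟨ ∑ᴸ-+ ind _ (keys (R c)) ⟨
      ∑ᴸ (λ v → ind v + ∑ᴸ g (fibre c v Ω)) (keys (R c)) ≡⟨ ∑ᴸ-cong add (keys (R c)) ⟩
      ∑ᴸ (λ v → ∑ᴸ g (fibre c v (x ∷ Ω))) (keys (R c)) ∎
      where
      ind : ℤ → ℕ
      ind v with b c x ℤ.≟ v
      ... | yes _ = g x
      ... | no  _ = 0
      hit : ind (b c x) ≡ g x
      hit with b c x ℤ.≟ b c x
      ... | yes _ = refl
      ... | no  ≢ = ⊥-elim (≢ refl)
      add : ∀ v → ind v + ∑ᴸ g (fibre c v Ω) ≡ ∑ᴸ g (fibre c v (x ∷ Ω))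
      add v with b c x ℤ.≟ v
      ... | yes _ = refl
      ... | no  _ = refl

    fibre-weight : ∀ c cs v Ω → ∑ᴸ (W (c ∷ cs)) (fibre c v Ω) ≡ weight (κ c) (R c) v * ∑ᴸ (W cs) (fibre c v Ω)
    fibre-weight c cs v []      = sym (ℕ.*-zeroʳ (weight (κ c) (R c) v))
    fibre-weight c cs v (x ∷ Ω) with b c x ℤ.≟ v
    ... | yes refl = trans (cong (λ z → W (c ∷ cs) x + z) (fibre-weight c cs v Ω)) (sym (ℕ.*-distribˡ-+ (weight (κ c) (R c) v) (W cs x) _))
    ... | no  _    = fibre-weight c cs v Ω

    -- A constraint multiplies the effective number of joint fibres by its total weight, close to 1,
    -- and not by its 2 R + 1 possible values. That is the gain over a plain pigeonhole count.
    weighted-count : ∀ β γ cs Ω → Fibres≤ β γ cs Ω →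
      β * ∑ᴸ (W cs) Ω * ∏ᴸ (λ c → 2 ^ κ c) cs ≤ γ * ∏ᴸ (λ c → 2 ^ (κ c * R c) * (2 ^ κ c + 4)) cs
    weighted-count β γ [] Ω F = ℕ.*-monoˡ-≤ 1 (ℕ.≤-trans (ℕ.≤-reflexive (cong (β *_) (trans (∑ᴸ-const 1 Ω) (ℕ.*-identityʳ _)))) F)
    weighted-count β γ (c ∷ cs) Ω F = begin
      β * ∑ᴸ (W (c ∷ cs)) Ω * (2 ^ κ c * P) ≤⟨ ℕ.*-monoˡ-≤ (2 ^ κ c * P) (ℕ.*-monoʳ-≤ β (split-fibres c (W (c ∷ cs)) Ω)) ⟩
      β * ∑ᴸ (λ v → ∑ᴸ (W (c ∷ cs)) (fibre c v Ω)) ks * (2 ^ κ c * P) ≡⟨ cong (λ z → β * z * (2 ^ κ c * P)) (∑ᴸ-cong (λ v → fibre-weight c cs v Ω) ks) ⟩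
      β * ∑ᴸ (λ v → w v * S v) ks * (2 ^ κ c * P) ≡⟨ lem₁ β _ (2 ^ κ c) P ⟩
      2 ^ κ c * (β * P * ∑ᴸ (λ v → w v * S v) ks) ≡⟨ cong (2 ^ κ c *_) (∑ᴸ-*ˡ (β * P) _ ks) ⟨
      2 ^ κ c * ∑ᴸ (λ v → β * P * (w v * S v)) ks ≤⟨ ℕ.*-monoʳ-≤ (2 ^ κ c) (∑ᴸ-mono ks (λ v _ → ℕ.≤-trans (ℕ.≤-reflexive (lem₂ β P (w v) (S v))) (ℕ.*-monoʳ-≤ (w v) (weighted-count β γ cs (fibre c v Ω) (F v))))) ⟩
      2 ^ κ c * ∑ᴸ (λ v → w v * (γ * Q)) ks ≡⟨ cong (2 ^ κ c *_) (trans (∑ᴸ-cong (λ v → ℕ.*-comm (w v) (γ * Q)) ks) (∑ᴸ-*ˡ (γ * Q) w ks)) ⟩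
      2 ^ κ c * (γ * Q * ∑ᴸ w ks) ≡⟨ lem₃ (2 ^ κ c) γ Q (∑ᴸ w ks) ⟩
      γ * Q * (2 ^ κ c * ∑ᴸ w ks) ≤⟨ ℕ.*-monoʳ-≤ (γ * Q) (ℕ.≤-trans (ℕ.m≤m+n _ 4) (weight-sum (κ c) (R c) (κ≥1 c))) ⟩
      γ * Q * (2 ^ (κ c * R c) * (2 ^ κ c + 4)) ≡⟨ lem₄ γ Q _ ⟩
      γ * (2 ^ (κ c * R c) * (2 ^ κ c + 4) * Q) ∎
      where
      ks = keys (R c)
      w : ℤ → ℕ
      w = weight (κ c) (R c)
      S : ℤ → ℕ
      S v = ∑ᴸ (W cs) (fibre c v Ω)
      P Q : ℕ
      P = ∏ᴸ (λ c → 2 ^ κ c) cs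
      Q = ∏ᴸ (λ c → 2 ^ (κ c * R c) * (2 ^ κ c + 4)) cs
      lem₁ : ∀ b s k p → b * s * (k * p) ≡ k * (b * p * s)
      lem₁ = ℕ-ring
      lem₂ : ∀ b p w s → b * p * (w * s) ≡ w * (b * s * p)
      lem₂ = ℕ-ring
      lem₃ : ∀ k g q s → k * (g * q * s) ≡ g * q * (k * s)
      lem₃ = ℕ-ring
      lem₄ : ∀ g q s → g * q * s ≡ g * (s * q)
      lem₄ = ℕ-ring

    cost : List C → X → ℕ
    cost cs x = ∑ᴸ (λ c → κ c * ∣ b c x ∣) cs

    Z : List C → ℕ
    Z cs = ∑ᴸ (λ c → κ c * R c) cs

    W-cost : ∀ cs x → W cs x * 2 ^ cost cs x ≡ 2 ^ Z cs
    W-cost []       x = refl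
    W-cost (c ∷ cs) x = begin-equality
      w * W cs x * 2 ^ (k + cost cs x) ≡⟨ cong (w * W cs x *_) (ℕ.^-distribˡ-+-* 2 k (cost cs x)) ⟩
      w * W cs x * (2 ^ k * 2 ^ cost cs x) ≡⟨ lem w (W cs x) (2 ^ k) (2 ^ cost cs x) ⟩
      (w * 2 ^ k) * (W cs x * 2 ^ cost cs x) ≡⟨ cong₂ _*_ head (W-cost cs x) ⟩
      2 ^ (κ c * R c) * 2 ^ Z cs ≡⟨ ℕ.^-distribˡ-+-* 2 (κ c * R c) (Z cs) ⟨
      2 ^ (κ c * R c + Z cs) ∎
      where
      w k : ℕ
      w = weight (κ c) (R c) (b c x)
      k = κ c * ∣ b c x ∣
      lem : ∀ a b c d → a * b * (c * d) ≡ a * c * (b * d)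
      lem = ℕ-ring
      head : w * 2 ^ k ≡ 2 ^ (κ c * R c)
      head = trans (sym (ℕ.^-distribˡ-+-* 2 (κ c * (R c ∸ ∣ b c x ∣)) k)) (cong (2 ^_) (trans (sym (ℕ.*-distribˡ-+ (κ c) (R c ∸ ∣ b c x ∣) ∣ b c x ∣)) (cong (κ c *_) (ℕ.m∸n+n≡m (b≤R c x)))))

    -- Jensen's inequality for 2^(-cost), by its tangent 2^(A - c) ≥ 1 + A - c at the mean.
    tangent : ∀ A cs x → 2 ^ Z cs * suc A ≤ 2 ^ A * W cs x + 2 ^ Z cs * cost cs x
    tangent A cs x with cost cs x ≤? A
    ... | no  A<k = ℕ.≤-trans (ℕ.*-monoʳ-≤ (2 ^ Z cs) (ℕ.≰⇒> A<k)) (ℕ.m≤n+m _ (2 ^ A * W cs x))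
    ... | yes k≤A = begin
      2 ^ Z cs * suc A ≡⟨ cong (λ z → 2 ^ Z cs * suc z) (ℕ.m∸n+n≡m k≤A) ⟨
      2 ^ Z cs * (suc (A ∸ k) + k) ≡⟨ ℕ.*-distribˡ-+ (2 ^ Z cs) (suc (A ∸ k)) k ⟩
      2 ^ Z cs * suc (A ∸ k) + 2 ^ Z cs * k ≤⟨ ℕ.+-monoˡ-≤ (2 ^ Z cs * k) (ℕ.*-monoʳ-≤ (2 ^ Z cs) (1+n≤2^n (A ∸ k))) ⟩
      2 ^ Z cs * 2 ^ (A ∸ k) + 2 ^ Z cs * k ≡⟨ cong (λ z → z * 2 ^ (A ∸ k) + 2 ^ Z cs * k) (W-cost cs x) ⟨
      W cs x * 2 ^ k * 2 ^ (A ∸ k) + 2 ^ Z cs * k ≡⟨ cong (_+ 2 ^ Z cs * k) (trans (lem (W cs x) (2 ^ k) (2 ^ (A ∸ k))) (cong (_* W cs x) (trans (sym (ℕ.^-distribˡ-+-* 2 (A ∸ k) k)) (cong (2 ^_) (ℕ.m∸n+n≡m k≤A))))) ⟩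
      2 ^ A * W cs x + 2 ^ Z cs * k ∎
      where
      k : ℕ
      k = cost cs x
      lem : ∀ a b c → a * b * c ≡ c * b * a
      lem = ℕ-ring

    average-weight : ∀ A cs Ω → ∑ᴸ (cost cs) Ω ≤ A * length Ω → 2 ^ Z cs * length Ω ≤ 2 ^ A * ∑ᴸ (W cs) Ω
    average-weight A cs Ω h = ℕ.+-cancelʳ-≤ (2 ^ Z cs * ∑ᴸ (cost cs) Ω) _ _ (begin
      2 ^ Z cs * length Ω + 2 ^ Z cs * ∑ᴸ (cost cs) Ω ≤⟨ ℕ.+-monoʳ-≤ _ (ℕ.*-monoʳ-≤ (2 ^ Z cs) h) ⟩
      2 ^ Z cs * length Ω + 2 ^ Z cs * (A * length Ω) ≡⟨ lem (2 ^ Z cs) (length Ω) A ⟩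
      length Ω * (2 ^ Z cs * suc A) ≡⟨ ∑ᴸ-const (2 ^ Z cs * suc A) Ω ⟨
      ∑ᴸ (λ _ → 2 ^ Z cs * suc A) Ω ≤⟨ ∑ᴸ-mono Ω (λ x _ → tangent A cs x) ⟩
      ∑ᴸ (λ x → 2 ^ A * W cs x + 2 ^ Z cs * cost cs x) Ω ≡⟨ ∑ᴸ-+ _ _ Ω ⟩
      ∑ᴸ (λ x → 2 ^ A * W cs x) Ω + ∑ᴸ (λ x → 2 ^ Z cs * cost cs x) Ω ≡⟨ cong₂ _+_ (∑ᴸ-*ˡ (2 ^ A) (W cs) Ω) (∑ᴸ-*ˡ (2 ^ Z cs) (cost cs) Ω) ⟩
      2 ^ A * ∑ᴸ (W cs) Ω + 2 ^ Z cs * ∑ᴸ (cost cs) Ω ∎)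
      where
      lem : ∀ z l a → z * l + z * (a * l) ≡ l * (z * suc a)
      lem = ℕ-ring

    split-∏ : ∀ cs → ∏ᴸ (λ c → 2 ^ (κ c * R c) * (2 ^ κ c + 4)) cs ≡ 2 ^ Z cs * ∏ᴸ (λ c → 2 ^ κ c + 4) cs
    split-∏ []       = refl
    split-∏ (c ∷ cs) = trans (cong (2 ^ (κ c * R c) * (2 ^ κ c + 4) *_) (split-∏ cs))
      (trans (lem (2 ^ (κ c * R c)) (2 ^ κ c + 4) (2 ^ Z cs) _) (cong (_* ((2 ^ κ c + 4) * ∏ᴸ (λ c → 2 ^ κ c + 4) cs)) (sym (ℕ.^-distribˡ-+-* 2 (κ c * R c) (Z cs)))))
      where
      lem : ∀ a b c d → a * b * (c * d) ≡ a * c * (b * d)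
      lem = ℕ-ring

    -- The total weight is small because every joint fibre is small, and large because the mean cost
    -- is at most A. The effective number of fibres is therefore 2^A ∏ (1 + 4·2^-κ), which plays the
    -- part of the exponential of an entropy.
    pigeonhole : ∀ β γ A cs Ω → ∑ᴸ (cost cs) Ω ≤ A * length Ω → Fibres≤ β γ cs Ω →
      β * length Ω * ∏ᴸ (λ c → 2 ^ κ c) cs ≤ 2 ^ A * γ * ∏ᴸ (λ c → 2 ^ κ c + 4) cs
    pigeonhole β γ A cs Ω h F = ℕ.*-cancelˡ-≤ (2 ^ Z cs) {{ℕ.m^n≢0 2 (Z cs)}} (begin
      z * (β * length Ω * P) ≡⟨ lem₁ z β (length Ω) P ⟩
      (z * length Ω) * (β * P) ≤⟨ ℕ.*-monoˡ-≤ (β * P) (average-weight A cs Ω h) ⟩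
      (2 ^ A * ∑ᴸ (W cs) Ω) * (β * P) ≡⟨ lem₂ (2 ^ A) (∑ᴸ (W cs) Ω) β P ⟩
      2 ^ A * (β * ∑ᴸ (W cs) Ω * P) ≤⟨ ℕ.*-monoʳ-≤ (2 ^ A) (weighted-count β γ cs Ω F) ⟩
      2 ^ A * (γ * _) ≡⟨ cong (λ y → 2 ^ A * (γ * y)) (split-∏ cs) ⟩
      2 ^ A * (γ * (z * Q)) ≡⟨ lem₃ (2 ^ A) γ z Q ⟩
      z * (2 ^ A * γ * Q) ∎)
      where
      z P Q : ℕ
      z = 2 ^ Z cs
      P = ∏ᴸ (λ c → 2 ^ κ c) cs
      Q = ∏ᴸ (λ c → 2 ^ κ c + 4) cs
      lem₁ : ∀ z b l p → z * (b * l * p) ≡ z * l * (b * p)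
      lem₁ = ℕ-ring
      lem₂ : ∀ a s b p → a * s * (b * p) ≡ a * (b * s * p)
      lem₂ = ℕ-ring
      lem₃ : ∀ a g z q → a * (g * (z * q)) ≡ z * (a * g * q)
      lem₃ = ℕ-ring

  agreements : ∀ {n} → Vec Bool n → Vec Bool n → ℕ
  agreements []          []          = 0
  agreements (true  ∷ x) (true  ∷ y) = suc (agreements x y)
  agreements (false ∷ x) (false ∷ y) = suc (agreements x y)
  agreements (true  ∷ x) (false ∷ y) = agreements x y
  agreements (false ∷ x) (true  ∷ y) = agreements x y

  ∑-allVecs : ∀ n (f : Vec Bool (suc n) → ℕ) → ∑ᴸ f (allVecs (suc n)) ≡ ∑ᴸ (λ x → f (true ∷ x)) (allVecs n) + ∑ᴸ (λ x → f (false ∷ x)) (allVecs n)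
  ∑-allVecs n f = trans (∑ᴸ-++ f (map (true ∷_) (allVecs n)) _) (cong₂ _+_ (∑ᴸ-map f (true ∷_) (allVecs n)) (∑ᴸ-map f (false ∷_) (allVecs n)))

  length-allVecs : ∀ n → length (allVecs n) ≡ 2 ^ n
  length-allVecs n = trans (sym (trans (∑ᴸ-const 1 (allVecs n)) (ℕ.*-identityʳ _))) (go n)
    where
    go : ∀ n → ∑ᴸ (λ _ → 1) (allVecs n) ≡ 2 ^ n
    go zero    = refl
    go (suc n) = trans (∑-allVecs n (λ _ → 1)) (trans (cong₂ _+_ (go n) (go n)) (cong (λ z → 2 ^ n + z) (sym (ℕ.+-identityʳ (2 ^ n)))))

  -- An exponential moment: a coordinate contributes 4 if it agrees and 1 if not. By Markov's
  -- inequality at most 5^n / 4^σ vectors agree with `x` in σ or more places.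
  agreement-weights : ∀ {n} (x : Vec Bool n) → ∑ᴸ (λ y → 4 ^ agreements x y) (allVecs n) ≡ 5 ^ n
  agreement-weights []          = refl
  agreement-weights {suc n} (true ∷ x)  = trans (∑-allVecs n _) (trans (cong (_+ ∑ᴸ (λ y → 4 ^ agreements x y) (allVecs n)) (∑ᴸ-*ˡ 4 (λ y → 4 ^ agreements x y) (allVecs n))) (trans (lem (∑ᴸ (λ y → 4 ^ agreements x y) (allVecs n))) (cong (5 *_) (agreement-weights x))))
    where
    lem : ∀ s → 4 * s + s ≡ 5 * s
    lem = ℕ-ring
  agreement-weights {suc n} (false ∷ x) = trans (∑-allVecs n _) (trans (cong (λ z → ∑ᴸ (λ y → 4 ^ agreements x y) (allVecs n) + z) (∑ᴸ-*ˡ 4 (λ y → 4 ^ agreements x y) (allVecs n))) (cong (5 *_) (agreement-weights x)))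

  module _ {n : ℕ} {C : Set} (b : C → Vec Bool n → ℤ) (κ R : C → ℕ) (b≤R : ∀ c x → ∣ b c x ∣ ≤ R c) (κ≥1 : ∀ c → 1 ≤ κ c) where

    open Weighted b κ R b≤R κ≥1

    -- All members of a joint fibre are close to its first member, so `agreement-weights` bounds
    -- their number. The first hypothesis expresses, through sums, that no vector occurs in `Ω` more
    -- often than in `allVecs n`.
    close⇒Fibres≤ : ∀ σ cs Ω → (∀ g → ∑ᴸ g Ω ≤ ∑ᴸ g (allVecs n)) →
      (∀ x y → x ∈ Ω → y ∈ Ω → All (λ c → b c x ≡ b c y) cs → σ ≤ agreements x y) → Fibres≤ (4 ^ σ) (5 ^ n) cs Ω
    close⇒Fibres≤ σ [] []        sub close = ℕ.≤-trans (ℕ.≤-reflexive (ℕ.*-zeroʳ (4 ^ σ))) z≤n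
    close⇒Fibres≤ σ [] Ω@(x ∷ _) sub close = begin
      4 ^ σ * length Ω ≡⟨ ℕ.*-comm (4 ^ σ) (length Ω) ⟩
      length Ω * 4 ^ σ ≡⟨ ∑ᴸ-const (4 ^ σ) Ω ⟨
      ∑ᴸ (λ _ → 4 ^ σ) Ω ≤⟨ ∑ᴸ-mono Ω (λ y y∈ → ℕ.^-monoʳ-≤ 4 (close x y (here refl) y∈ [])) ⟩
      ∑ᴸ (λ y → 4 ^ agreements x y) Ω ≤⟨ sub _ ⟩
      ∑ᴸ (λ y → 4 ^ agreements x y) (allVecs n) ≡⟨ agreement-weights x ⟩
      5 ^ n ∎
    close⇒Fibres≤ σ (c ∷ cs) Ω sub close v = close⇒Fibres≤ σ cs (fibre c v Ω)
      (λ g → ℕ.≤-trans (∑ᴸ-filter≤ _ g Ω) (sub g))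
      (λ x y x∈ y∈ eqs → let x∈′ , bx = ∈-filter⁻ (λ x → b c x ℤ.≟ v) {xs = Ω} x∈
                             y∈′ , by = ∈-filter⁻ (λ x → b c x ℤ.≟ v) {xs = Ω} y∈ in
                         close x y x∈′ y∈′ (trans bx (sym by) ∷ eqs))

    distant-pair : ∀ σ A cs → ∑ᴸ (cost cs) (allVecs n) ≤ A * 2 ^ n →
      2 ^ A * 5 ^ n * ∏ᴸ (λ c → 2 ^ κ c + 4) cs < 4 ^ σ * 2 ^ n * ∏ᴸ (λ c → 2 ^ κ c) cs →
      ∃ λ x → ∃ λ y → (agreements x y < σ) × All (λ c → b c x ≡ b c y) cs
    distant-pair σ A cs h lt with any? (λ x → any? (λ y → (agreements x y <? σ) ×-dec all? (λ c → b c x ℤ.≟ b c y) cs) (allVecs n)) (allVecs n)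
    ... | yes p with find p
    ...   | x , _ , q with find q
    ...     | y , _ , r = x , y , r
    distant-pair σ A cs h lt | no none = ⊥-elim (ℕ.<⇒≱ lt
      (subst (λ z → 4 ^ σ * z * ∏ᴸ (λ c → 2 ^ κ c) cs ≤ 2 ^ A * 5 ^ n * ∏ᴸ (λ c → 2 ^ κ c + 4) cs) (length-allVecs n)
        (pigeonhole (4 ^ σ) (5 ^ n) A cs (allVecs n) (subst (λ z → ∑ᴸ (cost cs) (allVecs n) ≤ A * z) (sym (length-allVecs n)) h)
          (close⇒Fibres≤ σ cs (allVecs n) (λ g → ℕ.≤-refl)
            (λ x y x∈ y∈ eqs → ℕ.≮⇒≥ (λ far → none (lose x∈ (lose y∈ (far , eqs)))))))))

-- Signed sums of variables, their moments and their rounding.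

module Moments where

  open Pigeon

  Literal : ℕ → Set
  Literal n = Fin n × Bool

  -- The values are arbitrary integers because the same sum is applied to differences of two
  -- colourings, with values 0 and ±2.
  S : ∀ {n} → (Fin n → ℤ) → List (Literal n) → ℤ
  S v []             = 0ℤ
  S v ((i , s) ∷ xs) = sign s *ᶻ v i +ᶻ S v xs

  S-++ : ∀ {n} (v : Fin n → ℤ) xs ys → S v (xs ++ ys) ≡ S v xs +ᶻ S v ys
  S-++ v []             ys = sym (ℤ.+-identityˡ _)
  S-++ v ((i , s) ∷ xs) ys = trans (cong (sign s *ᶻ v i +ᶻ_) (S-++ v xs ys)) (sym (ℤ.+-assoc (sign s *ᶻ v i) _ _))

  signs : ∀ {n} → Vec Bool n → Fin n → ℤ
  signs χ i = sign (lookup χ i)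

  ∣sign∣ : ∀ b → ∣ sign b ∣ ≡ 1
  ∣sign∣ true  = refl
  ∣sign∣ false = refl

  ∣S∣≤length : ∀ {n} (v : Fin n → ℤ) → (∀ i → ∣ v i ∣ ≤ 1) → ∀ xs → ∣ S v xs ∣ ≤ length xs
  ∣S∣≤length v h []             = z≤n
  ∣S∣≤length v h ((i , s) ∷ xs) = ℕ.≤-trans (ℤ.∣i+j∣≤∣i∣+∣j∣ (sign s *ᶻ v i) (S v xs))
    (ℕ.+-mono-≤ (ℕ.≤-trans (ℕ.≤-reflexive (trans (ℤ.abs-* (sign s) (v i)) (trans (cong (_* ∣ v i ∣) (∣sign∣ s)) (ℕ.*-identityˡ _)))) (h i)) (∣S∣≤length v h xs))

  δ : ∀ {n} → Fin n → Fin n → ℕ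
  δ zero    zero    = 1
  δ (suc i) (suc j) = δ i j
  δ zero    (suc j) = 0
  δ (suc i) zero    = 0

  occ : ∀ {n} → Fin n → List (Literal n) → ℕ
  occ i = ∑ᴸ (λ l → δ i (proj₁ l))

  addAt : ∀ {n} → Fin n → ℤ → Vec ℤ n → Vec ℤ n
  addAt zero    c (a ∷ as) = (c +ᶻ a) ∷ as
  addAt (suc i) c (a ∷ as) = a ∷ addAt i c as

  -- A variable can occur several times in a list. Its occurrences are collected first, since the
  -- moment computations need independent coordinates.
  coefs : ∀ {n} → List (Literal n) → Vec ℤ n
  coefs []             = replicate _ 0ℤ
  coefs ((i , s) ∷ xs) = addAt i (sign s) (coefs xs)

  dot : ∀ {n} → Vec ℤ n → Vec Bool n → ℤ
  dot []       []      = 0ℤ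
  dot (a ∷ as) (x ∷ χ) = a *ᶻ sign x +ᶻ dot as χ

  l1 sq : ∀ {n} → Vec ℤ n → ℕ
  l1 []       = 0
  l1 (a ∷ as) = ∣ a ∣ + l1 as
  sq []       = 0
  sq (a ∷ as) = ∣ a ∣ * ∣ a ∣ + sq as

  dot-addAt : ∀ {n} (i : Fin n) c a χ → dot (addAt i c a) χ ≡ c *ᶻ signs χ i +ᶻ dot a χ
  dot-addAt zero    c (a ∷ as) (x ∷ χ) = lem c a (sign x) (dot as χ)
    where
    lem : ∀ c a x d → (c +ᶻ a) *ᶻ x +ᶻ d ≡ c *ᶻ x +ᶻ (a *ᶻ x +ᶻ d)
    lem = ℤ-ring
  dot-addAt (suc i) c (a ∷ as) (x ∷ χ) = trans (cong (a *ᶻ sign x +ᶻ_) (dot-addAt i c as χ)) (lem (a *ᶻ sign x) (c *ᶻ signs χ i) (dot as χ))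
    where
    lem : ∀ a b c → a +ᶻ (b +ᶻ c) ≡ b +ᶻ (a +ᶻ c)
    lem = ℤ-ring

  dot-0 : ∀ {n} (χ : Vec Bool n) → dot (replicate n 0ℤ) χ ≡ 0ℤ
  dot-0 []      = refl
  dot-0 (x ∷ χ) = trans (ℤ.+-identityˡ _) (dot-0 χ)

  dot-coefs : ∀ {n} (xs : List (Literal n)) χ → dot (coefs xs) χ ≡ S (signs χ) xs
  dot-coefs []             χ = dot-0 χ
  dot-coefs ((i , s) ∷ xs) χ = trans (dot-addAt i (sign s) (coefs xs) χ) (cong (sign s *ᶻ signs χ i +ᶻ_) (dot-coefs xs χ))

  l1-addAt : ∀ {n} (i : Fin n) c a → l1 (addAt i c a) ≤ ∣ c ∣ + l1 a
  l1-addAt zero    c (a ∷ as) = ℕ.≤-trans (ℕ.+-monoˡ-≤ (l1 as) (ℤ.∣i+j∣≤∣i∣+∣j∣ c a)) (ℕ.≤-reflexive (ℕ.+-assoc ∣ c ∣ ∣ a ∣ (l1 as)))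
  l1-addAt (suc i) c (a ∷ as) = ℕ.≤-trans (ℕ.+-monoʳ-≤ ∣ a ∣ (l1-addAt i c as)) (ℕ.≤-reflexive (lem ∣ a ∣ ∣ c ∣ (l1 as)))
    where
    lem : ∀ a b c → a + (b + c) ≡ b + (a + c)
    lem = ℕ-ring

  l1-coefs : ∀ {n} (xs : List (Literal n)) → l1 (coefs xs) ≤ length xs
  l1-coefs {n} [] = ℕ.≤-reflexive (l1-0 n)
    where
    l1-0 : ∀ n → l1 (replicate n 0ℤ) ≡ 0
    l1-0 zero    = refl
    l1-0 (suc n) = l1-0 n
  l1-coefs ((i , s) ∷ xs) = ℕ.≤-trans (l1-addAt i (sign s) (coefs xs)) (ℕ.+-mono-≤ (ℕ.≤-reflexive (∣sign∣ s)) (l1-coefs xs))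

  lookup-addAt : ∀ {n} (i j : Fin n) c a → ∣ lookup (addAt j c a) i ∣ ≤ δ i j * ∣ c ∣ + ∣ lookup a i ∣
  lookup-addAt zero    zero    c (a ∷ as) = ℕ.≤-trans (ℤ.∣i+j∣≤∣i∣+∣j∣ c a) (ℕ.≤-reflexive (cong (_+ ∣ a ∣) (sym (ℕ.*-identityˡ ∣ c ∣))))
  lookup-addAt (suc i) (suc j) c (a ∷ as) = lookup-addAt i j c as
  lookup-addAt zero    (suc j) c (a ∷ as) = ℕ.≤-refl
  lookup-addAt (suc i) zero    c (a ∷ as) = ℕ.≤-refl

  lookup-coefs : ∀ {n} i (xs : List (Literal n)) → ∣ lookup (coefs xs) i ∣ ≤ occ i xs
  lookup-coefs i [] = ℕ.≤-reflexive (cong ∣_∣ (lookup-0 i))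
    where
    lookup-0 : ∀ {n} (i : Fin n) → lookup (replicate n 0ℤ) i ≡ 0ℤ
    lookup-0 zero    = refl
    lookup-0 (suc i) = lookup-0 i
  lookup-coefs i ((j , s) ∷ xs) = ℕ.≤-trans (lookup-addAt i j (sign s) (coefs xs))
    (ℕ.+-mono-≤ (ℕ.≤-reflexive (trans (cong (δ i j *_) (∣sign∣ s)) (ℕ.*-identityʳ _))) (lookup-coefs i xs))

  sq≤ : ∀ {n} K (a : Vec ℤ n) → (∀ i → ∣ lookup a i ∣ ≤ K) → sq a ≤ K * l1 a
  sq≤ K []       h = z≤n
  sq≤ K (a ∷ as) h = ℕ.≤-trans (ℕ.+-mono-≤ (ℕ.*-monoˡ-≤ ∣ a ∣ (h zero)) (sq≤ K as (λ i → h (suc i)))) (ℕ.≤-reflexive (sym (ℕ.*-distribˡ-+ K ∣ a ∣ (l1 as))))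

  infix 8 _²
  _² : ℤ → ℕ
  z ² = ∣ z ∣ * ∣ z ∣

  square : ∀ z → + (z ²) ≡ z *ᶻ z
  square (+ m)    = ℤ.pos-* m m
  square -[1+ m ] = refl

  parallelogram : ∀ a z → (a *ᶻ + 1 +ᶻ z) ² + (a *ᶻ ℤ.- (+ 1) +ᶻ z) ² ≡ 2 * a ² + 2 * z ²
  parallelogram a z = ℤ.+-injective (begin
    + (p ² + m ²) ≡⟨ ℤ.pos-+ (p ²) (m ²) ⟩
    + (p ²) +ᶻ + (m ²) ≡⟨ cong₂ _+ᶻ_ (square p) (square m) ⟩
    p *ᶻ p +ᶻ m *ᶻ m ≡⟨ lem a z ⟩
    + 2 *ᶻ (a *ᶻ a) +ᶻ + 2 *ᶻ (z *ᶻ z) ≡⟨ cong₂ (λ x y → + 2 *ᶻ x +ᶻ + 2 *ᶻ y) (square a) (square z) ⟨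
    + 2 *ᶻ + (a ²) +ᶻ + 2 *ᶻ + (z ²) ≡⟨ cong₂ _+ᶻ_ (ℤ.pos-* 2 (a ²)) (ℤ.pos-* 2 (z ²)) ⟨
    + (2 * a ²) +ᶻ + (2 * z ²) ≡⟨ ℤ.pos-+ (2 * a ²) (2 * z ²) ⟨
    + (2 * a ² + 2 * z ²) ∎)
    where
    open ≡-Reasoning
    p m : ℤ
    p = a *ᶻ + 1 +ᶻ z
    m = a *ᶻ ℤ.- (+ 1) +ᶻ z
    lem : ∀ a z → (a *ᶻ + 1 +ᶻ z) *ᶻ (a *ᶻ + 1 +ᶻ z) +ᶻ (a *ᶻ ℤ.- (+ 1) +ᶻ z) *ᶻ (a *ᶻ ℤ.- (+ 1) +ᶻ z) ≡ + 2 *ᶻ (a *ᶻ a) +ᶻ + 2 *ᶻ (z *ᶻ z)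
    lem = ℤ-ring

  parallelogram₄ : ∀ a z → (a *ᶻ + 1 +ᶻ z) ² * (a *ᶻ + 1 +ᶻ z) ² + (a *ᶻ ℤ.- (+ 1) +ᶻ z) ² * (a *ᶻ ℤ.- (+ 1) +ᶻ z) ²
    ≡ 2 * (a ² * a ²) + 12 * a ² * z ² + 2 * (z ² * z ²)
  parallelogram₄ a z = ℤ.+-injective (begin
    + (p ² * p ² + m ² * m ²) ≡⟨ ℤ.pos-+ (p ² * p ²) (m ² * m ²) ⟩
    + (p ² * p ²) +ᶻ + (m ² * m ²) ≡⟨ cong₂ _+ᶻ_ (fourth p) (fourth m) ⟩
    p *ᶻ p *ᶻ (p *ᶻ p) +ᶻ m *ᶻ m *ᶻ (m *ᶻ m) ≡⟨ lem a z ⟩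
    + 2 *ᶻ (a *ᶻ a *ᶻ (a *ᶻ a)) +ᶻ + 12 *ᶻ (a *ᶻ a) *ᶻ (z *ᶻ z) +ᶻ + 2 *ᶻ (z *ᶻ z *ᶻ (z *ᶻ z))
                                                                     ≡⟨ cong₂ (λ x y → + 2 *ᶻ (x *ᶻ x) +ᶻ + 12 *ᶻ x *ᶻ y +ᶻ + 2 *ᶻ (y *ᶻ y)) (square a) (square z) ⟨
    + 2 *ᶻ (A *ᶻ A) +ᶻ + 12 *ᶻ A *ᶻ B +ᶻ + 2 *ᶻ (B *ᶻ B) ≡⟨ cast (a ²) (z ²) ⟨
    + (2 * (a ² * a ²) + 12 * a ² * z ² + 2 * (z ² * z ²)) ∎)
    where
    open ≡-Reasoning
    p m A B : ℤ
    p = a *ᶻ + 1 +ᶻ z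
    m = a *ᶻ ℤ.- (+ 1) +ᶻ z
    A = + (a ²)
    B = + (z ²)
    fourth : ∀ x → + (x ² * x ²) ≡ x *ᶻ x *ᶻ (x *ᶻ x)
    fourth x = trans (ℤ.pos-* (x ²) (x ²)) (cong₂ _*ᶻ_ (square x) (square x))
    cast : ∀ x y → + (2 * (x * x) + 12 * x * y + 2 * (y * y)) ≡ + 2 *ᶻ (+ x *ᶻ + x) +ᶻ + 12 *ᶻ + x *ᶻ + y +ᶻ + 2 *ᶻ (+ y *ᶻ + y)
    cast x y = trans (ℤ.pos-+ (2 * (x * x) + 12 * x * y) (2 * (y * y))) (cong₂ _+ᶻ_
      (trans (ℤ.pos-+ (2 * (x * x)) (12 * x * y)) (cong₂ _+ᶻ_ (trans (ℤ.pos-* 2 (x * x)) (cong (+ 2 *ᶻ_) (ℤ.pos-* x x))) (trans (ℤ.pos-* (12 * x) y) (cong (_*ᶻ + y) (ℤ.pos-* 12 x)))))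
      (trans (ℤ.pos-* 2 (y * y)) (cong (+ 2 *ᶻ_) (ℤ.pos-* y y))))
    lem : ∀ a z → (a *ᶻ + 1 +ᶻ z) *ᶻ (a *ᶻ + 1 +ᶻ z) *ᶻ ((a *ᶻ + 1 +ᶻ z) *ᶻ (a *ᶻ + 1 +ᶻ z)) +ᶻ (a *ᶻ ℤ.- (+ 1) +ᶻ z) *ᶻ (a *ᶻ ℤ.- (+ 1) +ᶻ z) *ᶻ ((a *ᶻ ℤ.- (+ 1) +ᶻ z) *ᶻ (a *ᶻ ℤ.- (+ 1) +ᶻ z))
      ≡ + 2 *ᶻ (a *ᶻ a *ᶻ (a *ᶻ a)) +ᶻ + 12 *ᶻ (a *ᶻ a) *ᶻ (z *ᶻ z) +ᶻ + 2 *ᶻ (z *ᶻ z *ᶻ (z *ᶻ z))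
    lem = ℤ-ring

  open ℕ.≤-Reasoning

  second-moment : ∀ {n} (a : Vec ℤ n) → ∑ᴸ (λ χ → dot a χ ²) (allVecs n) ≡ 2 ^ n * sq a
  second-moment []             = refl
  second-moment {suc n} (a ∷ as) = begin-equality
    ∑ᴸ (λ χ → dot (a ∷ as) χ ²) (allVecs (suc n)) ≡⟨ ∑-allVecs n (λ χ → dot (a ∷ as) χ ²) ⟩
    ∑ᴸ (λ χ → (a *ᶻ + 1 +ᶻ dot as χ) ²) (allVecs n) + ∑ᴸ (λ χ → (a *ᶻ ℤ.- (+ 1) +ᶻ dot as χ) ²) (allVecs n)
                                                                               ≡⟨ ∑ᴸ-+ _ _ (allVecs n) ⟨
    ∑ᴸ (λ χ → (a *ᶻ + 1 +ᶻ dot as χ) ² + (a *ᶻ ℤ.- (+ 1) +ᶻ dot as χ) ²) (allVecs n)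
                                                                               ≡⟨ ∑ᴸ-cong (λ χ → parallelogram a (dot as χ)) (allVecs n) ⟩
    ∑ᴸ (λ χ → 2 * a ² + 2 * dot as χ ²) (allVecs n) ≡⟨ ∑ᴸ-+ _ _ (allVecs n) ⟩
    ∑ᴸ (λ χ → 2 * a ²) (allVecs n) + ∑ᴸ (λ χ → 2 * dot as χ ²) (allVecs n) ≡⟨ cong₂ _+_ (trans (∑ᴸ-const (2 * a ²) (allVecs n)) (cong (_* (2 * a ²)) (length-allVecs n))) (trans (∑ᴸ-*ˡ 2 (λ χ → dot as χ ²) (allVecs n)) (cong (2 *_) (second-moment as))) ⟩
    2 ^ n * (2 * a ²) + 2 * (2 ^ n * sq as) ≡⟨ lem (2 ^ n) (a ²) (sq as) ⟩
    2 * 2 ^ n * (a ² + sq as) ∎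
    where
    lem : ∀ p x y → p * (2 * x) + 2 * (p * y) ≡ 2 * p * (x + y)
    lem = ℕ-ring

  -- Khintchine's inequality with constant 3. Averaging over the first sign leaves a^4 + 6 a^2 z^2 +
  -- z^4; the mean of z^2 is known exactly, and the mixed term is precisely the one in 3 (x + y)^2.
  fourth-moment : ∀ {n} (a : Vec ℤ n) → ∑ᴸ (λ χ → dot a χ ² * dot a χ ²) (allVecs n) ≤ 3 * 2 ^ n * (sq a * sq a)
  fourth-moment []             = z≤n
  fourth-moment {suc n} (a ∷ as) = begin
    ∑ᴸ (λ χ → dot (a ∷ as) χ ² * dot (a ∷ as) χ ²) (allVecs (suc n)) ≡⟨ ∑-allVecs n (λ χ → dot (a ∷ as) χ ² * dot (a ∷ as) χ ²) ⟩
    ∑ᴸ (λ χ → (a *ᶻ + 1 +ᶻ dot as χ) ² * (a *ᶻ + 1 +ᶻ dot as χ) ²) (allVecs n) + ∑ᴸ (λ χ → (a *ᶻ ℤ.- (+ 1) +ᶻ dot as χ) ² * (a *ᶻ ℤ.- (+ 1) +ᶻ dot as χ) ²) (allVecs n)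
                                                                               ≡⟨ ∑ᴸ-+ _ _ (allVecs n) ⟨
    ∑ᴸ (λ χ → (a *ᶻ + 1 +ᶻ dot as χ) ² * (a *ᶻ + 1 +ᶻ dot as χ) ² + (a *ᶻ ℤ.- (+ 1) +ᶻ dot as χ) ² * (a *ᶻ ℤ.- (+ 1) +ᶻ dot as χ) ²) (allVecs n)
                                                                               ≡⟨ ∑ᴸ-cong (λ χ → parallelogram₄ a (dot as χ)) (allVecs n) ⟩
    ∑ᴸ (λ χ → 2 * (a ² * a ²) + 12 * a ² * dot as χ ² + 2 * (dot as χ ² * dot as χ ²)) (allVecs n)
                                                                               ≡⟨ trans (∑ᴸ-+ _ _ (allVecs n)) (cong₂ _+_ (trans (∑ᴸ-+ _ _ (allVecs n)) (cong₂ _+_ (trans (∑ᴸ-const (2 * (a ² * a ²)) (allVecs n)) (cong (_* (2 * (a ² * a ²))) (length-allVecs n))) (trans (∑ᴸ-*ˡ (12 * a ²) (λ χ → dot as χ ²) (allVecs n)) (cong (12 * a ² *_) (second-moment as))))) (∑ᴸ-*ˡ 2 (λ χ → dot as χ ² * dot as χ ²) (allVecs n))) ⟩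
    2 ^ n * (2 * (a ² * a ²)) + 12 * a ² * (2 ^ n * sq as) + 2 * ∑ᴸ (λ χ → dot as χ ² * dot as χ ²) (allVecs n)
                                                                               ≤⟨ ℕ.+-mono-≤ (ℕ.+-monoˡ-≤ (12 * a ² * (2 ^ n * sq as)) (ℕ.m≤n*m (2 ^ n * (2 * (a ² * a ²))) 3)) (ℕ.*-monoʳ-≤ 2 (fourth-moment as)) ⟩
    3 * (2 ^ n * (2 * (a ² * a ²))) + 12 * a ² * (2 ^ n * sq as) + 2 * (3 * 2 ^ n * (sq as * sq as))
                                                                               ≡⟨ lem (2 ^ n) (a ²) (sq as) ⟩
    3 * (2 * 2 ^ n) * ((a ² + sq as) * (a ² + sq as)) ∎
    where
    lem : ∀ p x y → 3 * (p * (2 * (x * x))) + 12 * x * (p * y) + 2 * (3 * p * (y * y)) ≡ 3 * (2 * p) * ((x + y) * (x + y))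
    lem = ℕ-ring

  module _ (Δ : ℕ) {{Δ≢0 : NonZero Δ}} where

    -- Truncation towards zero gives all z with ∣ z ∣ < Δ the same quotient 0.
    tq : ℤ → ℤ
    tq (+ m)    = + (m / Δ)
    tq -[1+ m ] = ℤ.- (+ (suc m / Δ))

    ∣tq∣ : ∀ z → ∣ tq z ∣ ≡ ∣ z ∣ / Δ
    ∣tq∣ (+ m)    = refl
    ∣tq∣ -[1+ m ] = ℤ.∣-i∣≡∣i∣ (+ (suc m / Δ))

    ∣tq∣≤ : ∀ z → ∣ tq z ∣ ≤ ∣ z ∣
    ∣tq∣≤ z = ℕ.≤-trans (ℕ.≤-reflexive (∣tq∣ z)) (Data.Nat.DivMod.m/n≤m ∣ z ∣ Δ)

    same-quotient : ∀ m n → m / Δ ≡ n / Δ → m ≤ Δ + n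
    same-quotient m n eq = begin
      m ≡⟨ m≡m%n+[m/n]*n m Δ ⟩
      m % Δ + (m / Δ) * Δ ≤⟨ ℕ.+-mono-≤ (ℕ.<⇒≤ (m%n<n m Δ)) (ℕ.≤-trans (ℕ.≤-reflexive (cong (_* Δ) eq)) (m/n*n≤m n Δ)) ⟩
      Δ + n ∎

    zero-quotient : ∀ m → m / Δ ≡ 0 → m ≤ Δ
    zero-quotient m eq = begin
      m ≡⟨ m≡m%n+[m/n]*n m Δ ⟩
      m % Δ + (m / Δ) * Δ ≡⟨ cong (λ z → m % Δ + z * Δ) eq ⟩
      m % Δ + 0 ≡⟨ ℕ.+-identityʳ _ ⟩
      m % Δ ≤⟨ ℕ.<⇒≤ (m%n<n m Δ) ⟩
      Δ ∎

    difference≤ : ∀ m n → m ≤ Δ + n → n ≤ Δ + m → ∣ + m -ᶻ + n ∣ ≤ Δ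
    difference≤ m n p q with ℕ.≤-total n m
    ... | inj₁ n≤m = subst (_≤ Δ) (cong ∣_∣ (sym (trans (ℤ.m-n≡m⊖n m n) (ℤ.⊖-≥ n≤m)))) (ℕ.≤-trans (ℕ.∸-monoˡ-≤ n p) (ℕ.≤-reflexive (ℕ.m+n∸n≡m Δ n)))
    ... | inj₂ m≤n = subst (_≤ Δ) (sym (trans (ℤ.∣i-j∣≡∣j-i∣ (+ m) (+ n)) (cong ∣_∣ (trans (ℤ.m-n≡m⊖n n m) (ℤ.⊖-≥ m≤n))))) (ℕ.≤-trans (ℕ.∸-monoˡ-≤ m q) (ℕ.≤-reflexive (ℕ.m+n∸n≡m Δ m)))

    opposite : ∀ m n → + (m / Δ) ≡ ℤ.- (+ (n / Δ)) → (m / Δ ≡ 0) × (n / Δ ≡ 0)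
    opposite m n eq with m / Δ | n / Δ
    opposite m n refl | zero | zero = refl , refl

    -- Equal nonzero quotients confine both numbers to one interval of length `Δ`; the quotient 0
    -- covers both sides of the origin and causes the factor 2.
    tq-close : ∀ x y → tq x ≡ tq y → ∣ x -ᶻ y ∣ ≤ 2 * Δ
    tq-close (+ m) (+ n) eq = ℕ.≤-trans (difference≤ m n (same-quotient m n (ℤ.+-injective eq)) (same-quotient n m (ℤ.+-injective (sym eq)))) (ℕ.m≤m+n Δ _)
    tq-close -[1+ m ] -[1+ n ] eq = ℕ.≤-trans (ℕ.≤-reflexive (trans (cong ∣_∣ (lem (+ suc m) (+ suc n))) (ℤ.∣-i∣≡∣i∣ (+ suc m -ᶻ + suc n))))
      (ℕ.≤-trans (difference≤ (suc m) (suc n) (same-quotient (suc m) (suc n) eq′) (same-quotient (suc n) (suc m) (sym eq′))) (ℕ.m≤m+n Δ _))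
      where
      eq′ : suc m / Δ ≡ suc n / Δ
      eq′ = ℤ.+-injective (ℤ.neg-injective eq)
      lem : ∀ a b → -ᶻ a -ᶻ -ᶻ b ≡ -ᶻ (a -ᶻ b)
      lem = ℤ-ring
    tq-close (+ m) -[1+ n ] eq with opposite m (suc n) eq
    ... | p , q = ℕ.≤-trans (ℤ.∣i-j∣≤∣i∣+∣j∣ (+ m) -[1+ n ]) (ℕ.+-mono-≤ (zero-quotient m p) (ℕ.≤-trans (zero-quotient (suc n) q) (ℕ.m≤m+n Δ 0)))
    tq-close -[1+ m ] (+ n) eq with opposite n (suc m) (sym eq)
    ... | p , q = ℕ.≤-trans (ℤ.∣i-j∣≤∣i∣+∣j∣ -[1+ m ] (+ n)) (ℕ.+-mono-≤ (zero-quotient (suc m) q) (ℕ.≤-trans (zero-quotient n p) (ℕ.m≤m+n Δ 0)))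

    -- A natural number is at most its fourth power, so the quotient itself is dominated without
    -- choosing a threshold.
    markov : ∀ z → Δ * Δ * (Δ * Δ) * ∣ tq z ∣ ≤ z ² * z ²
    markov z = begin
      Δ * Δ * (Δ * Δ) * ∣ tq z ∣ ≤⟨ ℕ.*-monoʳ-≤ (Δ * Δ * (Δ * Δ)) (n≤n⁴ ∣ tq z ∣) ⟩
      Δ * Δ * (Δ * Δ) * (t * t * (t * t)) ≡⟨ lem Δ t ⟩
      (t * Δ) * (t * Δ) * ((t * Δ) * (t * Δ)) ≤⟨ ℕ.*-mono-≤ (ℕ.*-mono-≤ tΔ≤ tΔ≤) (ℕ.*-mono-≤ tΔ≤ tΔ≤) ⟩
      z ² * z ² ∎
      where
      t : ℕ
      t = ∣ tq z ∣
      n≤n⁴ : ∀ n → n ≤ n * n * (n * n)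
      n≤n⁴ zero    = z≤n
      n≤n⁴ n@(suc _) = ℕ.≤-trans (ℕ.m≤m*n n n) (ℕ.m≤m*n (n * n) (n * n))
      lem : ∀ d t → d * d * (d * d) * (t * t * (t * t)) ≡ (t * d) * (t * d) * ((t * d) * (t * d))
      lem = ℕ-ring
      tΔ≤ : t * Δ ≤ ∣ z ∣
      tΔ≤ = ℕ.≤-trans (ℕ.≤-reflexive (cong (_* Δ) (∣tq∣ z))) (m/n*n≤m ∣ z ∣ Δ)

    -- The variance is the sum of the squared coefficients. Each coefficient is at most `K`, and
    -- their absolute values add up to at most the length.
    tq-moment : ∀ {n} K (xs : List (Literal n)) → (∀ i → occ i xs ≤ K) →
      Δ * Δ * (Δ * Δ) * ∑ᴸ (λ χ → ∣ tq (S (signs χ) xs) ∣) (allVecs n) ≤ 3 * 2 ^ n * (K * length xs * (K * length xs))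
    tq-moment {n} K xs h = begin
      D * ∑ᴸ (λ χ → ∣ tq (S (signs χ) xs) ∣) (allVecs n) ≡⟨ ∑ᴸ-*ˡ D _ (allVecs n) ⟨
      ∑ᴸ (λ χ → D * ∣ tq (S (signs χ) xs) ∣) (allVecs n) ≤⟨ ∑ᴸ-mono (allVecs n) (λ χ _ → markov (S (signs χ) xs)) ⟩
      ∑ᴸ (λ χ → S (signs χ) xs ² * S (signs χ) xs ²) (allVecs n) ≡⟨ ∑ᴸ-cong (λ χ → cong (λ z → z ² * z ²) (sym (dot-coefs xs χ))) (allVecs n) ⟩
      ∑ᴸ (λ χ → dot (coefs xs) χ ² * dot (coefs xs) χ ²) (allVecs n) ≤⟨ fourth-moment (coefs xs) ⟩
      3 * 2 ^ n * (sq (coefs xs) * sq (coefs xs)) ≤⟨ ℕ.*-monoʳ-≤ (3 * 2 ^ n) (ℕ.*-mono-≤ sq-coefs sq-coefs) ⟩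
      3 * 2 ^ n * (K * length xs * (K * length xs)) ∎
      where
      D : ℕ
      D = Δ * Δ * (Δ * Δ)
      sq-coefs : sq (coefs xs) ≤ K * length xs
      sq-coefs = ℕ.≤-trans (sq≤ K (coefs xs) (λ i → ℕ.≤-trans (lookup-coefs i xs) (h i))) (ℕ.*-monoʳ-≤ K (l1-coefs xs))

-- One partial colouring: chunks of all scales and their cost.

module Step where

  open Pigeon
  open Moments

  open ℕ.≤-Reasoning

  ∑ᶠ : ∀ n → (Fin n → ℕ) → ℕ
  ∑ᶠ zero    f = 0
  ∑ᶠ (suc n) f = f zero + ∑ᶠ n (λ i → f (suc i))

  ∑ᶠ-+ : ∀ n f g → ∑ᶠ n (λ i → f i + g i) ≡ ∑ᶠ n f + ∑ᶠ n g
  ∑ᶠ-+ zero    f g = refl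
  ∑ᶠ-+ (suc n) f g = trans (cong (λ z → f zero + g zero + z) (∑ᶠ-+ n _ _)) (lem (f zero) (g zero) _ _)
    where
    lem : ∀ a b c d → a + b + (c + d) ≡ a + c + (b + d)
    lem = ℕ-ring

  ∑ᶠ-0 : ∀ n → ∑ᶠ n (λ _ → 0) ≡ 0
  ∑ᶠ-0 zero    = refl
  ∑ᶠ-0 (suc n) = ∑ᶠ-0 n

  ∑ᶠ-δ : ∀ n (j : Fin n) → ∑ᶠ n (λ i → δ i j) ≡ 1
  ∑ᶠ-δ (suc n) zero    = cong suc (∑ᶠ-0 n)
  ∑ᶠ-δ (suc n) (suc j) = ∑ᶠ-δ n j

  ∑ᶠ≤ : ∀ n f K → (∀ i → f i ≤ K) → ∑ᶠ n f ≤ n * K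
  ∑ᶠ≤ zero    f K h = z≤n
  ∑ᶠ≤ (suc n) f K h = ℕ.+-mono-≤ (h zero) (∑ᶠ≤ n _ K (λ i → h (suc i)))

  ∑ᶠ-occ : ∀ {n} (xs : List (Literal n)) → ∑ᶠ n (λ i → occ i xs) ≡ length xs
  ∑ᶠ-occ {n} []       = ∑ᶠ-0 n
  ∑ᶠ-occ {n} (x ∷ xs) = trans (∑ᶠ-+ n (λ i → δ i (proj₁ x)) (λ i → occ i xs)) (cong₂ _+_ (∑ᶠ-δ n (proj₁ x)) (∑ᶠ-occ xs))

  length≤ : ∀ {n} K (xs : List (Literal n)) → (∀ i → occ i xs ≤ K) → length xs ≤ n * K
  length≤ {n} K xs h = ℕ.≤-trans (ℕ.≤-reflexive (sym (∑ᶠ-occ xs))) (∑ᶠ≤ n _ K h)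

  ∑ᴸ-take≤ : ∀ {X : Set} (f : X → ℕ) h xs → ∑ᴸ f (take h xs) ≤ ∑ᴸ f xs
  ∑ᴸ-take≤ f zero    xs       = z≤n
  ∑ᴸ-take≤ f (suc h) []       = z≤n
  ∑ᴸ-take≤ f (suc h) (x ∷ xs) = ℕ.+-monoʳ-≤ (f x) (∑ᴸ-take≤ f h xs)

  ∑ᴸ-drop≤ : ∀ {X : Set} (f : X → ℕ) h xs → ∑ᴸ f (drop h xs) ≤ ∑ᴸ f xs
  ∑ᴸ-drop≤ f zero    xs       = ℕ.≤-refl
  ∑ᴸ-drop≤ f (suc h) []       = z≤n
  ∑ᴸ-drop≤ f (suc h) (x ∷ xs) = ℕ.≤-trans (∑ᴸ-drop≤ f h xs) (ℕ.m≤n+m _ (f x))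

  length-take≤ : ∀ {X : Set} h (xs : List X) → length (take h xs) ≤ h
  length-take≤ h xs = ℕ.≤-trans (ℕ.≤-reflexive (List.length-take h xs)) (ℕ.m⊓n≤m h (length xs))

  S-take-+ : ∀ {n} (v : Fin n → ℤ) a h xs → S v (take (a + h) xs) ≡ S v (take a xs) +ᶻ S v (take h (drop a xs))
  S-take-+ v zero    h xs       = sym (ℤ.+-identityˡ _)
  S-take-+ v (suc a) h []       = sym (trans (cong (λ z → 0ℤ +ᶻ S v z) (List.take-[] h)) refl)
  S-take-+ v (suc a) h ((i , s) ∷ xs) = trans (cong (sign s *ᶻ v i +ᶻ_) (S-take-+ v a h xs)) (sym (ℤ.+-assoc (sign s *ᶻ v i) _ _))

  S-- : ∀ {n} (v w : Fin n → ℤ) xs → S (λ i → v i -ᶻ w i) xs ≡ S v xs -ᶻ S w xs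
  S-- v w []             = refl
  S-- v w ((i , s) ∷ xs) = trans (cong (sign s *ᶻ (v i -ᶻ w i) +ᶻ_) (S-- v w xs)) (lem (sign s) (v i) (w i) (S v xs) (S w xs))
    where
    lem : ∀ s v w a b → s *ᶻ (v -ᶻ w) +ᶻ (a -ᶻ b) ≡ s *ᶻ v +ᶻ a -ᶻ (s *ᶻ w +ᶻ b)
    lem = ℤ-ring

  module Multiscale (p : ℕ → ℤ) (p-0 : p 0 ≡ 0ℤ) (D : ℕ → ℕ) (len : ℕ) where

    ∑D : ℕ → ℕ
    ∑D zero    = 0
    ∑D (suc j) = ∑D j + D j

    walk : ∀ h d → (∀ c → suc c * h ≤ len → ∣ p (suc c * h) -ᶻ p (c * h) ∣ ≤ d) →
      ∀ c k → (k + c) * h ≤ len → ∣ p ((k + c) * h) -ᶻ p (c * h) ∣ ≤ k * d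
    walk h d step c zero    le = ℕ.≤-reflexive (cong ∣_∣ (ℤ.+-inverseʳ (p (c * h))))
    walk h d step c (suc k) le = begin
      ∣ p (suc (k + c) * h) -ᶻ p (c * h) ∣ ≡⟨ cong ∣_∣ (lem (p (suc (k + c) * h)) (p ((k + c) * h)) (p (c * h))) ⟩
      ∣ (p (suc (k + c) * h) -ᶻ p ((k + c) * h)) +ᶻ (p ((k + c) * h) -ᶻ p (c * h)) ∣
        ≤⟨ ℤ.∣i+j∣≤∣i∣+∣j∣ (p (suc (k + c) * h) -ᶻ p ((k + c) * h)) _ ⟩
      ∣ p (suc (k + c) * h) -ᶻ p ((k + c) * h) ∣ + ∣ p ((k + c) * h) -ᶻ p (c * h) ∣
        ≤⟨ ℕ.+-mono-≤ (step (k + c) le) (walk h d step c k (ℕ.≤-trans (ℕ.m≤n+m _ h) le)) ⟩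
      d + k * d ∎
      where
      lem : ∀ a b c → a -ᶻ c ≡ a -ᶻ b +ᶻ (b -ᶻ c)
      lem = ℤ-ring

    quot : ℕ → ℕ → ℕ
    quot ℓ zero    = ℓ
    quot ℓ (suc j) = quot ℓ j / 64

    quot≤ : ∀ ℓ j → quot ℓ j * 64 ^ j ≤ ℓ
    quot≤ ℓ zero    = ℕ.≤-reflexive (ℕ.*-identityʳ ℓ)
    quot≤ ℓ (suc j) = ℕ.≤-trans (ℕ.≤-reflexive (sym (ℕ.*-assoc (quot ℓ j / 64) 64 (64 ^ j)))) (ℕ.≤-trans (ℕ.*-monoˡ-≤ (64 ^ j) (m/n*n≤m (quot ℓ j) 64)) (quot≤ ℓ j))

    -- The expansion of ℓ in base 64: rounding from a multiple of 64^j down to a multiple of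
    -- 64^(j+1) removes as many chunks as the digit says, hence at most 63.
    descend : ∀ ℓ → ℓ ≤ len → ∀ j → (∀ i → i < j → ∀ c → suc c * 64 ^ i ≤ len → ∣ p (suc c * 64 ^ i) -ᶻ p (c * 64 ^ i) ∣ ≤ D i) →
      ∣ p ℓ -ᶻ p (quot ℓ j * 64 ^ j) ∣ ≤ 63 * ∑D j
    descend ℓ ℓ≤ zero    hyp = ℕ.≤-reflexive (cong ∣_∣ (trans (cong (λ z → p ℓ -ᶻ p z) (ℕ.*-identityʳ ℓ)) (ℤ.+-inverseʳ (p ℓ))))
    descend ℓ ℓ≤ (suc j) hyp = begin
      ∣ p ℓ -ᶻ p (m / 64 * 64 ^ suc j) ∣ ≡⟨ cong ∣_∣ (lem (p ℓ) (p (m * 64 ^ j)) _) ⟩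
      ∣ (p ℓ -ᶻ p (m * 64 ^ j)) +ᶻ (p (m * 64 ^ j) -ᶻ p (m / 64 * 64 ^ suc j)) ∣ ≤⟨ ℤ.∣i+j∣≤∣i∣+∣j∣ (p ℓ -ᶻ p (m * 64 ^ j)) _ ⟩
      ∣ p ℓ -ᶻ p (m * 64 ^ j) ∣ + ∣ p (m * 64 ^ j) -ᶻ p (m / 64 * 64 ^ suc j) ∣ ≤⟨ ℕ.+-mono-≤ (descend ℓ ℓ≤ j (λ i i<j → hyp i (ℕ.m<n⇒m<1+n i<j))) last ⟩
      63 * ∑D j + 63 * D j ≡⟨ ℕ.*-distribˡ-+ 63 (∑D j) (D j) ⟨
      63 * ∑D (suc j) ∎
      where
      m : ℕ
      m = quot ℓ j
      lem : ∀ a b c → a -ᶻ c ≡ a -ᶻ b +ᶻ (b -ᶻ c)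
      lem = ℤ-ring
      m≡ : m % 64 + m / 64 * 64 ≡ m
      m≡ = sym (m≡m%n+[m/n]*n m 64)
      last : ∣ p (m * 64 ^ j) -ᶻ p (m / 64 * 64 ^ suc j) ∣ ≤ 63 * D j
      last = begin
        ∣ p (m * 64 ^ j) -ᶻ p (m / 64 * 64 ^ suc j) ∣ ≡⟨ cong₂ (λ x y → ∣ p (x * 64 ^ j) -ᶻ p y ∣) (sym m≡) (sym (ℕ.*-assoc (m / 64) 64 (64 ^ j))) ⟩
        ∣ p ((m % 64 + m / 64 * 64) * 64 ^ j) -ᶻ p ((m / 64 * 64) * 64 ^ j) ∣ ≤⟨ walk (64 ^ j) (D j) (hyp j ℕ.≤-refl) (m / 64 * 64) (m % 64) (ℕ.≤-trans (ℕ.≤-reflexive (cong (_* 64 ^ j) m≡)) (ℕ.≤-trans (quot≤ ℓ j) ℓ≤)) ⟩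
        (m % 64) * D j ≤⟨ ℕ.*-monoˡ-≤ (D j) (ℕ.≤-pred (m%n<n m 64)) ⟩
        63 * D j ∎

    prefix-bound : ∀ j → len < 64 ^ j → (∀ i → i < j → ∀ c → suc c * 64 ^ i ≤ len → ∣ p (suc c * 64 ^ i) -ᶻ p (c * 64 ^ i) ∣ ≤ D i) →
      ∀ ℓ → ℓ ≤ len → ∣ p ℓ ∣ ≤ 63 * ∑D j
    prefix-bound j len< hyp ℓ ℓ≤ = subst (λ z → ∣ z ∣ ≤ 63 * ∑D j) (trans (cong (λ z → p ℓ -ᶻ p (z * 64 ^ j)) quot-0) (trans (cong (λ z → p ℓ -ᶻ z) p-0) (ℤ.+-identityʳ (p ℓ)))) (descend ℓ ℓ≤ j hyp)
      where
      quot-0 : quot ℓ j ≡ 0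
      quot-0 with quot ℓ j in eq
      ... | zero  = refl
      ... | suc q = ⊥-elim (ℕ.<⇒≱ len< (ℕ.≤-trans (ℕ.m≤m+n (64 ^ j) (q * 64 ^ j)) (ℕ.≤-trans (ℕ.≤-reflexive (cong (_* 64 ^ j) (sym eq))) (ℕ.≤-trans (quot≤ ℓ j) ℓ≤))))

  *-^-distrib : ∀ n a b → (a * b) ^ n ≡ a ^ n * b ^ n
  *-^-distrib zero    a b = refl
  *-^-distrib (suc n) a b = trans (cong (a * b *_) (*-^-distrib n a b)) (lem a b (a ^ n) (b ^ n))
    where
    lem : ∀ a b c d → a * b * (c * d) ≡ a * c * (b * d)
    lem = ℕ-ring

  -- (1 + 1/y)^z ≤ 1 / (1 - z/y), the reciprocal of Bernoulli's inequality.
  compound : ∀ y z → z ≤ y → suc y ^ z * (y ∸ z) ≤ y ^ z * y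
  compound y zero    _   = ℕ.≤-refl
  compound y (suc z) z<y = begin
    suc y * suc y ^ z * (y ∸ suc z) ≡⟨ lem₁ (suc y) (suc y ^ z) (y ∸ suc z) ⟩
    suc y ^ z * (suc y * (y ∸ suc z)) ≤⟨ ℕ.*-monoʳ-≤ (suc y ^ z) factor ⟩
    suc y ^ z * (y * (y ∸ z)) ≡⟨ lem₂ (suc y ^ z) y (y ∸ z) ⟩
    y * (suc y ^ z * (y ∸ z)) ≤⟨ ℕ.*-monoʳ-≤ y (compound y z (ℕ.<⇒≤ z<y)) ⟩
    y * (y ^ z * y) ≡⟨ ℕ.*-assoc y (y ^ z) y ⟨
    y * y ^ z * y ∎
    where
    lem₁ : ∀ a b c → a * b * c ≡ b * (a * c)
    lem₁ = ℕ-ring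
    lem₂ : ∀ a b c → a * (b * c) ≡ b * (a * c)
    lem₂ = ℕ-ring
    factor : suc y * (y ∸ suc z) ≤ y * (y ∸ z)
    factor = begin
      (y ∸ suc z) + y * (y ∸ suc z) ≤⟨ ℕ.+-monoˡ-≤ _ (ℕ.m∸n≤m y (suc z)) ⟩
      y + y * (y ∸ suc z) ≡⟨ ℕ.*-suc y (y ∸ suc z) ⟨
      y * suc (y ∸ suc z) ≡⟨ cong (y *_) (ℕ.+-∸-assoc 1 z<y) ⟨
      y * (y ∸ z) ∎

  -- This is (1 + 1/(2z))^z ≤ 2, the case y = 2z of `compound`. The common factor 4 only matches the
  -- shape of `2 ^ κ i + 4`.
  compound-half : ∀ z → (4 * (2 * z + 1)) ^ z ≤ 2 * (4 * (2 * z)) ^ z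
  compound-half zero    = s≤s z≤n
  compound-half z@(suc _) = begin
    (4 * (2 * z + 1)) ^ z ≡⟨ *-^-distrib z 4 (2 * z + 1) ⟩
    4 ^ z * (2 * z + 1) ^ z ≤⟨ ℕ.*-monoʳ-≤ (4 ^ z) (ℕ.*-cancelʳ-≤ ((2 * z + 1) ^ z) (2 * (2 * z) ^ z) z main) ⟩
    4 ^ z * (2 * (2 * z) ^ z) ≡⟨ lem (4 ^ z) ((2 * z) ^ z) ⟩
    2 * (4 ^ z * (2 * z) ^ z) ≡⟨ cong (2 *_) (*-^-distrib z 4 (2 * z)) ⟨
    2 * (4 * (2 * z)) ^ z ∎
    where
    lem : ∀ a b → a * (2 * b) ≡ 2 * (a * b)
    lem = ℕ-ring
    lem₂ : ∀ a z → a * (2 * z) ≡ 2 * a * z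
    lem₂ = ℕ-ring
    main : (2 * z + 1) ^ z * z ≤ 2 * (2 * z) ^ z * z
    main = subst₂ _≤_ (cong₂ (λ a b → a ^ z * b) (ℕ.+-comm 1 (2 * z)) (trans (cong (_∸ z) (cong (λ t → z + t) (ℕ.+-identityʳ z))) (ℕ.m+n∸n≡m z z))) (lem₂ ((2 * z) ^ z) z)
      (compound (2 * z) z (ℕ.m≤m+n z _))

  64^≡ : ∀ i → 64 ^ i ≡ 2 ^ i * 2 ^ i * 2 ^ i * (2 ^ i * 2 ^ i * 2 ^ i)
  64^≡ zero    = refl
  64^≡ (suc i) = trans (cong (64 *_) (64^≡ i)) (lem (2 ^ i))
    where
    lem : ∀ p → 64 * (p * p * p * (p * p * p)) ≡ (2 * p) * (2 * p) * (2 * p) * ((2 * p) * (2 * p) * (2 * p))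
    lem = ℕ-ring

  -- The integer form of log₂ 5 < 19/8: 5^8 = 390625 and 2^19 = 524288.
  5^≤2^ : ∀ x → 5 ^ (8 * x) ≤ 2 ^ (19 * x)
  5^≤2^ x = begin
    5 ^ (8 * x) ≡⟨ ℕ.^-*-assoc 5 8 x ⟨
    (5 ^ 8) ^ x ≤⟨ ℕ.^-monoˡ-≤ x (ℕ.≤ᵇ⇒≤ (5 ^ 8) (2 ^ 19) _) ⟩
    (2 ^ 19) ^ x ≡⟨ ℕ.^-*-assoc 2 19 x ⟩
    2 ^ (19 * x) ∎

  -- Binary exponents in units of μ: on the left 1/8 for the cost, 19/8 for 5^μ and 1/8 for the
  -- product of weights, together 21/8; on the right 2·7/8 + 1 = 22/8. The comparison is made after
  -- raising to the power 8 U, where these exponents are integers.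
  volume-inequality : ∀ U μ A σ E num den → .{{_ : NonZero den}} → 0 < U * μ → num ^ U ≤ 2 ^ E * den ^ U →
    8 * E ≤ U * μ → A * 8 ≤ μ → 7 * μ ≤ 8 * σ → 2 ^ A * 5 ^ μ * num < 4 ^ σ * 2 ^ μ * den
  volume-inequality U μ A σ E num den 0<Uμ num≤ E≤ A≤ σ≥ = ℕ.≰⇒> λ le → ℕ.<⇒≱ (exponents V refl)
      (ℕ.≮⇒≥ λ lt → ℕ.<⇒≱ (ℕ.^-monoʳ-< 2 (s≤s (s≤s z≤n)) lt)
        (ℕ.*-cancelʳ-≤ (2 ^ ((2 * σ + μ) * V)) (2 ^ (A * V + 19 * (μ * U) + E * 8)) (den ^ V) {{ℕ.m^n≢0 den V}} (powers V refl le)))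
    where
    V : ℕ
    V = U * 8
    powers : ∀ V → V ≡ U * 8 → 4 ^ σ * 2 ^ μ * den ≤ 2 ^ A * 5 ^ μ * num →
      2 ^ ((2 * σ + μ) * V) * den ^ V ≤ 2 ^ (A * V + 19 * (μ * U) + E * 8) * den ^ V
    powers V V≡ le = begin
      2 ^ ((2 * σ + μ) * V) * den ^ V ≡⟨ cong (_* den ^ V) (ℕ.^-*-assoc 2 (2 * σ + μ) V) ⟨
      (2 ^ (2 * σ + μ)) ^ V * den ^ V ≡⟨ *-^-distrib V (2 ^ (2 * σ + μ)) den ⟨
      (2 ^ (2 * σ + μ) * den) ^ V ≡⟨ cong (λ z → (z * den) ^ V) (trans (ℕ.^-distribˡ-+-* 2 (2 * σ) μ) (cong (_* 2 ^ μ) (sym (ℕ.^-*-assoc 2 2 σ)))) ⟩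
      (4 ^ σ * 2 ^ μ * den) ^ V ≤⟨ ℕ.^-monoˡ-≤ V le ⟩
      (2 ^ A * 5 ^ μ * num) ^ V ≡⟨ trans (*-^-distrib V (2 ^ A * 5 ^ μ) num) (cong (_* num ^ V) (trans (*-^-distrib V (2 ^ A) (5 ^ μ)) (cong₂ _*_ (ℕ.^-*-assoc 2 A V) (ℕ.^-*-assoc 5 μ V)))) ⟩
      2 ^ (A * V) * 5 ^ (μ * V) * num ^ V ≤⟨ ℕ.*-mono-≤ (ℕ.*-monoʳ-≤ (2 ^ (A * V)) five) num-V ⟩
      2 ^ (A * V) * 2 ^ (19 * (μ * U)) * (2 ^ (E * 8) * den ^ V) ≡⟨ ℕ.*-assoc (2 ^ (A * V) * 2 ^ (19 * (μ * U))) (2 ^ (E * 8)) (den ^ V) ⟨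
      2 ^ (A * V) * 2 ^ (19 * (μ * U)) * 2 ^ (E * 8) * den ^ V ≡⟨ cong (_* den ^ V) (sym (trans (ℕ.^-distribˡ-+-* 2 (A * V + 19 * (μ * U)) (E * 8)) (cong (_* 2 ^ (E * 8)) (ℕ.^-distribˡ-+-* 2 (A * V) (19 * (μ * U)))))) ⟩
      2 ^ (A * V + 19 * (μ * U) + E * 8) * den ^ V ∎
      where
      lem : ∀ μ U → μ * (U * 8) ≡ 8 * (μ * U)
      lem = ℕ-ring
      five : 5 ^ (μ * V) ≤ 2 ^ (19 * (μ * U))
      five = ℕ.≤-trans (ℕ.≤-reflexive (cong (5 ^_) (trans (cong (μ *_) V≡) (lem μ U)))) (5^≤2^ (μ * U))
      num-V : num ^ V ≤ 2 ^ (E * 8) * den ^ V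
      num-V = begin
        num ^ V ≡⟨ trans (cong (num ^_) V≡) (sym (ℕ.^-*-assoc num U 8)) ⟩
        (num ^ U) ^ 8 ≤⟨ ℕ.^-monoˡ-≤ 8 num≤ ⟩
        (2 ^ E * den ^ U) ^ 8 ≡⟨ *-^-distrib 8 (2 ^ E) (den ^ U) ⟩
        (2 ^ E) ^ 8 * (den ^ U) ^ 8 ≡⟨ cong₂ _*_ (ℕ.^-*-assoc 2 E 8) (trans (ℕ.^-*-assoc den U 8) (cong (den ^_) (sym V≡))) ⟩
        2 ^ (E * 8) * den ^ V ∎
    exponents : ∀ V → V ≡ U * 8 → A * V + 19 * (μ * U) + E * 8 < (2 * σ + μ) * V
    exponents V V≡ = begin-strict
      A * V + 19 * (μ * U) + E * 8 ≡⟨ trans (cong (λ z → A * z + 19 * (μ * U) + E * 8) V≡) (lem₁ A U μ E) ⟩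
      U * (A * 8) + 19 * (U * μ) + 8 * E ≤⟨ ℕ.+-mono-≤ (ℕ.+-monoˡ-≤ (19 * (U * μ)) (ℕ.*-monoʳ-≤ U A≤)) E≤ ⟩
      U * μ + 19 * (U * μ) + U * μ <⟨ ℕ.m<m+n _ 0<Uμ ⟩
      U * μ + 19 * (U * μ) + U * μ + U * μ ≡⟨ lem₂ U μ ⟩
      2 * U * (7 * μ) + 8 * (U * μ) ≤⟨ ℕ.+-monoˡ-≤ (8 * (U * μ)) (ℕ.*-monoʳ-≤ (2 * U) σ≥) ⟩
      2 * U * (8 * σ) + 8 * (U * μ) ≡⟨ trans (lem₃ U σ μ) (cong ((2 * σ + μ) *_) (sym V≡)) ⟩
      (2 * σ + μ) * V ∎
      where
      lem₁ : ∀ A U μ e → A * (U * 8) + 19 * (μ * U) + e * 8 ≡ U * (A * 8) + 19 * (U * μ) + 8 * e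
      lem₁ = ℕ-ring
      lem₂ : ∀ U μ → U * μ + 19 * (U * μ) + U * μ + U * μ ≡ 2 * U * (7 * μ) + 8 * (U * μ)
      lem₂ = ℕ-ring
      lem₃ : ∀ U σ μ → 2 * U * (8 * σ) + 8 * (U * μ) ≡ (2 * σ + μ) * (U * 8)
      lem₃ = ℕ-ring

  chunk : ∀ {X : Set} → ℕ → List X → ℕ → List X
  chunk i xs c = take (64 ^ i) (drop (c * 64 ^ i) xs)

  chunkCount : ∀ {X : Set} → ℕ → List X → ℕ
  chunkCount i xs = _/_ (length xs) (64 ^ i) {{ℕ.m^n≢0 64 i}}

  chunks : ∀ {X : Set} → ℕ → List X → List (List X)
  chunks i xs = map (chunk i xs) (upTo (chunkCount i xs))

  length-concatMap-chunks : ∀ {X : Set} i B (Ls : List (List X)) → (∀ xs → xs ∈ Ls → length xs ≤ B) →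
    length (concatMap (chunks i) Ls) * 64 ^ i ≤ length Ls * B
  length-concatMap-chunks i B []        h = z≤n
  length-concatMap-chunks i B (xs ∷ Ls) h = begin
    length (chunks i xs ++ concatMap (chunks i) Ls) * 64 ^ i ≡⟨ cong (_* 64 ^ i) (List.length-++ (chunks i xs)) ⟩
    (length (chunks i xs) + length (concatMap (chunks i) Ls)) * 64 ^ i ≡⟨ ℕ.*-distribʳ-+ (64 ^ i) (length (chunks i xs)) _ ⟩
    length (chunks i xs) * 64 ^ i + length (concatMap (chunks i) Ls) * 64 ^ i
      ≤⟨ ℕ.+-mono-≤ (ℕ.≤-trans (ℕ.≤-reflexive (cong (_* 64 ^ i) (trans (List.length-map (chunk i xs) (upTo (chunkCount i xs))) (List.length-upTo (chunkCount i xs))))) (ℕ.≤-trans (m/n*n≤m (length xs) (64 ^ i) {{ℕ.m^n≢0 64 i}}) (h xs (here refl)))) (length-concatMap-chunks i B Ls (λ ys p → h ys (there p))) ⟩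
    B + length Ls * B ∎

  ∈-chunks : ∀ {X : Set} i (xs : List X) c → suc c * 64 ^ i ≤ length xs → chunk i xs c ∈ chunks i xs
  ∈-chunks i xs c h = ∈-map⁺ (chunk i xs) (∈-upTo⁺ (subst (_≤ chunkCount i xs) (Data.Nat.DivMod.m*n/n≡m (suc c) (64 ^ i) {{ℕ.m^n≢0 64 i}}) (/-monoˡ-≤ (64 ^ i) {{ℕ.m^n≢0 64 i}} h)))

  module Scales (N K s L : ℕ) {{s≢0 : NonZero s}} (NK≤ : N * K ≤ 64 ^ L) (K≤ : K ≤ s * s) where

    P : ℕ
    P = 2 ^ L

    -- With t = L - i there are at most 64^t μ chunks of scale i, and by the fourth moment a chunk has expected
    -- quotient O(256^-t) by Δ i.  The weights κ keep both Σ 64^t κ 256^-t and Σ 64^t 2^-κ small.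
    Δ κ : ℕ → ℕ
    Δ i = 8 * s * (P * P) * 2 ^ i
    κ i = 7 * suc (L ∸ i)

    instance
      P≢0 : NonZero P
      P≢0 = ℕ.m^n≢0 2 L

    Δ≢0 : ∀ i → NonZero (Δ i)
    Δ≢0 i = ℕ.m*n≢0 (8 * s * (P * P)) (2 ^ i) {{ℕ.m*n≢0 (8 * s) (P * P) {{ℕ.m*n≢0 8 s}} {{ℕ.m*n≢0 P P}}}} {{ℕ.m^n≢0 2 i}}

    -- The linear growth of `κ` is bounded by 2^t with t = L - i. This spends half of the decay 4^-t
    -- that remains from 64^t·256^-t; the other half makes the sum over scales converge.
    κp≤ : ∀ i → i ≤ L → κ i * 2 ^ i ≤ 7 * P
    κp≤ i i≤L = begin
      7 * suc (L ∸ i) * 2 ^ i ≡⟨ ℕ.*-assoc 7 (suc (L ∸ i)) (2 ^ i) ⟩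
      7 * (suc (L ∸ i) * 2 ^ i) ≤⟨ ℕ.*-monoʳ-≤ 7 (ℕ.*-monoˡ-≤ (2 ^ i) (1+n≤2^n (L ∸ i))) ⟩
      7 * (2 ^ (L ∸ i) * 2 ^ i) ≡⟨ cong (7 *_) (trans (sym (ℕ.^-distribˡ-+-* 2 (L ∸ i) i)) (cong (2 ^_) (ℕ.m∸n+n≡m i≤L))) ⟩
      7 * P ∎

    -- A common exponent that makes all the fractional entropies 2^(3 - κ i) integral.
    U : ℕ
    U = 128 * 128 ^ L

    -- Since 2^κ = 8 z, the ratio of the bases is 1 + 1/(2z), and z such factors cost one bit. As U
    -- = z w, the power `U` costs w bits.
    κ-product : ∀ i → i ≤ L → (2 ^ κ i + 4) ^ U ≤ 2 ^ (8 * 128 ^ i) * (2 ^ κ i) ^ U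
    κ-product i i≤L = begin
      (2 ^ κ i + 4) ^ U ≡⟨ cong₂ (λ x y → x ^ y) (trans (cong (_+ 4) 2^κ) (lem₁ z)) U≡ ⟩
      (4 * (2 * z + 1)) ^ (z * w) ≡⟨ ℕ.^-*-assoc (4 * (2 * z + 1)) z w ⟨
      ((4 * (2 * z + 1)) ^ z) ^ w ≤⟨ ℕ.^-monoˡ-≤ w (compound-half z) ⟩
      (2 * (4 * (2 * z)) ^ z) ^ w ≡⟨ *-^-distrib w 2 ((4 * (2 * z)) ^ z) ⟩
      2 ^ w * ((4 * (2 * z)) ^ z) ^ w ≡⟨ cong (2 ^ w *_) (ℕ.^-*-assoc (4 * (2 * z)) z w) ⟩
      2 ^ w * (4 * (2 * z)) ^ (z * w) ≡⟨ cong₂ (λ x y → 2 ^ w * x ^ y) 2^κ U≡ ⟨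
      2 ^ w * (2 ^ κ i) ^ U ∎
      where
      z w : ℕ
      z = 16 * 128 ^ (L ∸ i)
      w = 8 * 128 ^ i
      lem₁ : ∀ z → 4 * (2 * z) + 4 ≡ 4 * (2 * z + 1)
      lem₁ = ℕ-ring
      lem₂ : ∀ x → 128 * x ≡ 4 * (2 * (16 * x))
      lem₂ = ℕ-ring
      lem₃ : ∀ x y → 128 * (x * y) ≡ 16 * x * (8 * y)
      lem₃ = ℕ-ring
      2^κ : 2 ^ κ i ≡ 4 * (2 * z)
      2^κ = trans (sym (ℕ.^-*-assoc 2 7 (suc (L ∸ i)))) (lem₂ (128 ^ (L ∸ i)))
      U≡ : U ≡ z * w
      U≡ = trans (cong (128 *_) (trans (cong (128 ^_) (sym (ℕ.m∸n+n≡m i≤L))) (ℕ.^-distribˡ-+-* 128 (L ∸ i) i))) (lem₃ (128 ^ (L ∸ i)) (128 ^ i))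

    module Family {μ : ℕ} (Ls : List (List (Literal μ))) (len≤N : length Ls ≤ N) (occ≤K : ∀ xs → xs ∈ Ls → ∀ v → occ v xs ≤ K) where

      Constraint : Set
      Constraint = ℕ × List (Literal μ)

      b : Constraint → Vec Bool μ → ℤ
      b (i , ys) χ = tq (Δ i) {{Δ≢0 i}} (S (signs χ) ys)

      chunksAt : ℕ → List (List (Literal μ))
      chunksAt i = concatMap (chunks i) Ls

      at : ℕ → List (List (Literal μ)) → List Constraint
      at i = map (i ,_)

      constraints : ℕ → List Constraint
      constraints zero    = at 0 (chunksAt 0)
      constraints (suc J) = at (suc J) (chunksAt (suc J)) ++ constraints J

      T : ℕ → ℕ
      T i = length (chunksAt i)

      T-bound : ∀ i → T i * 64 ^ i ≤ 64 ^ L * μ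
      T-bound i = begin
        T i * 64 ^ i ≤⟨ length-concatMap-chunks i (μ * K) Ls (λ xs p → length≤ K xs (occ≤K xs p)) ⟩
        length Ls * (μ * K) ≤⟨ ℕ.*-monoˡ-≤ (μ * K) len≤N ⟩
        N * (μ * K) ≡⟨ lem N μ K ⟩
        N * K * μ ≤⟨ ℕ.*-monoˡ-≤ μ NK≤ ⟩
        64 ^ L * μ ∎
        where
        lem : ∀ a b c → a * (b * c) ≡ a * c * b
        lem = ℕ-ring

      chunk-length : ∀ i ys → ys ∈ chunksAt i → length ys ≤ 64 ^ i
      chunk-length i ys p with find (∈-concatMap⁻ (chunks i) {xs = Ls} p)
      ... | xs , _ , q with ∈-map⁻ (chunk i xs) q
      ... | c , _ , refl = length-take≤ (64 ^ i) (drop (c * 64 ^ i) xs)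

      chunk-occ : ∀ i ys → ys ∈ chunksAt i → ∀ v → occ v ys ≤ K
      chunk-occ i ys p v with find (∈-concatMap⁻ (chunks i) {xs = Ls} p)
      ... | xs , xs∈ , q with ∈-map⁻ (chunk i xs) q
      ... | c , _ , refl = ℕ.≤-trans (∑ᴸ-take≤ _ (64 ^ i) (drop (c * 64 ^ i) xs)) (ℕ.≤-trans (∑ᴸ-drop≤ _ (c * 64 ^ i) xs) (occ≤K xs xs∈ v))

      M : ℕ
      M = 2 ^ μ

      deviation : Constraint → ℕ
      deviation c = ∑ᴸ (λ χ → ∣ b c χ ∣) (allVecs μ)

      P⁷ : ℕ
      P⁷ = P * (P * P * P * (P * P * P))

      -- In `tq-moment` the fourth power of `Δ i` is 4096 s^4 P^8 2^(4i). Here s^4 cancels K^2, and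
      -- 2^(4i) cancels against 64^(2i), leaving 64^i·4^i.
      chunk-deviation : ∀ i ys → ys ∈ chunksAt i → P⁷ * (4096 * P * deviation (i , ys)) ≤ 3 * M * (64 ^ i * 2 ^ i * 2 ^ i)
      chunk-deviation i ys p = ℕ.*-cancelˡ-≤ (s * s * s * s * (q * q * q * q)) {{nz}} (begin
        s * s * s * s * (q * q * q * q) * (P⁷ * (4096 * P * B)) ≡⟨ lem₁ s q P B ⟩
        Δ i * Δ i * (Δ i * Δ i) * B ≤⟨ tq-moment (Δ i) {{Δ≢0 i}} K ys (chunk-occ i ys p) ⟩
        3 * M * (K * length ys * (K * length ys)) ≤⟨ ℕ.*-monoʳ-≤ (3 * M) (ℕ.*-mono-≤ K-len K-len) ⟩
        3 * M * (s * s * h * (s * s * h)) ≡⟨ cong (λ z → 3 * M * (s * s * h * (s * s * z))) (64^≡ i) ⟩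
        3 * M * (s * s * h * (s * s * (q * q * q * (q * q * q)))) ≡⟨ lem₂ s q M h ⟩
        s * s * s * s * (q * q * q * q) * (3 * M * (h * q * q)) ∎)
        where
        q h B : ℕ
        q = 2 ^ i
        h = 64 ^ i
        B = deviation (i , ys)
        nz : NonZero (s * s * s * s * (q * q * q * q))
        nz = ℕ.m*n≢0 (s * s * s * s) (q * q * q * q) {{ℕ.m*n≢0 (s * s * s) s {{ℕ.m*n≢0 (s * s) s {{ℕ.m*n≢0 s s}}}}}} {{ℕ.m*n≢0 (q * q * q) q {{ℕ.m*n≢0 (q * q) q {{ℕ.m*n≢0 q q {{q≢0}} {{q≢0}}}} {{q≢0}}}} {{q≢0}}}}
          where
          q≢0 : NonZero q
          q≢0 = ℕ.m^n≢0 2 i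
        K-len : K * length ys ≤ s * s * h
        K-len = ℕ.*-mono-≤ K≤ (chunk-length i ys p)
        lem₁ : ∀ s q P B → s * s * s * s * (q * q * q * q) * (P * (P * P * P * (P * P * P)) * (4096 * P * B)) ≡ 8 * s * (P * P) * q * (8 * s * (P * P) * q) * (8 * s * (P * P) * q * (8 * s * (P * P) * q)) * B
        lem₁ = ℕ-ring
        lem₂ : ∀ s q M h → 3 * M * (s * s * h * (s * s * (q * q * q * (q * q * q)))) ≡ s * s * s * s * (q * q * q * q) * (3 * M * (h * q * q))
        lem₂ = ℕ-ring

      total-deviation : List Constraint → ℕ
      total-deviation = ∑ᴸ (λ c → κ (proj₁ c) * deviation c)

      scale-deviation : ∀ i → i ≤ L → 4096 * P * total-deviation (at i (chunksAt i)) ≤ 21 * M * μ * 2 ^ i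
      scale-deviation i i≤L = ℕ.*-cancelˡ-≤ P⁷ {{P⁷≢0}} (begin
        P⁷ * (4096 * P * total-deviation (at i (chunksAt i))) ≡⟨ cong (λ z → P⁷ * (4096 * P * z)) (trans (∑ᴸ-map _ (i ,_) (chunksAt i)) (∑ᴸ-*ˡ (κ i) (λ ys → deviation (i , ys)) (chunksAt i))) ⟩
        P⁷ * (4096 * P * (κ i * X)) ≡⟨ lem₁ P⁷ (4096 * P) (κ i) X ⟩
        κ i * (P⁷ * (4096 * P) * X) ≡⟨ cong (κ i *_) (∑ᴸ-*ˡ (P⁷ * (4096 * P)) _ (chunksAt i)) ⟨
        κ i * ∑ᴸ (λ ys → P⁷ * (4096 * P) * deviation (i , ys)) (chunksAt i)
          ≤⟨ ℕ.*-monoʳ-≤ (κ i) (∑ᴸ-mono (chunksAt i) (λ ys p → ℕ.≤-trans (ℕ.≤-reflexive (ℕ.*-assoc P⁷ (4096 * P) _)) (chunk-deviation i ys p))) ⟩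
        κ i * ∑ᴸ (λ ys → 3 * M * (64 ^ i * q * q)) (chunksAt i) ≡⟨ cong (κ i *_) (∑ᴸ-const _ (chunksAt i)) ⟩
        κ i * (T i * (3 * M * (64 ^ i * q * q))) ≡⟨ lem₂ (κ i) (T i) M (64 ^ i) q ⟩
        3 * M * q * ((κ i * q) * (T i * 64 ^ i)) ≤⟨ ℕ.*-monoʳ-≤ (3 * M * q) (ℕ.*-mono-≤ (κp≤ i i≤L) (T-bound i)) ⟩
        3 * M * q * (7 * P * (64 ^ L * μ)) ≡⟨ cong (λ z → 3 * M * q * (7 * P * (z * μ))) (64^≡ L) ⟩
        3 * M * q * (7 * P * (P * P * P * (P * P * P) * μ)) ≡⟨ lem₃ M q P μ ⟩
        P⁷ * (21 * M * μ * q) ∎)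
        where
        q X : ℕ
        q = 2 ^ i
        X = ∑ᴸ (λ ys → deviation (i , ys)) (chunksAt i)
        P⁷≢0 : NonZero P⁷
        P⁷≢0 = ℕ.m*n≢0 P _ {{P≢0}} {{ℕ.m*n≢0 (P * P * P) (P * P * P) {{P³}} {{P³}}}}
          where
          P³ : NonZero (P * P * P)
          P³ = ℕ.m*n≢0 (P * P) P {{ℕ.m*n≢0 P P}}
        lem₁ : ∀ a b c d → a * (b * (c * d)) ≡ c * (a * b * d)
        lem₁ = ℕ-ring
        lem₂ : ∀ k t M h q → k * (t * (3 * M * (h * q * q))) ≡ 3 * M * q * ((k * q) * (t * h))
        lem₂ = ℕ-ring
        lem₃ : ∀ M q P μ → 3 * M * q * (7 * P * (P * P * P * (P * P * P) * μ)) ≡ P * (P * P * P * (P * P * P)) * (21 * M * μ * q)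
        lem₃ = ℕ-ring

      -- The additional `c` stands for the missing initial part of the geometric series, so that one
      -- induction step is an exact doubling.
      geometric : (F : ℕ → ℕ) (G : ℕ → ℕ) (c : ℕ) → F 0 ≡ G 0 → (∀ J → F (suc J) ≡ G (suc J) + F J) → (∀ i → i ≤ L → G i ≤ c * 2 ^ i) →
        ∀ J → J ≤ L → F J + c ≤ c * (2 * 2 ^ J)
      geometric F G c F0 Fs h zero    _   = ℕ.≤-trans (ℕ.+-monoˡ-≤ c (ℕ.≤-trans (ℕ.≤-reflexive F0) (h 0 z≤n))) (ℕ.≤-reflexive (lem c))
        where
        lem : ∀ c → c * 1 + c ≡ c * 2
        lem = ℕ-ring
      geometric F G c F0 Fs h (suc J) J<L = begin
        F (suc J) + c ≡⟨ trans (cong (_+ c) (Fs J)) (ℕ.+-assoc (G (suc J)) (F J) c) ⟩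
        G (suc J) + (F J + c) ≤⟨ ℕ.+-mono-≤ (h (suc J) J<L) (geometric F G c F0 Fs h J (ℕ.<⇒≤ J<L)) ⟩
        c * (2 * 2 ^ J) + c * (2 * 2 ^ J) ≡⟨ lem c (2 ^ J) ⟩
        c * (2 * (2 * 2 ^ J)) ∎
        where
        lem : ∀ c q → c * (2 * q) + c * (2 * q) ≡ c * (2 * (2 * q))
        lem = ℕ-ring

      all-deviation : ∀ J → J ≤ L → 4096 * total-deviation (constraints J) ≤ 42 * (M * μ)
      all-deviation J J≤L = ℕ.*-cancelˡ-≤ P (begin
        P * (4096 * total-deviation (constraints J)) ≡⟨ lem₁ P (total-deviation (constraints J)) ⟩
        4096 * P * total-deviation (constraints J) ≤⟨ ℕ.m≤m+n _ (21 * M * μ) ⟩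
        4096 * P * total-deviation (constraints J) + 21 * M * μ
          ≤⟨ geometric (λ J → 4096 * P * total-deviation (constraints J)) (λ i → 4096 * P * total-deviation (at i (chunksAt i))) (21 * M * μ) refl
               (λ J → trans (cong (4096 * P *_) (∑ᴸ-++ _ (at (suc J) (chunksAt (suc J))) (constraints J))) (ℕ.*-distribˡ-+ (4096 * P) _ _)) scale-deviation J J≤L ⟩
        21 * M * μ * (2 * 2 ^ J) ≤⟨ ℕ.*-monoʳ-≤ (21 * M * μ) (ℕ.*-monoʳ-≤ 2 (ℕ.^-monoʳ-≤ 2 J≤L)) ⟩
        21 * M * μ * (2 * P) ≡⟨ lem₂ M μ P ⟩
        P * (42 * (M * μ)) ∎)
        where
        lem₁ : ∀ P x → P * (4096 * x) ≡ 4096 * P * x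
        lem₁ = ℕ-ring
        lem₂ : ∀ M μ P → 21 * M * μ * (2 * P) ≡ P * (42 * (M * μ))
        lem₂ = ℕ-ring

      entropy : ℕ → ℕ
      entropy zero    = T 0 * (8 * 128 ^ 0)
      entropy (suc J) = T (suc J) * (8 * 128 ^ suc J) + entropy J

      num den : List Constraint → ℕ
      num = ∏ᴸ (λ c → 2 ^ κ (proj₁ c) + 4)
      den = ∏ᴸ (λ c → 2 ^ κ (proj₁ c))

      scale-product : ∀ i → i ≤ L → ∀ yss → num (at i yss) ^ U ≤ 2 ^ (length yss * (8 * 128 ^ i)) * den (at i yss) ^ U
      scale-product i i≤L []         = ℕ.≤-reflexive (sym (ℕ.*-identityˡ (1 ^ U)))
      scale-product i i≤L (ys ∷ yss) = begin
        ((2 ^ κ i + 4) * num (at i yss)) ^ U ≡⟨ *-^-distrib U (2 ^ κ i + 4) (num (at i yss)) ⟩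
        (2 ^ κ i + 4) ^ U * num (at i yss) ^ U ≤⟨ ℕ.*-mono-≤ (κ-product i i≤L) (scale-product i i≤L yss) ⟩
        2 ^ w * (2 ^ κ i) ^ U * (2 ^ (length yss * w) * den (at i yss) ^ U) ≡⟨ lem (2 ^ w) ((2 ^ κ i) ^ U) _ _ ⟩
        2 ^ w * 2 ^ (length yss * w) * ((2 ^ κ i) ^ U * den (at i yss) ^ U) ≡⟨ cong₂ _*_ (ℕ.^-distribˡ-+-* 2 w (length yss * w)) (*-^-distrib U (2 ^ κ i) (den (at i yss))) ⟨
        2 ^ (w + length yss * w) * (2 ^ κ i * den (at i yss)) ^ U ∎
        where
        w : ℕ
        w = 8 * 128 ^ i
        lem : ∀ a b c d → a * b * (c * d) ≡ a * c * (b * d)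
        lem = ℕ-ring

      all-product : ∀ J → J ≤ L → num (constraints J) ^ U ≤ 2 ^ entropy J * den (constraints J) ^ U
      all-product zero    J≤L = scale-product 0 J≤L (chunksAt 0)
      all-product (suc J) J<L = begin
        num (C₁ ++ C₂) ^ U ≡⟨ trans (cong (_^ U) (∏ᴸ-++ _ C₁ C₂)) (*-^-distrib U (num C₁) (num C₂)) ⟩
        num C₁ ^ U * num C₂ ^ U ≤⟨ ℕ.*-mono-≤ (scale-product (suc J) J<L (chunksAt (suc J))) (all-product J (ℕ.<⇒≤ J<L)) ⟩
        2 ^ w * den C₁ ^ U * (2 ^ entropy J * den C₂ ^ U) ≡⟨ lem (2 ^ w) (den C₁ ^ U) (2 ^ entropy J) (den C₂ ^ U) ⟩
        2 ^ w * 2 ^ entropy J * (den C₁ ^ U * den C₂ ^ U) ≡⟨ cong₂ _*_ (sym (ℕ.^-distribˡ-+-* 2 w (entropy J))) (sym (trans (cong (_^ U) (∏ᴸ-++ _ C₁ C₂)) (*-^-distrib U (den C₁) (den C₂)))) ⟩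
        2 ^ (w + entropy J) * den (C₁ ++ C₂) ^ U ∎
        where
        C₁ C₂ : List Constraint
        C₁ = at (suc J) (chunksAt (suc J))
        C₂ = constraints J
        w : ℕ
        w = T (suc J) * (8 * 128 ^ suc J)
        lem : ∀ a b c d → a * b * (c * d) ≡ a * c * (b * d)
        lem = ℕ-ring

      -- All constraints together cost at most μ/8 bits. The factor 128 of `U` is used up exactly: 8
      -- from this claim, 8 from the bits per chunk and 2 from the geometric sum.
      entropy-bound : ∀ J → J ≤ L → 8 * entropy J ≤ U * μ
      entropy-bound J J≤L = begin
        8 * entropy J ≤⟨ ℕ.*-monoʳ-≤ 8 (ℕ.m≤m+n (entropy J) c) ⟩
        8 * (entropy J + c) ≤⟨ ℕ.*-monoʳ-≤ 8 (geometric entropy (λ i → T i * (8 * 128 ^ i)) c refl (λ J → refl) scale J J≤L) ⟩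
        8 * (c * (2 * 2 ^ J)) ≤⟨ ℕ.*-monoʳ-≤ 8 (ℕ.*-monoʳ-≤ c (ℕ.*-monoʳ-≤ 2 (ℕ.^-monoʳ-≤ 2 J≤L))) ⟩
        8 * (8 * (64 ^ L * μ) * (2 * P)) ≡⟨ lem (64 ^ L) μ P ⟩
        128 * (64 ^ L * P) * μ ≡⟨ cong (λ z → 128 * z * μ) (*-^-distrib L 64 2) ⟨
        U * μ ∎
        where
        c : ℕ
        c = 8 * (64 ^ L * μ)
        lem : ∀ Q μ P → 8 * (8 * (Q * μ) * (2 * P)) ≡ 128 * (Q * P) * μ
        lem = ℕ-ring
        lem₂ : ∀ t h q → t * (8 * (h * q)) ≡ 8 * (t * h) * q
        lem₂ = ℕ-ring
        scale : ∀ i → i ≤ L → T i * (8 * 128 ^ i) ≤ c * 2 ^ i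
        scale i _ = begin
          T i * (8 * 128 ^ i) ≡⟨ cong (λ z → T i * (8 * z)) (*-^-distrib i 64 2) ⟩
          T i * (8 * (64 ^ i * 2 ^ i)) ≡⟨ lem₂ (T i) (64 ^ i) (2 ^ i) ⟩
          8 * (T i * 64 ^ i) * 2 ^ i ≤⟨ ℕ.*-monoˡ-≤ (2 ^ i) (ℕ.*-monoʳ-≤ 8 (T-bound i)) ⟩
          c * 2 ^ i ∎

      private
        A σ : ℕ
        A = μ / 16
        σ = μ ∸ μ / 8

      b≤length : ∀ c χ → ∣ b c χ ∣ ≤ length (proj₂ c)
      b≤length (i , ys) χ = ℕ.≤-trans (∣tq∣≤ (Δ i) {{Δ≢0 i}} (S (signs χ) ys)) (∣S∣≤length (signs χ) (λ j → ℕ.≤-reflexive (∣sign∣ (lookup χ j))) ys)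

      open Weighted b (λ c → κ (proj₁ c)) (λ c → length (proj₂ c)) b≤length (λ c → s≤s z≤n) using (cost)

      cost-bound : 64 ≤ μ → ∀ J → J ≤ L → ∑ᴸ (cost (constraints J)) (allVecs μ) ≤ A * M
      cost-bound 64≤μ J J≤L = ℕ.*-cancelˡ-≤ 4096 (begin
        4096 * ∑ᴸ (cost (constraints J)) (allVecs μ) ≡⟨ cong (4096 *_) (trans (∑ᴸ-swap (λ χ c → κ (proj₁ c) * ∣ b c χ ∣) (allVecs μ) (constraints J)) (∑ᴸ-cong (λ c → ∑ᴸ-*ˡ (κ (proj₁ c)) (λ χ → ∣ b c χ ∣) (allVecs μ)) (constraints J))) ⟩
        4096 * total-deviation (constraints J) ≤⟨ all-deviation J J≤L ⟩
        42 * (M * μ) ≤⟨ ℕ.*-monoʳ-≤ 42 (ℕ.*-monoʳ-≤ M μ≤32A) ⟩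
        42 * (M * (32 * A)) ≡⟨ lem M A ⟩
        -- The mean cost is at most 42 μ / 4096. Rounding in A = μ/16 loses at most a factor 2 once
        -- A is positive, and 42·32 = 1344 still leaves room.
        1344 * (A * M) ≤⟨ ℕ.*-monoˡ-≤ (A * M) (ℕ.m≤m+n 1344 2752) ⟩
        4096 * (A * M) ∎)
        where
        lem : ∀ M A → 42 * (M * (32 * A)) ≡ 1344 * (A * M)
        lem = ℕ-ring
        lem₂ : ∀ A → 16 * A + A * 16 ≡ 32 * A
        lem₂ = ℕ-ring
        1≤A : 1 ≤ A
        1≤A = ℕ.≤-trans (s≤s z≤n) (/-monoˡ-≤ 16 64≤μ)
        μ≤32A : μ ≤ 32 * A
        μ≤32A = begin
          μ ≡⟨ m≡m%n+[m/n]*n μ 16 ⟩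
          μ % 16 + A * 16 ≤⟨ ℕ.+-monoˡ-≤ (A * 16) (ℕ.<⇒≤ (m%n<n μ 16)) ⟩
          16 + A * 16 ≤⟨ ℕ.+-monoˡ-≤ (A * 16) (ℕ.*-monoʳ-≤ 16 1≤A) ⟩
          16 * A + A * 16 ≡⟨ lem₂ A ⟩
          32 * A ∎

      volume-bound : 64 ≤ μ → ∀ J → J ≤ L → 2 ^ A * 5 ^ μ * num (constraints J) < 4 ^ σ * 2 ^ μ * den (constraints J)
      volume-bound 64≤μ J J≤L = volume-inequality U μ A σ (entropy J) (num (constraints J)) (den (constraints J)) {{den≢0 (constraints J)}} 0<Uμ (all-product J J≤L) (entropy-bound J J≤L) 8A≤μ 7μ≤8σ
        where
        den≢0 : ∀ cs → NonZero (den cs)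
        den≢0 []       = _
        den≢0 (c ∷ cs) = ℕ.m*n≢0 (2 ^ κ (proj₁ c)) (den cs) {{ℕ.m^n≢0 2 (κ (proj₁ c))}} {{den≢0 cs}}
        8A≤μ : A * 8 ≤ μ
        8A≤μ = ℕ.≤-trans (ℕ.*-monoʳ-≤ A (ℕ.m≤m+n 8 8)) (m/n*n≤m μ 16)
        7μ≤8σ : 7 * μ ≤ 8 * σ
        7μ≤8σ = begin
          7 * μ ≡⟨ ℕ.m+n∸m≡n μ (7 * μ) ⟨
          8 * μ ∸ μ ≤⟨ ℕ.∸-monoʳ-≤ (8 * μ) (ℕ.≤-trans (ℕ.≤-reflexive (ℕ.*-comm 8 (μ / 8))) (m/n*n≤m μ 8)) ⟩
          8 * μ ∸ 8 * (μ / 8) ≡⟨ ℕ.*-distribˡ-∸ 8 μ (μ / 8) ⟨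
          8 * σ ∎
        0<Uμ : 0 < U * μ
        0<Uμ = ℕ.*-mono-≤ {1} {U} {1} {μ} (ℕ.>-nonZero⁻¹ U {{ℕ.m*n≢0 128 (128 ^ L) {{_}} {{ℕ.m^n≢0 128 L}}}}) (ℕ.≤-trans (s≤s z≤n) 64≤μ)

      ∈-constraints : ∀ J i → i ≤ J → ∀ {ys} → ys ∈ chunksAt i → (i , ys) ∈ constraints J
      ∈-constraints zero    .zero z≤n p = ∈-map⁺ (0 ,_) p
      ∈-constraints (suc J) i i≤J p with ℕ.m≤n⇒m<n∨m≡n i≤J
      ... | inj₁ (s≤s i≤J′) = ∈-++⁺ʳ (at (suc J) (chunksAt (suc J))) (∈-constraints J i i≤J′ p)
      ... | inj₂ refl       = ∈-++⁺ˡ (∈-map⁺ (i ,_) p)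

      PrefixClose : ℕ → Vec Bool μ → Vec Bool μ → Set
      PrefixClose B x y = ∀ xs → xs ∈ Ls → ∀ ℓ → ℓ ≤ length xs → ∣ S (λ i → signs x i -ᶻ signs y i) (take ℓ xs) ∣ ≤ B

      -- Only scales up to `J` occur, since `short` keeps every list below the length of a chunk of
      -- scale J + 1. The constant 2·1008 is 63·2·8·2: digits in base 64, the loss in `tq-close`,
      -- the constant of `Δ`, and the geometric sum over scales.
      agree⇒close : ∀ J → J ≤ L → μ * K < 64 ^ suc J → ∀ x y → All (λ c → b c x ≡ b c y) (constraints J) → PrefixClose (2 * (s * 1008 * (P * P) * 2 ^ J)) x y
      agree⇒close J J≤L short x y eqs xs xs∈ ℓ ℓ≤ = ℕ.≤-trans
          (prefix-bound (suc J) (ℕ.≤-<-trans (length≤ K xs (occ≤K xs xs∈)) short) close ℓ ℓ≤)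
          (ℕ.≤-trans (ℕ.*-monoʳ-≤ 63 (ℕ.≤-trans (ℕ.m≤m+n (∑D (suc J)) c) (ℕ.≤-reflexive (∑D≡ (suc J))))) (ℕ.≤-reflexive (lem s (P * P) (2 ^ J))))
        where
        d : Fin μ → ℤ
        d i = signs x i -ᶻ signs y i
        open Multiscale (λ ℓ → S d (take ℓ xs)) refl (λ i → 2 * Δ i) (length xs)
        c : ℕ
        c = 2 * (8 * s * (P * P))
        lem : ∀ s Q q → 63 * (2 * (8 * s * Q) * (2 * q)) ≡ 2 * (s * 1008 * Q * q)
        lem = ℕ-ring
        ∑D≡ : ∀ j → ∑D j + c ≡ c * 2 ^ j
        ∑D≡ zero    = sym (ℕ.*-identityʳ c)
        ∑D≡ (suc j) = trans (lem₁ (∑D j) (8 * s * (P * P)) (2 ^ j) ) (trans (cong (_+ c * 2 ^ j) (∑D≡ j)) (lem₂ c (2 ^ j)))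
          where
          lem₁ : ∀ a e q → a + 2 * (e * q) + 2 * e ≡ a + 2 * e + 2 * e * q
          lem₁ = ℕ-ring
          lem₂ : ∀ c q → c * q + c * q ≡ c * (2 * q)
          lem₂ = ℕ-ring
        close : ∀ i → i < suc J → ∀ k → suc k * 64 ^ i ≤ length xs → ∣ S d (take (suc k * 64 ^ i) xs) -ᶻ S d (take (k * 64 ^ i) xs) ∣ ≤ 2 * Δ i
        close i (s≤s i≤J) k le = subst (λ z → ∣ z ∣ ≤ 2 * Δ i) (sym increment)
          (tq-close (Δ i) {{Δ≢0 i}} (S (signs x) (chunk i xs k)) (S (signs y) (chunk i xs k))
            (All.lookup eqs (∈-constraints J i i≤J (∈-concat⁺′ (∈-chunks i xs k le) (∈-map⁺ (chunks i) xs∈)))))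
          where
          cancel : ∀ a b → a +ᶻ b -ᶻ a ≡ b
          cancel = ℤ-ring
          increment : S d (take (suc k * 64 ^ i) xs) -ᶻ S d (take (k * 64 ^ i) xs) ≡ S (signs x) (chunk i xs k) -ᶻ S (signs y) (chunk i xs k)
          increment = trans (cong (_-ᶻ S d (take (k * 64 ^ i) xs)) (trans (cong (λ z → S d (take z xs)) (ℕ.+-comm (64 ^ i) (k * 64 ^ i))) (S-take-+ d (k * 64 ^ i) (64 ^ i) xs)))
            (trans (cancel (S d (take (k * 64 ^ i) xs)) (S d (chunk i xs k))) (S-- (signs x) (signs y) (chunk i xs k)))

      partial-colouring : 64 ≤ μ → ∀ J → J ≤ L → μ * K < 64 ^ suc J →
        ∃ λ x → ∃ λ y → (8 * agreements x y ≤ 7 * μ) × PrefixClose (2 * (s * 1008 * (P * P) * 2 ^ J)) x y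
      partial-colouring 64≤μ J J≤L short = conclude (distant-pair b (λ c → κ (proj₁ c)) (λ c → length (proj₂ c)) b≤length (λ c → s≤s z≤n) σ A (constraints J) (cost-bound 64≤μ J J≤L) (volume-bound 64≤μ J J≤L))
        where
        -- The strict inequality `a < σ` absorbs the remainder of μ modulo 8.
        few : ∀ a → a < σ → 8 * a ≤ 7 * μ
        few a far = ℕ.+-cancelʳ-≤ μ _ _ (begin
          8 * a + μ ≡⟨ cong (λ z → 8 * a + z) (m≡m%n+[m/n]*n μ 8) ⟩
          8 * a + (μ % 8 + μ / 8 * 8) ≤⟨ ℕ.+-monoʳ-≤ (8 * a) (ℕ.+-monoˡ-≤ (μ / 8 * 8) (ℕ.<⇒≤ (m%n<n μ 8))) ⟩
          8 * a + (8 + μ / 8 * 8) ≡⟨ lem (a) (μ / 8) ⟩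
          8 * (suc (a) + μ / 8) ≤⟨ ℕ.*-monoʳ-≤ 8 (ℕ.≤-trans (ℕ.+-monoˡ-≤ (μ / 8) far) (ℕ.≤-reflexive (ℕ.m∸n+n≡m (Data.Nat.DivMod.m/n≤m μ 8)))) ⟩
          8 * μ ≡⟨ lem₂ μ ⟩
          7 * μ + μ ∎)
          where
          lem : ∀ a q → 8 * a + (8 + q * 8) ≡ 8 * (suc a + q)
          lem = ℕ-ring
          lem₂ : ∀ m → 8 * m ≡ 7 * m + m
          lem₂ = ℕ-ring
        conclude : (∃ λ x → ∃ λ y → (agreements x y < σ) × All (λ c → b c x ≡ b c y) (constraints J)) →
          ∃ λ x → ∃ λ y → (8 * agreements x y ≤ 7 * μ) × PrefixClose (2 * (s * 1008 * (P * P) * 2 ^ J)) x y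
        conclude (x , y , far , eqs) = x , y , few (agreements x y) far , agree⇒close J J≤L short x y eqs

-- Iterating partial colourings to a full colouring.

module Balance where

  open Pigeon
  open Moments
  open Step

  open ℕ.≤-Reasoning

  -- Points where the two colourings agree have half-difference 0 and stay uncoloured; they are
  -- renumbered as the variables of the next round. `nothing` marks a point that is settled now.
  relabel : ∀ {n} (x y : Vec Bool n) → Fin n → Maybe (Fin (agreements x y))
  relabel (true  ∷ x) (true  ∷ y) zero    = just zero
  relabel (true  ∷ x) (true  ∷ y) (suc i) = Maybe.map suc (relabel x y i)
  relabel (false ∷ x) (false ∷ y) zero    = just zero
  relabel (false ∷ x) (false ∷ y) (suc i) = Maybe.map suc (relabel x y i)
  relabel (true  ∷ x) (false ∷ y) zero    = nothing
  relabel (true  ∷ x) (false ∷ y) (suc i) = relabel x y i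
  relabel (false ∷ x) (true  ∷ y) zero    = nothing
  relabel (false ∷ x) (true  ∷ y) (suc i) = relabel x y i

  unlabel : ∀ {n} (x y : Vec Bool n) → Fin (agreements x y) → Fin n
  unlabel []          []          ()
  unlabel (true  ∷ x) (true  ∷ y) zero    = zero
  unlabel (true  ∷ x) (true  ∷ y) (suc j) = suc (unlabel x y j)
  unlabel (false ∷ x) (false ∷ y) zero    = zero
  unlabel (false ∷ x) (false ∷ y) (suc j) = suc (unlabel x y j)
  unlabel (true  ∷ x) (false ∷ y) j       = suc (unlabel x y j)
  unlabel (false ∷ x) (true  ∷ y) j       = suc (unlabel x y j)

  merge : ∀ {n} (x y : Vec Bool n) → Vec Bool (agreements x y) → Vec Bool n
  merge []          []          c       = []
  merge (true  ∷ x) (true  ∷ y) (a ∷ c) = a ∷ merge x y c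
  merge (false ∷ x) (false ∷ y) (a ∷ c) = a ∷ merge x y c
  merge (true  ∷ x) (false ∷ y) c       = true  ∷ merge x y c
  merge (false ∷ x) (true  ∷ y) c       = false ∷ merge x y c

  signsᴹ : ∀ {n} → Vec Bool n → Maybe (Fin n) → ℤ
  signsᴹ c nothing  = 0ℤ
  signsᴹ c (just j) = signs c j

  -- Doubling avoids the division: on a disagreement the difference of signs is twice the sign of
  -- `x`, and on an agreement it is 0 and the next round decides.
  merge-signs : ∀ {n} (x y : Vec Bool n) c i → + 2 *ᶻ signs (merge x y c) i ≡ (signs x i -ᶻ signs y i) +ᶻ + 2 *ᶻ signsᴹ c (relabel x y i)
  merge-signs (true  ∷ x) (true  ∷ y) (a ∷ c) zero    = sym (ℤ.+-identityˡ _)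
  merge-signs (false ∷ x) (false ∷ y) (a ∷ c) zero    = sym (ℤ.+-identityˡ _)
  merge-signs (true  ∷ x) (false ∷ y) c       zero    = refl
  merge-signs (false ∷ x) (true  ∷ y) c       zero    = refl
  merge-signs (true  ∷ x) (false ∷ y) c       (suc i) = merge-signs x y c i
  merge-signs (false ∷ x) (true  ∷ y) c       (suc i) = merge-signs x y c i
  merge-signs (true  ∷ x) (true  ∷ y) (a ∷ c) (suc i) with relabel x y i | merge-signs x y c i
  ... | nothing | eq = eq
  ... | just j  | eq = eq
  merge-signs (false ∷ x) (false ∷ y) (a ∷ c) (suc i) with relabel x y i | merge-signs x y c i
  ... | nothing | eq = eq
  ... | just j  | eq = eq

  -- Injectivity as an inequality between Kronecker deltas, the form that sums directly to
  -- `occ-restrict`.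
  relabel-injective : ∀ {n} (x y : Vec Bool n) j i j′ → relabel x y i ≡ just j′ → δ j j′ ≤ δ (unlabel x y j) i
  relabel-injective (true  ∷ x) (true  ∷ y) zero    zero    .zero refl = ℕ.≤-refl
  relabel-injective (true  ∷ x) (true  ∷ y) (suc j) zero    .zero refl = z≤n
  relabel-injective (false ∷ x) (false ∷ y) zero    zero    .zero refl = ℕ.≤-refl
  relabel-injective (false ∷ x) (false ∷ y) (suc j) zero    .zero refl = z≤n
  relabel-injective (true  ∷ x) (false ∷ y) j       (suc i) j′    eq   = relabel-injective x y j i j′ eq
  relabel-injective (false ∷ x) (true  ∷ y) j       (suc i) j′    eq   = relabel-injective x y j i j′ eq
  relabel-injective (true  ∷ x) (true  ∷ y) j       (suc i) j′    eq with relabel x y i in e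
  relabel-injective (true  ∷ x) (true  ∷ y) zero    (suc i) .(suc k) refl | just k = z≤n
  relabel-injective (true  ∷ x) (true  ∷ y) (suc j) (suc i) .(suc k) refl | just k = relabel-injective x y j i k e
  relabel-injective (false ∷ x) (false ∷ y) j       (suc i) j′    eq with relabel x y i in e
  relabel-injective (false ∷ x) (false ∷ y) zero    (suc i) .(suc k) refl | just k = z≤n
  relabel-injective (false ∷ x) (false ∷ y) (suc j) (suc i) .(suc k) refl | just k = relabel-injective x y j i k e

  module _ {n : ℕ} (x y : Vec Bool n) where

    restrict : List (Literal n) → List (Literal (agreements x y))
    restrict []             = []
    restrict ((i , s) ∷ xs) with relabel x y i
    ... | nothing = restrict xs
    ... | just j  = (j , s) ∷ restrict xs

    restrict-++ : ∀ xs ys → restrict (xs ++ ys) ≡ restrict xs ++ restrict ys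
    restrict-++ []             ys = refl
    restrict-++ ((i , s) ∷ xs) ys with relabel x y i
    ... | nothing = restrict-++ xs ys
    ... | just j  = cong ((j , s) ∷_) (restrict-++ xs ys)

    occ-restrict : ∀ j xs → occ j (restrict xs) ≤ occ (unlabel x y j) xs
    occ-restrict j []             = z≤n
    occ-restrict j ((i , s) ∷ xs) with relabel x y i in eq
    ... | nothing = ℕ.≤-trans (occ-restrict j xs) (ℕ.m≤n+m _ _)
    ... | just j′ = ℕ.+-mono-≤ (relabel-injective x y j i j′ eq) (occ-restrict j xs)

    S-merge : ∀ c xs → + 2 *ᶻ S (signs (merge x y c)) xs ≡ S (λ i → signs x i -ᶻ signs y i) xs +ᶻ + 2 *ᶻ S (signs c) (restrict xs)
    S-merge c []             = refl
    S-merge c ((i , s) ∷ xs) with relabel x y i | merge-signs x y c i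
    ... | nothing | eq = step₀ (sign s) (signs (merge x y c) i) (S (signs (merge x y c)) xs) (signs x i -ᶻ signs y i) _ _ eq (S-merge c xs)
      where
      step₀ : ∀ s m M d D R → + 2 *ᶻ m ≡ d +ᶻ + 2 *ᶻ 0ℤ → + 2 *ᶻ M ≡ D +ᶻ + 2 *ᶻ R → + 2 *ᶻ (s *ᶻ m +ᶻ M) ≡ s *ᶻ d +ᶻ D +ᶻ + 2 *ᶻ R
      step₀ s m M d D R p q = trans (lem₁ s m M) (trans (cong₂ (λ a b → s *ᶻ a +ᶻ b) p q) (lem₂ s d D R))
        where
        lem₁ : ∀ s m M → + 2 *ᶻ (s *ᶻ m +ᶻ M) ≡ s *ᶻ (+ 2 *ᶻ m) +ᶻ + 2 *ᶻ M
        lem₁ = ℤ-ring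
        lem₂ : ∀ s d D R → s *ᶻ (d +ᶻ + 2 *ᶻ 0ℤ) +ᶻ (D +ᶻ + 2 *ᶻ R) ≡ s *ᶻ d +ᶻ D +ᶻ + 2 *ᶻ R
        lem₂ = ℤ-ring
    ... | just j  | eq = step₁ (sign s) (signs (merge x y c) i) (S (signs (merge x y c)) xs) (signs x i -ᶻ signs y i) _ (signs c j) _ eq (S-merge c xs)
      where
      step₁ : ∀ s m M d D r R → + 2 *ᶻ m ≡ d +ᶻ + 2 *ᶻ r → + 2 *ᶻ M ≡ D +ᶻ + 2 *ᶻ R → + 2 *ᶻ (s *ᶻ m +ᶻ M) ≡ s *ᶻ d +ᶻ D +ᶻ + 2 *ᶻ (s *ᶻ r +ᶻ R)
      step₁ s m M d D r R p q = trans (lem₁ s m M) (trans (cong₂ (λ a b → s *ᶻ a +ᶻ b) p q) (lem₂ s d D r R))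
        where
        lem₁ : ∀ s m M → + 2 *ᶻ (s *ᶻ m +ᶻ M) ≡ s *ᶻ (+ 2 *ᶻ m) +ᶻ + 2 *ᶻ M
        lem₁ = ℤ-ring
        lem₂ : ∀ s d D r R → s *ᶻ (d +ᶻ + 2 *ᶻ r) +ᶻ (D +ᶻ + 2 *ᶻ R) ≡ s *ᶻ d +ᶻ D +ᶻ + 2 *ᶻ (s *ᶻ r +ᶻ R)
        lem₂ = ℤ-ring

  Balanced : ∀ {μ} → ℕ → List (List (Literal μ)) → Set
  Balanced {μ} B Ls = Σ (Vec Bool μ) λ χ → ∀ xs → xs ∈ Ls → ∀ ys zs → xs ≡ ys ++ zs → ∣ S (signs χ) ys ∣ ≤ B

  module Iterate (N K s L : ℕ) {{K≢0 : NonZero K}} {{s≢0 : NonZero s}} (NK≤ : N * K ≤ 64 ^ L) (K≤ : K ≤ s * s) where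

    open Scales N K s L NK≤ K≤ using (P; module Family)

    -- Since 64 · 7^32 ≤ 8^32, thirty-two partial colourings shrink the problem by one scale, which halves the tolerance.
    bound : ℕ → ℕ → ℕ
    bound J a = K * 64 + s * 1008 * (P * P) * 2 ^ J * (32 + a)

    -- (8/7)^32 is about 72, far below 64^2. This keeps the lists shorter than a chunk of scale J +
    -- 1 throughout the 32 rounds.
    8^a< : ∀ a → a ≤ 32 → 8 ^ a < 64 * 64 * 7 ^ a
    8^a< a a≤ = ℕ.*-cancelʳ-< (7 ^ (32 ∸ a)) (8 ^ a) (64 * 64 * 7 ^ a) (begin-strict
      8 ^ a * 7 ^ (32 ∸ a) ≤⟨ ℕ.*-monoʳ-≤ (8 ^ a) (ℕ.^-monoˡ-≤ (32 ∸ a) (ℕ.n≤1+n 7)) ⟩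
      8 ^ a * 8 ^ (32 ∸ a) ≡⟨ ℕ.^-distribˡ-+-* 8 a (32 ∸ a) ⟨
      8 ^ (a + (32 ∸ a)) ≡⟨ cong (8 ^_) (ℕ.m+[n∸m]≡n a≤) ⟩
      8 ^ 32 <⟨ ℕ.<ᵇ⇒< (8 ^ 32) (64 * 64 * 7 ^ 32) _ ⟩
      64 * 64 * 7 ^ 32 ≡⟨ cong (λ z → 64 * 64 * 7 ^ z) (ℕ.m+[n∸m]≡n a≤) ⟨
      64 * 64 * 7 ^ (a + (32 ∸ a)) ≡⟨ cong (64 * 64 *_) (ℕ.^-distribˡ-+-* 7 a (32 ∸ a)) ⟩
      64 * 64 * (7 ^ a * 7 ^ (32 ∸ a)) ≡⟨ ℕ.*-assoc (64 * 64) (7 ^ a) (7 ^ (32 ∸ a)) ⟨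
      64 * 64 * 7 ^ a * 7 ^ (32 ∸ a) ∎)

    64*7^32≤8^32 : 64 * 7 ^ 32 ≤ 8 ^ 32
    64*7^32≤8^32 = ℕ.≤ᵇ⇒≤ (64 * 7 ^ 32) (8 ^ 32) _

    balance-few : ∀ J a μ → μ ≤ 64 → (Ls : List (List (Literal μ))) → (∀ xs → xs ∈ Ls → ∀ v → occ v xs ≤ K) → Balanced (bound J a) Ls
    balance-few J a μ μ≤64 Ls occ≤K = replicate μ true , λ { xs xs∈ ys zs refl → begin
      ∣ S (signs (replicate μ true)) ys ∣ ≤⟨ ∣S∣≤length (signs (replicate μ true)) (λ i → ℕ.≤-reflexive (∣sign∣ (lookup (replicate μ true) i))) ys ⟩
      length ys ≤⟨ ℕ.≤-trans (ℕ.m≤m+n (length ys) (length zs)) (ℕ.≤-reflexive (sym (List.length-++ ys))) ⟩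
      length (ys ++ zs) ≤⟨ length≤ K (ys ++ zs) (occ≤K (ys ++ zs) xs∈) ⟩
      μ * K ≡⟨ ℕ.*-comm μ K ⟩
      K * μ ≤⟨ ℕ.*-monoʳ-≤ K μ≤64 ⟩
      K * 64 ≤⟨ ℕ.m≤m+n (K * 64) _ ⟩
      bound J a ∎ }

    -- The size hypothesis says 64 μ K ≤ 64^J (8/7)^a. A partial colouring reduces μ to 7/8 and `a`
    -- by one; at a = 0 the pair (J, 0) is exchanged for (J - 1, 32) without changing the bound. The
    -- 32 added to `a` in `bound` is the reserve for all smaller scales, because 32 (1 + 2 + ... +
    -- 2^(J-1)) ≤ 32·2^J.
    balance : ∀ J a μ → J ≤ L → a ≤ 32 → μ * K * (64 * 7 ^ a) ≤ 64 ^ J * 8 ^ a →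
      (Ls : List (List (Literal μ))) → length Ls ≤ N → (∀ xs → xs ∈ Ls → ∀ v → occ v xs ≤ K) → Balanced (bound J a) Ls
    balance zero zero μ J≤L a≤32 small Ls len≤N occ≤K = balance-few 0 0 μ (ℕ.≤-trans (ℕ.m≤m*n μ K) (ℕ.≤-trans (ℕ.m≤m*n (μ * K) 64) (ℕ.≤-trans small (s≤s z≤n)))) Ls occ≤K
    balance (suc J) zero μ J<L a≤32 small Ls len≤N occ≤K =
      subst (λ B → Balanced B Ls) (cong (λ z → K * 64 + z) (lem₁ (s * 1008 * (P * P)) (2 ^ J)))
        (balance J 32 μ (ℕ.<⇒≤ J<L) ℕ.≤-refl small′ Ls len≤N occ≤K)
      where
      lem₁ : ∀ c q → c * q * 64 ≡ c * (2 * q) * 32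
      lem₁ = ℕ-ring
      lem₂ : ∀ a → 64 * a * 1 ≡ a * 64
      lem₂ = ℕ-ring
      small′ : μ * K * (64 * 7 ^ 32) ≤ 64 ^ J * 8 ^ 32
      small′ = ℕ.*-mono-≤ (ℕ.*-cancelʳ-≤ (μ * K) (64 ^ J) 64 (ℕ.≤-trans small (ℕ.≤-reflexive (lem₂ (64 ^ J))))) 64*7^32≤8^32
    balance J (suc a) μ J≤L a<32 small Ls len≤N occ≤K = decide (64 ≤? μ)
      where
      lem : ∀ x y w → x * y * (64 * w) ≡ x * y * 64 * w
      lem = ℕ-ring
      lem₂ : ∀ j w → j * (64 * 64 * w) ≡ 64 * j * 64 * w
      lem₂ = ℕ-ring
      short : μ * K < 64 ^ suc J
      short = ℕ.*-cancelʳ-< 64 (μ * K) (64 * 64 ^ J) (ℕ.*-cancelʳ-< (7 ^ suc a) (μ * K * 64) (64 * 64 ^ J * 64) (begin-strict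
        μ * K * 64 * 7 ^ suc a ≡⟨ lem μ K (7 ^ suc a) ⟨
        μ * K * (64 * 7 ^ suc a) ≤⟨ small ⟩
        64 ^ J * 8 ^ suc a <⟨ ℕ.*-monoʳ-< (64 ^ J) {{ℕ.m^n≢0 64 J}} (8^a< (suc a) a<32) ⟩
        64 ^ J * (64 * 64 * 7 ^ suc a) ≡⟨ lem₂ (64 ^ J) (7 ^ suc a) ⟩
        64 * 64 ^ J * 64 * 7 ^ suc a ∎))
      extend-by : (∃ λ x → ∃ λ y → (8 * agreements x y ≤ 7 * μ) × Family.PrefixClose Ls len≤N occ≤K (2 * (s * 1008 * (P * P) * 2 ^ J)) x y) → Balanced (bound J (suc a)) Ls
      extend-by (x , y , few , close) = merged (balance J a (agreements x y) J≤L (ℕ.<⇒≤ a<32) small′ (map (restrict x y) Ls) (ℕ.≤-trans (ℕ.≤-reflexive (List.length-map (restrict x y) Ls)) len≤N) occ′)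
        where
        lem₁ : ∀ m K w → 8 * (m * K * (64 * w)) ≡ 8 * m * (K * (64 * w))
        lem₁ = ℕ-ring
        lem₃ : ∀ m K w → 7 * m * (K * (64 * w)) ≡ m * K * (64 * (7 * w))
        lem₃ = ℕ-ring
        lem₄ : ∀ j w → j * (8 * w) ≡ 8 * (j * w)
        lem₄ = ℕ-ring
        small′ : agreements x y * K * (64 * 7 ^ a) ≤ 64 ^ J * 8 ^ a
        small′ = ℕ.*-cancelˡ-≤ 8 (begin
          8 * (agreements x y * K * (64 * 7 ^ a)) ≡⟨ lem₁ (agreements x y) K (7 ^ a) ⟩
          8 * agreements x y * (K * (64 * 7 ^ a)) ≤⟨ ℕ.*-monoˡ-≤ (K * (64 * 7 ^ a)) few ⟩
          7 * μ * (K * (64 * 7 ^ a)) ≡⟨ lem₃ μ K (7 ^ a) ⟩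
          μ * K * (64 * (7 * 7 ^ a)) ≤⟨ small ⟩
          64 ^ J * (8 * 8 ^ a) ≡⟨ lem₄ (64 ^ J) (8 ^ a) ⟩
          8 * (64 ^ J * 8 ^ a) ∎)
        occ′ : ∀ xs → xs ∈ map (restrict x y) Ls → ∀ v → occ v xs ≤ K
        occ′ xs xs∈ v with ∈-map⁻ (restrict x y) xs∈
        ... | xs₀ , xs₀∈ , refl = ℕ.≤-trans (occ-restrict x y v xs₀) (occ≤K xs₀ xs₀∈ (unlabel x y v))
        d : Fin μ → ℤ
        d i = signs x i -ᶻ signs y i
        prefix-close : ∀ ys zs → (ys ++ zs) ∈ Ls → ∣ S d ys ∣ ≤ 2 * (s * 1008 * (P * P) * 2 ^ J)
        prefix-close ys zs p = subst (λ z → ∣ S d z ∣ ≤ 2 * (s * 1008 * (P * P) * 2 ^ J)) (take-all ys)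
          (close (ys ++ zs) p (length ys) (ℕ.≤-trans (ℕ.m≤m+n (length ys) (length zs)) (ℕ.≤-reflexive (sym (List.length-++ ys)))))
          where
          take-all : ∀ (ys : List (Literal μ)) → take (length ys) (ys ++ zs) ≡ ys
          take-all []       = refl
          take-all (l ∷ ys) = cong (l ∷_) (take-all ys)
        lem₅ : ∀ k c a → 2 * c + 2 * (k + c * (32 + a)) ≡ 2 * (k + c * (32 + suc a))
        lem₅ = ℕ-ring
        merged : Balanced (bound J a) (map (restrict x y) Ls) → Balanced (bound J (suc a)) Ls
        merged (c , good) = merge x y c , λ { xs xs∈ ys zs refl → ℕ.*-cancelˡ-≤ 2 (begin
          2 * ∣ S (signs (merge x y c)) ys ∣ ≡⟨ ℤ.abs-* (+ 2) (S (signs (merge x y c)) ys) ⟨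
          ∣ + 2 *ᶻ S (signs (merge x y c)) ys ∣ ≡⟨ cong ∣_∣ (S-merge x y c ys) ⟩
          ∣ S d ys +ᶻ + 2 *ᶻ S (signs c) (restrict x y ys) ∣ ≤⟨ ℤ.∣i+j∣≤∣i∣+∣j∣ (S d ys) (+ 2 *ᶻ S (signs c) (restrict x y ys)) ⟩
          ∣ S d ys ∣ + ∣ + 2 *ᶻ S (signs c) (restrict x y ys) ∣ ≡⟨ cong (λ z → ∣ S d ys ∣ + z) (ℤ.abs-* (+ 2) (S (signs c) (restrict x y ys))) ⟩
          ∣ S d ys ∣ + 2 * ∣ S (signs c) (restrict x y ys) ∣ ≤⟨ ℕ.+-mono-≤ (prefix-close ys zs xs∈) (ℕ.*-monoʳ-≤ 2 (good (restrict x y (ys ++ zs)) (∈-map⁺ (restrict x y) xs∈) (restrict x y ys) (restrict x y zs) (restrict-++ x y ys zs))) ⟩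
          2 * (s * 1008 * (P * P) * 2 ^ J) + 2 * bound J a ≡⟨ lem₅ (K * 64) (s * 1008 * (P * P) * 2 ^ J) a ⟩
          2 * bound J (suc a) ∎) }
      decide : Dec (64 ≤ μ) → Balanced (bound J (suc a)) Ls
      decide (yes 64≤μ) = extend-by (Family.partial-colouring Ls len≤N occ≤K 64≤μ J J≤L short)
      decide (no  μ<64) = balance-few J (suc a) μ (ℕ.<⇒≤ (ℕ.≰⇒> μ<64)) Ls occ≤K

    -- The constant is 64 + 1008·64. The trivial part 64 K joins the main term because K^2 ≤ s^2·(N
    -- K) ≤ s^2·64^L, so K ≤ s P^3.
    exists-balanced : 0 < N → ∀ μ → μ ≤ N → (Ls : List (List (Literal μ))) → length Ls ≤ N → (∀ xs → xs ∈ Ls → ∀ v → occ v xs ≤ K) →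
      Balanced (s * (P * P * P) * 64576) Ls
    exists-balanced 0<N μ μ≤N Ls len≤N occ≤K = weaken (balance L 32 μ ℕ.≤-refl ℕ.≤-refl
        (ℕ.*-mono-≤ (ℕ.≤-trans (ℕ.*-monoˡ-≤ K μ≤N) NK≤) 64*7^32≤8^32) Ls len≤N occ≤K)
      where
      X : ℕ
      X = s * (P * P * P)
      lem₁ : ∀ s P → s * s * (P * P * P * (P * P * P)) ≡ s * (P * P * P) * (s * (P * P * P))
      lem₁ = ℕ-ring
      lem₂ : ∀ s P → s * (P * P * P) * 64 + s * 1008 * (P * P) * P * 64 ≡ s * (P * P * P) * 64576
      lem₂ = ℕ-ring
      K≤X : K ≤ X
      K≤X = ℕ.≮⇒≥ λ X<K → ℕ.<⇒≱ (ℕ.*-mono-< X<K X<K) (begin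
        K * K ≤⟨ ℕ.*-mono-≤ K≤ (ℕ.≤-trans (ℕ.m≤n*m K N {{ℕ.>-nonZero 0<N}}) NK≤) ⟩
        s * s * 64 ^ L ≡⟨ trans (cong (s * s *_) (64^≡ L)) (lem₁ s P) ⟩
        X * X ∎)
      bound≤ : bound L 32 ≤ X * 64576
      bound≤ = ℕ.≤-trans (ℕ.+-monoˡ-≤ (s * 1008 * (P * P) * P * 64) (ℕ.*-monoˡ-≤ 64 K≤X)) (ℕ.≤-reflexive (lem₂ s P))
      weaken : Balanced (bound L 32) Ls → Balanced (X * 64576) Ls
      weaken (χ , h) = χ , λ xs p ys zs eq → ℕ.≤-trans (h xs p ys zs eq) bound≤

-- Signed identifications with small coset sums, and their products over coprime moduli.

module Folding where

  open Sums
  open Moments using (δ)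

  open ≡-Reasoning

  δ-refl : ∀ {n} (i : Fin n) → δ i i ≡ 1
  δ-refl zero    = refl
  δ-refl (suc i) = δ-refl i

  δ-≢ : ∀ {n} (i j : Fin n) → i ≢ j → δ i j ≡ 0
  δ-≢ zero    zero    h = ⊥-elim (h refl)
  δ-≢ zero    (suc j) h = refl
  δ-≢ (suc i) zero    h = refl
  δ-≢ (suc i) (suc j) h = δ-≢ i j (λ eq → h (cong suc eq))

  δ-combine : ∀ {m n} (i i′ : Fin m) (j j′ : Fin n) → δ (combine i j) (combine i′ j′) ≡ δ i i′ * δ j j′
  δ-combine i i′ j j′ with i Fin.≟ i′ | j Fin.≟ j′
  ... | yes refl | yes refl = trans (δ-refl (combine i j)) (sym (cong₂ _*_ (δ-refl i) (δ-refl j)))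
  ... | no  ≢    | _        = trans (δ-≢ _ _ (λ eq → ≢ (Fin.combine-injectiveˡ i j i′ j′ eq))) (cong (_* δ j j′) (sym (δ-≢ i i′ ≢)))
  ... | yes refl | no ≢     = trans (δ-≢ _ _ (λ eq → ≢ (Fin.combine-injectiveʳ i j i′ j′ eq))) (sym (trans (cong (δ i i′ *_) (δ-≢ j j′ ≢)) (ℕ.*-zeroʳ (δ i i′))))

  infixl 7 _⊙_
  _⊙_ : Bool → Bool → Bool
  true  ⊙ b     = b
  false ⊙ true  = false
  false ⊙ false = true

  sign-⊙ : ∀ a b → sign (a ⊙ b) ≡ sign a *ᶻ sign b
  sign-⊙ true  true  = refl
  sign-⊙ true  false = refl
  sign-⊙ false true  = refl
  sign-⊙ false false = refl

  -- The Chinese remainder theorem for cosets. At position l a + i the part with l is invisible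
  -- modulo P, and modulo r it is a step `f * P`, which generates the same subgroup as `f`.
  -- Afterwards the step `e₁ * f` modulo P is exchanged for `e₁` in the same way. Separate arguments
  -- of Φ allow each period to be used alone.
  ∑-two-periods : ∀ P r e₁ f a b → P ≡ a * e₁ → r ≡ b * f → Coprime P r → .{{_ : NonZero a}} .{{_ : NonZero b}} →
    (Φ : ℕ → ℕ → ℤ) → (∀ w → Periodic P (λ u → Φ u w)) → (∀ u → Periodic r (Φ u)) →
    ∀ c → ∑ (a * b) (λ j → Φ (c + j * (e₁ * f)) (c + j * (e₁ * f))) ≡ ∑ a (λ i → ∑ b (λ l → Φ (c + i * e₁) (c + l * f)))
  ∑-two-periods P r e₁ f a b P≡ r≡ cop Φ p₁ p₂ c = begin
    ∑ (a * b) (λ j → Φ (c + j * e) (c + j * e)) ≡⟨ cong (λ z → ∑ z (λ j → Φ (c + j * e) (c + j * e))) (ℕ.*-comm a b) ⟩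
    ∑ (b * a) (λ j → Φ (c + j * e) (c + j * e)) ≡⟨ ∑-blocks b a (λ j → Φ (c + j * e) (c + j * e)) ⟩
    ∑ b (λ l → ∑ a (λ i → Φ (c + (l * a + i) * e) (c + (l * a + i) * e))) ≡⟨ ∑-swap b a (λ l i → Φ (c + (l * a + i) * e) (c + (l * a + i) * e)) ⟩
    ∑ a (λ i → ∑ b (λ l → Φ (c + (l * a + i) * e) (c + (l * a + i) * e))) ≡⟨ ∑-cong a (λ i → ∑-cong b (λ l → trans (cong₂ Φ (pos₁ i l) (pos₂ i l)) (periodic-* (p₁ (c + i * e + l * (f * P))) (l * f) (c + i * e)))) ⟩
    ∑ a (λ i → ∑ b (λ l → Φ (c + i * e) (c + i * e + l * (f * P)))) ≡⟨ ∑-cong a (λ i → cycle-sum b f (f * P) gcd₂ (Φ (c + i * e)) (p₂′ (c + i * e)) (c + i * e)) ⟩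
    ∑ a (λ i → ∑ b (λ l → Φ (c + i * e) (c + i * e + l * f))) ≡⟨ ∑-cong a (λ i → trans (∑-cong b (λ l → cong (λ z → Φ (c + i * e) (c + z + l * f)) (sym (ℕ.*-assoc i e₁ f)))) (periodic-* (∑-step-periodic b f (Φ (c + i * e)) (p₂′ (c + i * e))) (i * e₁) c)) ⟩
    ∑ a (λ i → ∑ b (λ l → Φ (c + i * e) (c + l * f))) ≡⟨ ∑-swap a b (λ i l → Φ (c + i * e) (c + l * f)) ⟩
    ∑ b (λ l → ∑ a (λ i → Φ (c + i * e) (c + l * f))) ≡⟨ ∑-cong b (λ l → cycle-sum a e₁ e gcd₁ (λ u → Φ u (c + l * f)) (subst (λ z → Periodic z (λ u → Φ u (c + l * f))) P≡ (p₁ (c + l * f))) c) ⟩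
    ∑ b (λ l → ∑ a (λ i → Φ (c + i * e₁) (c + l * f))) ≡⟨ ∑-swap b a (λ l i → Φ (c + i * e₁) (c + l * f)) ⟩
    ∑ a (λ i → ∑ b (λ l → Φ (c + i * e₁) (c + l * f))) ∎
    where
    e : ℕ
    e = e₁ * f
    p₂′ : ∀ u → Periodic (b * f) (Φ u)
    p₂′ u = subst (λ z → Periodic z (Φ u)) r≡ (p₂ u)
    lem₁ : ∀ c l a i e₁ f → c + (l * a + i) * (e₁ * f) ≡ c + i * (e₁ * f) + l * f * (a * e₁)
    lem₁ = ℕ-ring
    lem₂ : ∀ c l a i e₁ f → c + (l * a + i) * (e₁ * f) ≡ c + i * (e₁ * f) + l * (f * (a * e₁))
    lem₂ = ℕ-ring
    pos₁ : ∀ i l → c + (l * a + i) * e ≡ c + i * e + l * f * P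
    pos₁ i l = trans (lem₁ c l a i e₁ f) (cong (λ z → c + i * e + l * f * z) (sym P≡))
    pos₂ : ∀ i l → c + (l * a + i) * e ≡ c + i * e + l * (f * P)
    pos₂ i l = trans (lem₂ c l a i e₁ f) (cong (λ z → c + i * e + l * (f * z)) (sym P≡))
    b∣r : b ∣ r
    b∣r = divides f (trans r≡ (ℕ.*-comm b f))
    a∣P : a ∣ P
    a∣P = divides e₁ (trans P≡ (ℕ.*-comm a e₁))
    f∣r : f ∣ r
    f∣r = divides b r≡
    gcd-coprime : ∀ {x y} → (∀ {d} → d ∣ x → d ∣ P) → (∀ {d} → d ∣ y → d ∣ r) → gcd x y ≡ 1
    gcd-coprime h₁ h₂ = coprime⇒gcd≡1 (λ { (d∣x , d∣y) → cop (h₁ d∣x , h₂ d∣y) })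
    gcd₂ : gcd (b * f) (f * P) ≡ f
    gcd₂ = trans (cong (λ z → gcd z (f * P)) (ℕ.*-comm b f)) (trans (sym (c*gcd[m,n]≡gcd[cm,cn] f b P))
      (trans (cong (f *_) (trans (gcd-comm b P) (gcd-coprime (λ h → h) (λ h → ∣-trans h b∣r)))) (ℕ.*-identityʳ f)))
    gcd₁ : gcd (a * e₁) e ≡ e₁
    gcd₁ = trans (cong (λ z → gcd z (e₁ * f)) (ℕ.*-comm a e₁)) (trans (sym (c*gcd[m,n]≡gcd[cm,cn] e₁ a f))
      (trans (cong (e₁ *_) (gcd-coprime (λ h → ∣-trans h a∣P) (λ h → ∣-trans h f∣r))) (ℕ.*-identityʳ e₁)))

  -- The signed variable is chosen before χ, so the collapse also applies to functions derived from
  -- χ, which products of folds rely on.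
  Collapses : ∀ {r} → ((Fin r → ℤ) → ℤ) → Set
  Collapses {r} X = (∀ χ → X χ ≡ 0ℤ) ⊎ (∃₂ λ s v → ∀ χ → X χ ≡ sign s *ᶻ χ v)

  -- Every function χ on Fin r is unfolded to the r-periodic function x ↦ ± χ (rep x), whose sum over
  -- any coset of a subgroup of ℤ_r has at most one uncancelled term.
  record Fold (r K : ℕ) : Set where
    field
      rep    : ℕ → Fin r
      sgn    : ℕ → Bool
      rep-p  : ∀ x → rep (x + r) ≡ rep x
      sgn-p  : ∀ x → sgn (x + r) ≡ sgn x
      fibre  : ∀ v → Σ ℕ λ k → (k ≤ K) × (∑ r (λ x → + δ v (rep x)) ≡ + k)

    unfold : (Fin r → ℤ) → ℕ → ℤ
    unfold χ x = sign (sgn x) *ᶻ χ (rep x)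

    unfold-periodic : ∀ χ → Periodic r (unfold χ)
    unfold-periodic χ x = cong₂ (λ s v → sign s *ᶻ χ v) (sgn-p x) (rep-p x)

    field
      coset  : ∀ e q → q * e ≡ r → ∀ c → Collapses (λ χ → ∑ q (λ j → unfold χ (c + j * e)))

  weaken-fold : ∀ {r K K′} → K ≤ K′ → Fold r K → Fold r K′
  weaken-fold K≤ F = record
    { rep = rep ; sgn = sgn ; rep-p = rep-p ; sgn-p = sgn-p
    ; fibre = λ v → let k , k≤ , eq = fibre v in k , ℕ.≤-trans k≤ K≤ , eq
    ; coset = coset }
    where open Fold F

  fold-1 : Fold 1 1
  fold-1 = record
    { rep = λ _ → zero ; sgn = λ _ → true ; rep-p = λ _ → refl ; sgn-p = λ _ → refl
    ; fibre = λ { zero → 1 , ℕ.≤-refl , refl }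
    ; coset = λ e q qe c → inj₂ (true , zero , λ χ → trans (cong (λ z → ∑ z (λ _ → 1ℤ *ᶻ χ zero)) (ℕ.m*n≡1⇒m≡1 q e qe)) (ℤ.+-identityˡ _)) }

  -- With g = gcd P e, the cofactors a = P/g and f = e/g are coprime; f q = r a then forces a to
  -- divide q.
  factor-split : ∀ e q P r → q * e ≡ P * r → Coprime P r → .{{_ : NonZero P}} → Σ ℕ λ e₁ → Σ ℕ λ f → Σ ℕ λ a → Σ ℕ λ b →
    (P ≡ a * e₁) × (r ≡ b * f) × (e ≡ e₁ * f) × (q ≡ a * b)
  factor-split e q P r eq cop = go (gcd P e) refl (gcd[m,n]∣m P e) (gcd[m,n]∣n P e)
    where
    Goal : Set
    Goal = Σ ℕ λ e₁ → Σ ℕ λ f → Σ ℕ λ a → Σ ℕ λ b → (P ≡ a * e₁) × (r ≡ b * f) × (e ≡ e₁ * f) × (q ≡ a * b)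
    go : ∀ g → g ≡ gcd P e → g ∣ P → g ∣ e → Goal
    go g g≡ (divides a P≡) (divides f e≡) = finish (coprime-divisor a⊥f (divides r fq))
      where
      instance
        g≢0 : NonZero g
        g≢0 = ℕ.≢-nonZero λ { refl → ℕ.≢-nonZero⁻¹ P (trans P≡ (ℕ.*-zeroʳ a)) }
        ag≢0 : NonZero (a * g)
        ag≢0 = subst NonZero P≡ (ℕ.≢-nonZero (ℕ.≢-nonZero⁻¹ P))
      a⊥f : Coprime a f
      a⊥f = gcd≡1⇒coprime (ℕ.*-cancelˡ-≡ (gcd a f) 1 g (trans (c*gcd[m,n]≡gcd[cm,cn] g a f)
        (trans (cong₂ gcd (trans (ℕ.*-comm g a) (sym P≡)) (trans (ℕ.*-comm g f) (sym e≡))) (trans (sym g≡) (sym (ℕ.*-identityʳ g))))))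
      lem₁ : ∀ q f g → f * q * g ≡ q * (f * g)
      lem₁ = ℕ-ring
      lem₂ : ∀ a g r → a * g * r ≡ r * a * g
      lem₂ = ℕ-ring
      lem₃ : ∀ a g b f → a * g * (b * f) ≡ b * a * (f * g)
      lem₃ = ℕ-ring
      fq : f * q ≡ r * a
      fq = ℕ.*-cancelʳ-≡ (f * q) (r * a) g (trans (lem₁ q f g) (trans (cong (q *_) (sym e≡)) (trans eq (trans (cong (_* r) P≡) (lem₂ a g r)))))
      finish : a ∣ q → Goal
      finish (divides b q≡) = g , f , a , b , P≡ , r≡ , trans e≡ (ℕ.*-comm f g) , trans q≡ (ℕ.*-comm b a)
        where
        r≡ : r ≡ b * f
        r≡ = ℕ.*-cancelˡ-≡ r (b * f) (a * g) (trans (cong (_* r) (sym P≡)) (trans (sym eq) (trans (cong₂ _*_ q≡ e≡) (sym (lem₃ a g b f)))))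

  module _ {P r K₁ K₂ : ℕ} .{{P≢0 : NonZero P}} .{{r≢0 : NonZero r}} (cop : Coprime P r) (F₁ : Fold P K₁) (F₂ : Fold r K₂) where

    private
      module F₁ = Fold F₁
      module F₂ = Fold F₂

      mul : ∀ {X : Set} (h : ℕ → X) {n} → (∀ x → h (x + n) ≡ h x) → ∀ m x → h (x + m * n) ≡ h x
      mul h {n} p zero    x = cong h (ℕ.+-identityʳ x)
      mul h {n} p (suc m) x = trans (cong h (sym (ℕ.+-assoc x n (m * n)))) (trans (mul h p m (x + n)) (p x))

      rep : ℕ → Fin (P * r)
      rep x = combine (F₁.rep x) (F₂.rep x)

      sgn : ℕ → Bool
      sgn x = F₁.sgn x ⊙ F₂.sgn x

      module _ (v₁ : Fin P) (v₂ : Fin r) where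

        Φ : ℕ → ℕ → ℤ
        Φ u w = + δ v₁ (F₁.rep u) *ᶻ + δ v₂ (F₂.rep w)

        fibre-product : ∑ (P * r) (λ x → + δ (combine v₁ v₂) (rep x)) ≡ ∑ P (λ i → + δ v₁ (F₁.rep i)) *ᶻ ∑ r (λ l → + δ v₂ (F₂.rep l))
        fibre-product = begin
          ∑ (P * r) (λ x → + δ (combine v₁ v₂) (rep x)) ≡⟨ ∑-cong (P * r) (λ x → trans (cong +_ (δ-combine v₁ (F₁.rep x) v₂ (F₂.rep x))) (ℤ.pos-* (δ v₁ (F₁.rep x)) (δ v₂ (F₂.rep x)))) ⟩
          ∑ (P * r) (λ x → Φ x x) ≡⟨ ∑-cong (P * r) (λ x → cong (λ z → Φ z z) (sym (ℕ.*-identityʳ x))) ⟩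
          ∑ (P * r) (λ x → Φ (0 + x * (1 * 1)) (0 + x * (1 * 1))) ≡⟨ ∑-two-periods P r 1 1 P r (sym (ℕ.*-identityʳ P)) (sym (ℕ.*-identityʳ r)) cop Φ
                                                                           (λ w u → cong (λ z → + δ v₁ z *ᶻ + δ v₂ (F₂.rep w)) (F₁.rep-p u)) (λ u w → cong (λ z → + δ v₁ (F₁.rep u) *ᶻ + δ v₂ z) (F₂.rep-p w)) 0 ⟩
          ∑ P (λ i → ∑ r (λ l → Φ (0 + i * 1) (0 + l * 1))) ≡⟨ ∑-cong P (λ i → ∑-cong r (λ l → cong₂ Φ (ℕ.*-identityʳ i) (ℕ.*-identityʳ l))) ⟩
          ∑ P (λ i → ∑ r (λ l → Φ i l)) ≡⟨ ∑-cong P (λ i → ∑-*ˡ r (+ δ v₁ (F₁.rep i)) (λ l → + δ v₂ (F₂.rep l))) ⟩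
          ∑ P (λ i → + δ v₁ (F₁.rep i) *ᶻ ∑ r (λ l → + δ v₂ (F₂.rep l))) ≡⟨ ∑-*ʳ P (∑ r (λ l → + δ v₂ (F₂.rep l))) (λ i → + δ v₁ (F₁.rep i)) ⟩
          ∑ P (λ i → + δ v₁ (F₁.rep i)) *ᶻ ∑ r (λ l → + δ v₂ (F₂.rep l)) ∎

      fibre : ∀ v → Σ ℕ λ k → (k ≤ K₁ * K₂) × (∑ (P * r) (λ x → + δ v (rep x)) ≡ + k)
      fibre v with Fin.combine-surjective {P} {r} v
      ... | v₁ , v₂ , refl = proj₁ (F₁.fibre v₁) * proj₁ (F₂.fibre v₂) , ℕ.*-mono-≤ (proj₁ (proj₂ (F₁.fibre v₁))) (proj₁ (proj₂ (F₂.fibre v₂))) ,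
        trans (fibre-product v₁ v₂) (trans (cong₂ _*ᶻ_ (proj₂ (proj₂ (F₁.fibre v₁))) (proj₂ (proj₂ (F₂.fibre v₂)))) (sym (ℤ.pos-* (proj₁ (F₁.fibre v₁)) (proj₁ (F₂.fibre v₂)))))

      unfolded : (Fin (P * r) → ℤ) → ℕ → ℤ
      unfolded χ x = sign (sgn x) *ᶻ χ (rep x)

      module _ (e₁ f a b : ℕ) (P≡ : P ≡ a * e₁) (r≡ : r ≡ b * f) (c : ℕ) where

        Ψ : (Fin (P * r) → ℤ) → ℕ → ℕ → ℤ
        Ψ χ u w = sign (F₁.sgn u) *ᶻ (sign (F₂.sgn w) *ᶻ χ (combine (F₁.rep u) (F₂.rep w)))

        along : (Fin (P * r) → ℤ) → ℕ → Fin P → ℤ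
        along χ w v = sign (F₂.sgn w) *ᶻ χ (combine v (F₂.rep w))

        a≢0 : NonZero a
        a≢0 = ℕ.≢-nonZero λ { refl → ℕ.≢-nonZero⁻¹ P P≡ }

        b≢0 : NonZero b
        b≢0 = ℕ.≢-nonZero λ { refl → ℕ.≢-nonZero⁻¹ r r≡ }

        total : (Fin (P * r) → ℤ) → ℤ
        total χ = ∑ (a * b) (λ j → unfolded χ (c + j * (e₁ * f)))

        split : ∀ χ x → unfolded χ x ≡ Ψ χ x x
        split χ x = trans (cong (_*ᶻ χ (rep x)) (sign-⊙ (F₁.sgn x) (F₂.sgn x))) (ℤ.*-assoc (sign (F₁.sgn x)) (sign (F₂.sgn x)) (χ (rep x)))

        double : ∀ χ → total χ ≡ ∑ b (λ l → ∑ a (λ i → F₁.unfold (along χ (c + l * f)) (c + i * e₁)))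
        double χ = begin
          ∑ (a * b) (λ j → unfolded χ (c + j * (e₁ * f))) ≡⟨ ∑-cong (a * b) (λ j → split χ (c + j * (e₁ * f))) ⟩
          ∑ (a * b) (λ j → Ψ χ (c + j * (e₁ * f)) (c + j * (e₁ * f))) ≡⟨ ∑-two-periods P r e₁ f a b P≡ r≡ cop {{a≢0}} {{b≢0}} (Ψ χ)
                                                                          (λ w u → cong₂ (λ s z → sign s *ᶻ (sign (F₂.sgn w) *ᶻ χ (combine z (F₂.rep w)))) (F₁.sgn-p u) (F₁.rep-p u))
                                                                          (λ u w → cong₂ (λ s z → sign (F₁.sgn u) *ᶻ (sign s *ᶻ χ (combine (F₁.rep u) z))) (F₂.sgn-p w) (F₂.rep-p w)) c ⟩
          ∑ a (λ i → ∑ b (λ l → Ψ χ (c + i * e₁) (c + l * f))) ≡⟨ ∑-swap a b (λ i l → Ψ χ (c + i * e₁) (c + l * f)) ⟩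
          ∑ b (λ l → ∑ a (λ i → Ψ χ (c + i * e₁) (c + l * f))) ∎

        -- Every inner sum collapses to the same `v₁` with the same sign, whatever the outer index,
        -- so the outer sum is again a coset sum of `F₂`, taken for χ along the slice of `v₁`.
        product-collapses : Collapses (λ χ → ∑ a (λ i → F₁.unfold χ (c + i * e₁))) → Collapses (λ χ → ∑ b (λ l → F₂.unfold χ (c + l * f))) → Collapses total
        product-collapses (inj₁ z) _ = inj₁ λ χ → trans (double χ) (trans (∑-cong b (λ l → z (along χ (c + l * f)))) (∑-0 b))
        product-collapses (inj₂ (s₁ , v₁ , h₁)) cs₂ = second cs₂
          where
          reduce : ∀ χ → total χ ≡ sign s₁ *ᶻ ∑ b (λ l → F₂.unfold (λ v → χ (combine v₁ v)) (c + l * f))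
          reduce χ = trans (double χ) (trans (∑-cong b (λ l → h₁ (along χ (c + l * f)))) (∑-*ˡ b (sign s₁) (λ l → F₂.unfold (λ v → χ (combine v₁ v)) (c + l * f))))
          second : Collapses (λ χ → ∑ b (λ l → F₂.unfold χ (c + l * f))) → Collapses total
          second (inj₁ z) = inj₁ λ χ → trans (reduce χ) (trans (cong (sign s₁ *ᶻ_) (z (λ v → χ (combine v₁ v)))) (ℤ.*-zeroʳ (sign s₁)))
          second (inj₂ (s₂ , v₂ , h₂)) = inj₂ (s₁ ⊙ s₂ , combine v₁ v₂ , λ χ → trans (reduce χ) (trans (cong (sign s₁ *ᶻ_) (h₂ (λ v → χ (combine v₁ v))))
            (trans (sym (ℤ.*-assoc (sign s₁) (sign s₂) (χ (combine v₁ v₂)))) (cong (_*ᶻ χ (combine v₁ v₂)) (sym (sign-⊙ s₁ s₂))))))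

      coset : ∀ e q → q * e ≡ P * r → ∀ c → Collapses (λ χ → ∑ q (λ j → unfolded χ (c + j * e)))
      coset e q qe c = go (factor-split e q P r qe cop)
        where
        go : (Σ ℕ λ e₁ → Σ ℕ λ f → Σ ℕ λ a → Σ ℕ λ b → (P ≡ a * e₁) × (r ≡ b * f) × (e ≡ e₁ * f) × (q ≡ a * b)) → Collapses (λ χ → ∑ q (λ j → unfolded χ (c + j * e)))
        go (e₁ , f , a , b , P≡ , r≡ , e≡ , q≡) = subst₂ (λ e q → Collapses (λ χ → ∑ q (λ j → unfolded χ (c + j * e)))) (sym e≡) (sym q≡)
          (product-collapses e₁ f a b P≡ r≡ c (F₁.coset e₁ a (sym P≡) c) (F₂.coset f b (sym r≡) c))

    fold-* : Fold (P * r) (K₁ * K₂)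
    fold-* = record
      { rep   = rep
      ; sgn   = sgn
      ; rep-p = λ x → cong₂ combine (trans (cong (λ z → F₁.rep (x + z)) (ℕ.*-comm P r)) (mul F₁.rep F₁.rep-p r x)) (mul F₂.rep F₂.rep-p P x)
      ; sgn-p = λ x → cong₂ _⊙_ (trans (cong (λ z → F₁.sgn (x + z)) (ℕ.*-comm P r)) (mul F₁.sgn F₁.sgn-p r x)) (mul F₂.sgn F₂.sgn-p P x)
      ; fibre = fibre
      ; coset = coset }

-- Mirroring the top digit: from modulus P to modulus p P.

module Digit where

  open Sums
  open Folding
  open Moments using (δ)

  open ≡-Reasoning

  δℕ : ℕ → ℕ → ℕ
  δℕ zero    zero    = 1
  δℕ (suc a) (suc b) = δℕ a b
  δℕ zero    (suc b) = 0
  δℕ (suc a) zero    = 0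

  δ-toℕ : ∀ {n} (i j : Fin n) → δ i j ≡ δℕ (toℕ i) (toℕ j)
  δ-toℕ zero    zero    = refl
  δ-toℕ zero    (suc j) = refl
  δ-toℕ (suc i) zero    = refl
  δ-toℕ (suc i) (suc j) = δ-toℕ i j

  ∑-δℕ : ∀ n a → a < n → ∑ n (λ x → + δℕ a x) ≡ 1ℤ
  ∑-δℕ (suc n) zero    _         = trans (∑-cons n (λ x → + δℕ 0 x)) (cong (1ℤ +ᶻ_) (∑-0 n))
  ∑-δℕ (suc n) (suc a) (s≤s a<n) = trans (∑-cons n (λ x → + δℕ (suc a) x)) (trans (ℤ.+-identityˡ _) (∑-δℕ n a a<n))

  fin : (n : ℕ) .{{_ : NonZero n}} → ℕ → Fin n
  fin n x = fromℕ< (m%n<n x n)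

  fin-cong : ∀ n .{{_ : NonZero n}} {x y} → x % n ≡ y % n → fin n x ≡ fin n y
  fin-cong n {x} {y} eq = Fin.fromℕ<-cong (x % n) (y % n) eq (m%n<n x n) (m%n<n y n)

  ∑-fin : ∀ n .{{_ : NonZero n}} v → ∑ n (λ x → + δ v (fin n x)) ≡ 1ℤ
  ∑-fin n v = trans (∑-cong< n (λ x x<n → cong +_ (trans (δ-toℕ v (fin n x)) (cong (δℕ (toℕ v)) (trans (Fin.toℕ-fromℕ< (m%n<n x n)) (m<n⇒m%n≡m x<n)))))) (∑-δℕ n (toℕ v) (Fin.toℕ<n v))

  periodic-% : ∀ n .{{_ : NonZero n}} {f} → Periodic n f → ∀ x → f (x % n) ≡ f x
  periodic-% n {f} p x = trans (sym (periodic-* p (x / n) (x % n))) (cong f (sym (m≡m%n+[m/n]*n x n)))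

  -- The top base-p digit l is matched with p - 1 - l; for odd p the unmatched middle digit defers to F.
  module _ (m ε P : ℕ) (ε≤1 : ε ≤ 1) .{{P≢0 : NonZero P}} .{{p≢0 : NonZero (m + (ε + m))}} (F : Fold P 2) where

    private
      p : ℕ
      p = m + (ε + m)
      module F = Fold F

    data Part : Set where
      low mid high : Part

    part : ℕ → Part
    part l with l <? m
    ... | yes _ = low
    ... | no  _ with l <? m + ε
    ...   | yes _ = mid
    ...   | no  _ = high

    part-low : ∀ l → l < m → part l ≡ low
    part-low l l<m with l <? m
    ... | yes _ = refl
    ... | no  h = ⊥-elim (h l<m)

    part-mid : ∀ l → l < ε → part (m + l) ≡ mid
    part-mid l l<ε with m + l <? m
    ... | yes h = ⊥-elim (ℕ.m+n≮m m l h)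
    ... | no  _ with m + l <? m + ε
    ...   | yes _ = refl
    ...   | no  h = ⊥-elim (h (ℕ.+-monoʳ-< m l<ε))

    part-high : ∀ l → part (m + (ε + l)) ≡ high
    part-high l with m + (ε + l) <? m
    ... | yes h = ⊥-elim (ℕ.m+n≮m m (ε + l) h)
    ... | no  _ with m + (ε + l) <? m + ε
    ...   | yes h = ⊥-elim (ℕ.m+n≮m ε l (ℕ.+-cancelˡ-< m (ε + l) ε h))
    ...   | no  _ = refl

    repᴾ : Part → ℕ → ℕ → Fin (p * P)
    repᴾ low  l x = combine (fin p l) (fin P x)
    repᴾ mid  l x = combine (fin p l) (F.rep x)
    repᴾ high l x = combine (fin p (p ∸ suc l)) (fin P x)

    sgnᴾ : Part → ℕ → Bool
    sgnᴾ low  x = true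
    sgnᴾ mid  x = F.sgn x
    sgnᴾ high x = false

    digit : ℕ → ℕ
    digit x = (x / P) % p

    digit-+ : ∀ x → digit (x + p * P) ≡ digit x
    digit-+ x = trans (cong (_% p) (trans (+-distrib-/-∣ʳ x (n∣m*n p)) (cong (λ z → x / P + z) (m*n/n≡m p P)))) ([m+n]%n≡m%n (x / P) p)

    digit-≡ : ∀ a l → a < P → l < p → digit (a + l * P) ≡ l
    digit-≡ a l a<P l<p = trans (cong (_% p) (trans (+-distrib-/-∣ʳ a (n∣m*n l)) (cong₂ _+_ (m<n⇒m/n≡0 a<P) (m*n/n≡m l P)))) (m<n⇒m%n≡m l<p)

    rep-* : ∀ k x → F.rep (x + k * P) ≡ F.rep x
    rep-* zero    x = cong F.rep (ℕ.+-identityʳ x)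
    rep-* (suc k) x = trans (cong F.rep (sym (ℕ.+-assoc x P (k * P)))) (trans (rep-* k (x + P)) (F.rep-p x))

    sgn-* : ∀ k x → F.sgn (x + k * P) ≡ F.sgn x
    sgn-* zero    x = cong F.sgn (ℕ.+-identityʳ x)
    sgn-* (suc k) x = trans (cong F.sgn (sym (ℕ.+-assoc x P (k * P)))) (trans (sgn-* k (x + P)) (F.sgn-p x))

    repᴾ-* : ∀ t l k x → repᴾ t l (x + k * P) ≡ repᴾ t l x
    repᴾ-* low  l k x = cong (combine (fin p l)) (fin-cong P ([m+kn]%n≡m%n x k P))
    repᴾ-* mid  l k x = cong (combine (fin p l)) (rep-* k x)
    repᴾ-* high l k x = cong (combine (fin p (p ∸ suc l))) (fin-cong P ([m+kn]%n≡m%n x k P))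

    sgnᴾ-* : ∀ t k x → sgnᴾ t (x + k * P) ≡ sgnᴾ t x
    sgnᴾ-* low  k x = refl
    sgnᴾ-* mid  k x = sgn-* k x
    sgnᴾ-* high k x = refl

    rep′ : ℕ → Fin (p * P)
    rep′ x = repᴾ (part (digit x)) (digit x) x

    sgn′ : ℕ → Bool
    sgn′ x = sgnᴾ (part (digit x)) x

    rep′-p : ∀ x → rep′ (x + p * P) ≡ rep′ x
    rep′-p x = trans (cong (λ d → repᴾ (part d) d (x + p * P)) (digit-+ x)) (repᴾ-* (part (digit x)) (digit x) p x)

    sgn′-p : ∀ x → sgn′ (x + p * P) ≡ sgn′ x
    sgn′-p x = trans (cong (λ d → sgnᴾ (part d) (x + p * P)) (digit-+ x)) (sgnᴾ-* (part (digit x)) p x)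

    rep′-digit : ∀ a l → a < P → l < p → rep′ (a + l * P) ≡ repᴾ (part l) l a
    rep′-digit a l a<P l<p = trans (cong (λ d → repᴾ (part d) d (a + l * P)) (digit-≡ a l a<P l<p)) (repᴾ-* (part l) l l a)

    sgn′-digit : ∀ a l → a < P → l < p → sgn′ (a + l * P) ≡ sgnᴾ (part l) a
    sgn′-digit a l a<P l<p = trans (cong (λ d → sgnᴾ (part d) (a + l * P)) (digit-≡ a l a<P l<p)) (sgnᴾ-* (part l) l a)

    ∑-parts : ∀ (G : Part → ℕ → ℤ) → ∑ p (λ l → G (part l) l) ≡ ∑ m (G low) +ᶻ (∑ ε (λ l → G mid (m + l)) +ᶻ ∑ m (λ l → G high (m + (ε + l))))
    ∑-parts G = trans (∑-split m (ε + m) (λ l → G (part l) l)) (cong₂ _+ᶻ_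
      (∑-cong< m (λ l l<m → cong (λ t → G t l) (part-low l l<m)))
      (trans (∑-split ε m (λ l → G (part (m + l)) (m + l))) (cong₂ _+ᶻ_
        (∑-cong< ε (λ l l<ε → cong (λ t → G t (m + l)) (part-mid l l<ε)))
        (∑-cong m (λ l → cong (λ t → G t (m + (ε + l))) (part-high l))))))

    mirror : ∀ l → p ∸ suc (m + (ε + l)) ≡ m ∸ suc l
    mirror l = trans (cong₂ _∸_ (lem m ε) (lem₂ m ε l)) (ℕ.[m+n]∸[m+o]≡n∸o (m + ε) m (suc l))
      where
      lem : ∀ m ε → m + (ε + m) ≡ m + ε + m
      lem = ℕ-ring
      lem₂ : ∀ m ε l → suc (m + (ε + l)) ≡ m + ε + suc l
      lem₂ = ℕ-ring

    -- A variable with a low digit is met once from that digit and once from its mirror image; one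
    -- with the middle digit is met as often as in `F`. Only one case can occur for a given digit,
    -- so the multiplicity stays at 2 however high the prime power.
    fibre′ : ∀ v → Σ ℕ λ k → (k ≤ 2) × (∑ (p * P) (λ x → + δ v (rep′ x)) ≡ + k)
    fibre′ v with Fin.combine-surjective {p} {P} v
    ... | v₁ , v₂ , refl with F.fibre v₂
    ... | k₂ , k₂≤2 , eq₂ = ∣ total ∣ , bound , trans sum≡ (sym total≡)
      where
      at : ℕ → ℤ
      at l = + δ v₁ (fin p l)
      A B total : ℤ
      A = ∑ m at
      B = ∑ ε (λ l → at (m + l))
      total = A +ᶻ (B *ᶻ + k₂ +ᶻ A)
      G : Part → ℕ → ℤ
      G t l = ∑ P (λ a → + δ (combine v₁ v₂) (repᴾ t l a))
      separate : ∀ l (h : ℕ → Fin P) → ∑ P (λ a → + δ (combine v₁ v₂) (combine (fin p l) (h a))) ≡ at l *ᶻ ∑ P (λ a → + δ v₂ (h a))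
      separate l h = trans (∑-cong P (λ a → trans (cong +_ (δ-combine v₁ (fin p l) v₂ (h a))) (ℤ.pos-* (δ v₁ (fin p l)) (δ v₂ (h a))))) (∑-*ˡ P (at l) (λ a → + δ v₂ (h a)))
      G-outer : ∀ l → ∑ P (λ a → + δ (combine v₁ v₂) (combine (fin p l) (fin P a))) ≡ at l
      G-outer l = trans (separate l (fin P)) (trans (cong (at l *ᶻ_) (∑-fin P v₂)) (ℤ.*-identityʳ (at l)))
      sum≡ : ∑ (p * P) (λ x → + δ (combine v₁ v₂) (rep′ x)) ≡ total
      sum≡ = begin
        ∑ (p * P) (λ x → + δ (combine v₁ v₂) (rep′ x)) ≡⟨ ∑-blocks p P _ ⟩
        ∑ p (λ l → ∑ P (λ a → + δ (combine v₁ v₂) (rep′ (l * P + a)))) ≡⟨ ∑-cong< p (λ l l<p → ∑-cong< P (λ a a<P → cong (λ w → + δ (combine v₁ v₂) w) (trans (cong rep′ (ℕ.+-comm (l * P) a)) (rep′-digit a l a<P l<p)))) ⟩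
        ∑ p (λ l → G (part l) l) ≡⟨ ∑-parts G ⟩
        ∑ m (G low) +ᶻ (∑ ε (λ l → G mid (m + l)) +ᶻ ∑ m (λ l → G high (m + (ε + l))))
          ≡⟨ cong₂ _+ᶻ_ (∑-cong m G-outer) (cong₂ _+ᶻ_
               (trans (∑-cong ε (λ l → trans (separate (m + l) F.rep) (cong (at (m + l) *ᶻ_) eq₂))) (∑-*ʳ ε (+ k₂) (λ l → at (m + l))))
               (trans (∑-cong m (λ l → trans (G-outer (p ∸ suc (m + (ε + l)))) (cong at (mirror l)))) (∑-reverse m at))) ⟩
        total ∎
      at≥0 : ∀ l → 0ℤ ≤ᶻ at l
      at≥0 l = +≤+ z≤n
      ∑≥0 : ∀ n {f : ℕ → ℤ} → (∀ l → 0ℤ ≤ᶻ f l) → 0ℤ ≤ᶻ ∑ n f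
      ∑≥0 n {f} h = subst (_≤ᶻ ∑ n f) (∑-0 n) (∑-mono< n (λ l _ → h l))
      A≡ : + ∣ A ∣ ≡ A
      A≡ = ℤ.0≤i⇒+∣i∣≡i (∑≥0 m at≥0)
      B≡ : + ∣ B ∣ ≡ B
      B≡ = ℤ.0≤i⇒+∣i∣≡i (∑≥0 ε (λ l → at≥0 (m + l)))
      totalℕ : ℕ
      totalℕ = ∣ A ∣ + (∣ B ∣ * k₂ + ∣ A ∣)
      total≡ℕ : total ≡ + totalℕ
      total≡ℕ = begin
        A +ᶻ (B *ᶻ + k₂ +ᶻ A) ≡⟨ cong₂ (λ a b → a +ᶻ (b *ᶻ + k₂ +ᶻ a)) A≡ B≡ ⟨
        + ∣ A ∣ +ᶻ (+ ∣ B ∣ *ᶻ + k₂ +ᶻ + ∣ A ∣) ≡⟨ cong (λ z → + ∣ A ∣ +ᶻ (z +ᶻ + ∣ A ∣)) (ℤ.pos-* ∣ B ∣ k₂) ⟨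
        + totalℕ ∎
      total≡ : + ∣ total ∣ ≡ total
      total≡ = trans (cong (λ z → + ∣ z ∣) total≡ℕ) (sym total≡ℕ)
      A+B≤1 : ∣ A ∣ + ∣ B ∣ ≤ 1
      A+B≤1 = ℤ.drop‿+≤+ (subst₂ _≤ᶻ_ (sym (cong₂ _+ᶻ_ A≡ B≡)) total-1 (subst (_≤ᶻ A +ᶻ (B +ᶻ ∑ m (λ l → at (m + (ε + l))))) (cong (A +ᶻ_) (ℤ.+-identityʳ B)) (ℤ.+-monoʳ-≤ A (ℤ.+-monoʳ-≤ B (∑≥0 m (λ l → at≥0 (m + (ε + l))))))))
        where
        total-1 : A +ᶻ (B +ᶻ ∑ m (λ l → at (m + (ε + l)))) ≡ + 1
        total-1 = trans (sym (trans (∑-split m (ε + m) at) (cong (A +ᶻ_) (∑-split ε m (λ l → at (m + l)))))) (∑-fin p v₁)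
      bound : ∣ total ∣ ≤ 2
      bound = ℕ.≤-trans (ℕ.≤-reflexive (cong ∣_∣ total≡ℕ)) (ℕ.≤-trans (ℕ.+-monoʳ-≤ ∣ A ∣ (ℕ.+-monoˡ-≤ ∣ A ∣ (ℕ.*-monoʳ-≤ ∣ B ∣ k₂≤2)))
        (ℕ.≤-trans (ℕ.≤-reflexive (lem ∣ A ∣ ∣ B ∣)) (ℕ.*-monoʳ-≤ 2 A+B≤1)))
        where
        lem : ∀ a b → a + (b * 2 + a) ≡ 2 * (a + b)
        lem = ℕ-ring

    unfold′ : (Fin (p * P) → ℤ) → ℕ → ℤ
    unfold′ χ x = sign (sgn′ x) *ᶻ χ (rep′ x)

    digit-sum : ∀ χ y → ∑ p (λ l → unfold′ χ (y + l * P)) ≡ ∑ ε (λ l → F.unfold (λ v → χ (combine (fin p (m + l)) v)) y)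
    digit-sum χ y = begin
      -- Reducing `y` modulo `P` makes the top digit of the l-th point equal to l.
      D y ≡⟨ periodic-% P (∑-step-periodic p P (unfold′ χ) (λ x → cong₂ (λ s v → sign s *ᶻ χ v) (sgn′-p x) (rep′-p x))) y ⟨
      D a ≡⟨ ∑-cong< p (λ l l<p → cong₂ (λ s v → sign s *ᶻ χ v) (sgn′-digit a l (m%n<n y P) l<p) (rep′-digit a l (m%n<n y P) l<p)) ⟩
      ∑ p (λ l → G (part l) l) ≡⟨ ∑-parts G ⟩
      ∑ m (G low) +ᶻ (∑ ε (λ l → G mid (m + l)) +ᶻ ∑ m (λ l → G high (m + (ε + l))))
        ≡⟨ cong₂ _+ᶻ_ (∑-cong m (λ l → ℤ.*-identityˡ (h l))) (cong (∑ ε (λ l → G mid (m + l)) +ᶻ_)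
             (trans (∑-*ˡ m (sign false) (λ l → h (p ∸ suc (m + (ε + l))))) (cong (sign false *ᶻ_) (trans (∑-cong m (λ l → cong h (mirror l))) (∑-reverse m h))))) ⟩
      ∑ m h +ᶻ (∑ ε (λ l → G mid (m + l)) +ᶻ sign false *ᶻ ∑ m h) ≡⟨ lem (∑ m h) (∑ ε (λ l → G mid (m + l))) ⟩
      ∑ ε (λ l → G mid (m + l)) ≡⟨ ∑-cong ε (λ l → periodic-% P (F.unfold-periodic (λ v → χ (combine (fin p (m + l)) v))) y) ⟩
      ∑ ε (λ l → F.unfold (λ v → χ (combine (fin p (m + l)) v)) y) ∎
      where
      a : ℕ
      a = y % P
      D : ℕ → ℤ
      D y = ∑ p (λ l → unfold′ χ (y + l * P))
      G : Part → ℕ → ℤ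
      G t l = sign (sgnᴾ t a) *ᶻ χ (repᴾ t l a)
      h : ℕ → ℤ
      h l = χ (combine (fin p l) (fin P a))
      lem : ∀ x y → x +ᶻ (y +ᶻ ℤ.- (+ 1) *ᶻ x) ≡ y
      lem = ℤ-ring

    -- The hypothesis is what prime powers provide: a nontrivial subgroup contains all multiples of
    -- `P`. Its cosets are then unions of complete digit ranges, and `digit-sum` reduces them to
    -- cosets modulo `P`.
    extend : (∀ e q → q * e ≡ p * P → (q ≡ 1) ⊎ (Σ ℕ λ q′ → (q ≡ p * q′) × (q′ * e ≡ P))) → Fold (p * P) 2
    extend H = record { rep = rep′ ; sgn = sgn′ ; rep-p = rep′-p ; sgn-p = sgn′-p ; fibre = fibre′ ; coset = coset′ }
      where
      middle : ∀ ε → ε ≤ 1 → ∀ (g : ℕ → Fin p) e q′ → q′ * e ≡ P → ∀ c →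
        Collapses (λ χ → ∑ q′ (λ i → ∑ ε (λ l → F.unfold (λ v → χ (combine (g l) v)) (c + i * e))))
      middle zero _ g e q′ _ c = inj₁ (λ χ → ∑-0 q′)
      middle (suc zero) _ g e q′ q′e c with F.coset e q′ q′e c
      ... | inj₁ z           = inj₁ λ χ → trans (∑-cong q′ (λ i → ℤ.+-identityˡ _)) (z (λ v → χ (combine (g 0) v)))
      ... | inj₂ (s , v , h) = inj₂ (s , combine (g 0) v , λ χ → trans (∑-cong q′ (λ i → ℤ.+-identityˡ _)) (h (λ v → χ (combine (g 0) v))))
      middle (suc (suc _)) (s≤s ())
      pos : ∀ c l q′ i e → c + (l * q′ + i) * e ≡ c + i * e + l * (q′ * e)
      pos = ℕ-ring
      regroup : ∀ e q′ c → q′ * e ≡ P → ∀ χ → ∑ (p * q′) (λ j → unfold′ χ (c + j * e)) ≡ ∑ q′ (λ i → ∑ ε (λ l → F.unfold (λ v → χ (combine (fin p (m + l)) v)) (c + i * e)))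
      regroup e q′ c q′e χ = trans (∑-blocks p q′ _) (trans (∑-swap p q′ _) (∑-cong q′ (λ i → trans (∑-cong p (λ l → cong (unfold′ χ) (trans (pos c l q′ i e) (cong (λ z → c + i * e + l * z) q′e)))) (digit-sum χ (c + i * e)))))
      coset′ : ∀ e q → q * e ≡ p * P → ∀ c → Collapses (λ χ → ∑ q (λ j → unfold′ χ (c + j * e)))
      coset′ e q qe c with H e q qe
      ... | inj₁ refl = inj₂ (sgn′ (c + 0) , rep′ (c + 0) , λ χ → ℤ.+-identityˡ _)
      ... | inj₂ (q′ , refl , q′e) with middle ε ε≤1 (λ l → fin p (m + l)) e q′ q′e c
      ...   | inj₁ z           = inj₁ λ χ → trans (regroup e q′ c q′e χ) (z χ)
      ...   | inj₂ (s , v , h) = inj₂ (s , v , λ χ → trans (regroup e q′ c q′e χ) (h χ))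

-- Folds for prime powers and for general moduli.

module PrimeFold where

  open Sums
  open Folding
  open Counting
  open Digit

  prime-∤⇒coprime : ∀ {p q} → Prime p → ¬ (p ∣ q) → Coprime q p
  prime-∤⇒coprime pr p∤q (d∣q , d∣p) with prime⇒irreducible pr d∣p
  ... | inj₁ d≡1 = d≡1
  ... | inj₂ refl = ⊥-elim (p∤q d∣q)

  coprime-^ : ∀ {p q} k → Coprime q p → q ∣ p ^ k → q ≡ 1
  coprime-^ zero    cop h = ∣1⇒≡1 h
  coprime-^ (suc k) cop h = coprime-^ k cop (coprime-divisor cop h)

  fold-prime-power : ∀ p → Prime p → ∀ k → Fold (p ^ k) 2
  fold-prime-power p pr zero    = weaken-fold (s≤s z≤n) fold-1
  fold-prime-power p pr (suc k) = subst (λ z → Fold (z * p ^ k) 2) p≡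
    -- Here m = p / 2 and ε = p % 2. Only p = 2 gives ε = 0, and then no digit is left unmatched.
    (extend (p / 2) (p % 2) (p ^ k) (ℕ.≤-pred (m%n<n p 2)) {{ℕ.m^n≢0 p k}} {{subst NonZero (sym p≡) p≢0}} (fold-prime-power p pr k)
      (λ e q qe → quotients e q (trans qe (cong (_* p ^ k) p≡))))
    where
    instance
      p≢0 : NonZero p
      p≢0 = prime⇒nonZero pr
    lem : ∀ m ε → m + (ε + m) ≡ ε + m * 2
    lem = ℕ-ring
    p≡ : p / 2 + (p % 2 + p / 2) ≡ p
    p≡ = trans (lem (p / 2) (p % 2)) (sym (m≡m%n+[m/n]*n p 2))
    lem₂ : ∀ q p e → q * p * e ≡ p * (q * e)
    lem₂ = ℕ-ring
    quotients : ∀ e q → q * e ≡ p * p ^ k → (q ≡ 1) ⊎ (Σ ℕ λ q′ → (q ≡ (p / 2 + (p % 2 + p / 2)) * q′) × (q′ * e ≡ p ^ k))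
    quotients e q qe with p ∣? q
    ... | yes (divides q′ refl) = inj₂ (q′ , trans (ℕ.*-comm q′ p) (cong (_* q′) (sym p≡)) , ℕ.*-cancelˡ-≡ (q′ * e) (p ^ k) p (trans (sym (lem₂ q′ p e)) qe))
    ... | no  p∤q = inj₁ (coprime-^ (suc k) (prime-∤⇒coprime pr p∤q) (divides e (trans (sym qe) (ℕ.*-comm q e))))

  strip : ∀ p → Prime p → ∀ r → 0 < r → Σ ℕ λ k → Σ ℕ λ r′ → (r ≡ p ^ k * r′) × ¬ (p ∣ r′)
  strip p pr = <-rec (λ r → 0 < r → Σ ℕ λ k → Σ ℕ λ r′ → (r ≡ p ^ k * r′) × ¬ (p ∣ r′)) go
    where
    go : ∀ r → (∀ {s} → s < r → 0 < s → Σ ℕ λ k → Σ ℕ λ r′ → (s ≡ p ^ k * r′) × ¬ (p ∣ r′)) → 0 < r → Σ ℕ λ k → Σ ℕ λ r′ → (r ≡ p ^ k * r′) × ¬ (p ∣ r′)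
    go r rec 0<r with p ∣? r
    ... | no p∤r = 0 , r , sym (ℕ.*-identityˡ r) , p∤r
    ... | yes (divides zero refl) = ⊥-elim (ℕ.<-irrefl refl 0<r)
    ... | yes (divides q@(suc _) refl) with rec (ℕ.m<m*n q p (ℕ.nonTrivial⇒n>1 p {{prime⇒nonTrivial pr}})) (s≤s z≤n)
    ...   | k , r′ , q≡ , p∤ = suc k , r′ , trans (cong (_* p) q≡) (lem (p ^ k) r′ p) , p∤
      where
      lem : ∀ x r p → x * r * p ≡ p * x * r
      lem = ℕ-ring

  prime-divisor : ∀ r → 1 < r → ∃ λ p → Prime p × p ∣ r
  prime-divisor r@(suc _) 1<r with factorise r
  ... | record { factors = [] ; isFactorisation = eq } = ⊥-elim (ℕ.<-irrefl (sym eq) 1<r)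
  ... | record { factors = p ∷ ps ; isFactorisation = eq ; factorsPrime = pr ∷ _ } = p , pr , divides (product ps) (trans eq (ℕ.*-comm p (product ps)))

  omega-strip : ∀ p → Prime p → ∀ r r′ → 0 < r → p ∣ r → r′ ∣ r → ¬ (p ∣ r′) → suc (omega r′) ≤ omega r
  omega-strip p pr r@(suc _) r′ _ p∣r r′∣r p∤r′ = ℕ.≤-trans (s≤s (#upTo-mono P′? (s≤s (∣⇒≤ r′∣r))))
    (#upTo-⊂ P′? P? (λ { x (px , x∣) → px , ∣-trans x∣ r′∣r }) p (pr , p∣r) (λ { (_ , h) → p∤r′ h }) (suc r) (s≤s (∣⇒≤ p∣r)))
    where
    P? : (x : ℕ) → Dec (Prime x × x ∣ r)
    P? x = prime? x ×-dec (x ∣? r)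
    P′? : (x : ℕ) → Dec (Prime x × x ∣ r′)
    P′? x = prime? x ×-dec (x ∣? r′)

  -- Splitting off a whole prime power costs one factor 2 and lowers `omega` of the remaining
  -- modulus by at least one.
  fold-omega : ∀ r → 0 < r → Fold r (2 ^ omega r)
  fold-omega = <-rec (λ r → 0 < r → Fold r (2 ^ omega r)) go
    where
    go : ∀ r → (∀ {s} → s < r → 0 < s → Fold s (2 ^ omega s)) → 0 < r → Fold r (2 ^ omega r)
    go r rec 0<r with r ℕ.≟ 1
    ... | yes refl = weaken-fold (ℕ.m^n>0 2 (omega 1)) fold-1
    ... | no  r≢1 with prime-divisor r (ℕ.≤∧≢⇒< 0<r (λ eq → r≢1 (sym eq)))
    ...   | p , pr , p∣r with strip p pr r 0<r
    ...     | zero , r′ , r≡ , p∤r′ = ⊥-elim (p∤r′ (subst (p ∣_) (trans r≡ (ℕ.*-identityˡ r′)) p∣r))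
    ...     | suc k , zero , r≡ , p∤r′ = ⊥-elim (p∤r′ (divides 0 refl))
    ...     | suc k , r′@(suc _) , refl , p∤r′ = weaken-fold (ℕ.^-monoʳ-≤ 2 (omega-strip p pr (p ^ suc k * r′) r′ 0<r p∣r (n∣m*n (p ^ suc k)) p∤r′))
        (fold-* {{p^≢0}} cop (fold-prime-power p pr (suc k)) (rec r′<r (s≤s z≤n)))
      where
      p≢0 : NonZero p
      p≢0 = prime⇒nonZero pr
      p^≢0 : NonZero (p ^ suc k)
      p^≢0 = ℕ.m^n≢0 p (suc k) {{p≢0}}
      cop : Coprime (p ^ suc k) r′
      cop {d} (d∣p^ , d∣r′) = coprime-^ (suc k) (λ { (c∣d , c∣p) → prime-∤⇒coprime pr p∤r′ (∣-trans c∣d d∣r′ , c∣p) }) d∣p^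
      1<p^ : 1 < p ^ suc k
      1<p^ = ℕ.≤-trans (ℕ.nonTrivial⇒n>1 p {{prime⇒nonTrivial pr}}) (ℕ.m≤m*n p (p ^ k) {{ℕ.m^n≢0 p k {{p≢0}}}})
      r′<r : r′ < p ^ suc k * r′
      r′<r = ℕ.<-≤-trans (ℕ.m<m*n r′ (p ^ suc k) 1<p^) (ℕ.≤-reflexive (ℕ.*-comm r′ (p ^ suc k)))

-- Upper bound: walks through ℤ_r, progressions and the final constant.

module Upper where

  open Sums
  open Lower using (A; A-cong)
  open Disc
  open Pigeon
  open Moments
  open Step using (*-^-distrib; 64^≡)
  open Balance
  open Folding
  open Digit using (periodic-%)
  open PrimeFold

  ∣-∣≤ : ∀ {x y X Y} → ∣ x ∣ ≤ X → ∣ y ∣ ≤ Y → ∣ x -ᶻ y ∣ ≤ X + Y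
  ∣-∣≤ {x} {y} p q = ℕ.≤-trans (ℤ.∣i-j∣≤∣i∣+∣j∣ x y) (ℕ.+-mono-≤ p q)

  module Walks {r K : ℕ} .{{r≢0 : NonZero r}} (F : Fold r K) where

    open Fold F

    literal : ℕ → Literal r
    literal x = rep x , sgn x

    segment : ℕ → ℕ → ℕ → List (Literal r)
    segment d c zero    = []
    segment d c (suc l) = segment d c l ++ [ literal (c + l * d) ]

    -- The cycles of x ↦ x + d from the starting points 0, 1, 2, ... are written one after another.
    -- One list per difference then serves all cycles, so `r` lists suffice, and a stretch from the
    -- start of a cycle is a difference of two prefixes.
    walk : ℕ → ℕ → ℕ → List (Literal r)
    walk d π zero    = []
    walk d π (suc c) = walk d π c ++ segment d c π

    S-segment : ∀ v d c l → S v (segment d c l) ≡ A l d (unfold v) c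
    S-segment v d c zero    = refl
    S-segment v d c (suc l) = trans (S-++ v (segment d c l) [ literal (c + l * d) ]) (cong₂ _+ᶻ_ (S-segment v d c l) (ℤ.+-identityʳ _))

    occ-segment : ∀ v d c l → + occ v (segment d c l) ≡ ∑ l (λ k → + δ v (rep (c + k * d)))
    occ-segment v d c zero    = refl
    occ-segment v d c (suc l) = trans (cong +_ (∑ᴸ-++ _ (segment d c l) [ literal (c + l * d) ]))
      (trans (ℤ.pos-+ (occ v (segment d c l)) _) (cong₂ _+ᶻ_ (occ-segment v d c l) (cong +_ (ℕ.+-identityʳ _))))

    occ-walk : ∀ v d π g → + occ v (walk d π g) ≡ ∑ g (λ c → ∑ π (λ k → + δ v (rep (c + k * d))))
    occ-walk v d π zero    = refl
    occ-walk v d π (suc c) = trans (cong +_ (∑ᴸ-++ _ (walk d π c) (segment d c π)))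
      (trans (ℤ.pos-+ (occ v (walk d π c)) _) (cong₂ _+ᶻ_ (occ-walk v d π c) (occ-segment v d c π)))

    segment-prefix : ∀ d c l k → ∃ λ zs → segment d c (l + k) ≡ segment d c l ++ zs
    segment-prefix d c l zero    = [] , trans (cong (segment d c) (ℕ.+-identityʳ l)) (sym (List.++-identityʳ _))
    segment-prefix d c l (suc k) with segment-prefix d c l k
    ... | zs , eq = zs ++ [ literal (c + (l + k) * d) ] , trans (cong (segment d c) (ℕ.+-suc l k))
      (trans (cong (_++ [ literal (c + (l + k) * d) ]) eq) (List.++-assoc (segment d c l) zs _))

    walk-prefix : ∀ d π c k → ∃ λ zs → walk d π (c + k) ≡ walk d π c ++ zs
    walk-prefix d π c zero    = [] , trans (cong (walk d π) (ℕ.+-identityʳ c)) (sym (List.++-identityʳ _))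
    walk-prefix d π c (suc k) with walk-prefix d π c k
    ... | zs , eq = zs ++ segment d (c + k) π , trans (cong (walk d π) (ℕ.+-suc c k))
      (trans (cong (_++ segment d (c + k) π) eq) (List.++-assoc (walk d π c) zs _))

    period : ℕ → ℕ
    period d = Data.Nat.Divisibility.quotient (gcd[m,n]∣m r d)

    period-gcd : ∀ d → r ≡ period d * gcd r d
    period-gcd d = Data.Nat.Divisibility._∣_.equality (gcd[m,n]∣m r d)

    period≢0 : ∀ d → NonZero (period d)
    period≢0 d = ℕ.≢-nonZero λ eq → ℕ.≢-nonZero⁻¹ r (trans (period-gcd d) (cong (_* gcd r d) eq))

    fullWalk : ℕ → List (Literal r)
    fullWalk d = walk d (period d) (gcd r d)

    cycle-gcd : ∀ d f → Periodic r f → ∀ c → ∑ (period d) (λ k → f (c + k * d)) ≡ ∑ (period d) (λ j → f (c + j * gcd r d))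
    cycle-gcd d f p = cycle-sum (period d) (gcd r d) d {{period≢0 d}} (cong (λ z → gcd z d) (sym (period-gcd d))) f (subst (λ z → Periodic z f) (period-gcd d) p)

    -- The full walk meets every residue once: on each cycle the steps `d` may be exchanged for
    -- steps `gcd r d`, and the points c + j g with c < g enumerate all residues. The count is thus
    -- the one in `fibre`.
    occ-fullWalk : ∀ d v → occ v (fullWalk d) ≤ K
    occ-fullWalk d v = subst (_≤ K) (ℤ.+-injective (sym count)) (proj₁ (proj₂ (fibre v)))
      where
      open ≡-Reasoning
      h : ℕ → ℤ
      h x = + δ v (rep x)
      count : + occ v (fullWalk d) ≡ + proj₁ (fibre v)
      count = begin
        + occ v (fullWalk d) ≡⟨ occ-walk v d (period d) (gcd r d) ⟩
        ∑ (gcd r d) (λ c → ∑ (period d) (λ k → h (c + k * d))) ≡⟨ ∑-cong (gcd r d) (λ c → cycle-gcd d h (λ x → cong (λ z → + δ v z) (rep-p x)) c) ⟩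
        ∑ (gcd r d) (λ c → ∑ (period d) (λ j → h (c + j * gcd r d))) ≡⟨ ∑-swap (gcd r d) (period d) (λ c j → h (c + j * gcd r d)) ⟩
        ∑ (period d) (λ j → ∑ (gcd r d) (λ c → h (c + j * gcd r d))) ≡⟨ ∑-cong (period d) (λ j → ∑-cong (gcd r d) (λ c → cong h (ℕ.+-comm c (j * gcd r d)))) ⟩
        ∑ (period d) (λ j → ∑ (gcd r d) (λ c → h (j * gcd r d + c))) ≡⟨ ∑-blocks (period d) (gcd r d) h ⟨
        ∑ (period d * gcd r d) h ≡⟨ cong (λ z → ∑ z h) (period-gcd d) ⟨
        ∑ r h ≡⟨ proj₂ (proj₂ (fibre v)) ⟩
        + proj₁ (fibre v) ∎

    walks : List (List (Literal r))
    walks = map fullWalk (upTo r)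

    length-walks : length walks ≡ r
    length-walks = trans (List.length-map fullWalk (upTo r)) (List.length-upTo r)

    occ-walks : ∀ xs → xs ∈ walks → ∀ v → occ v xs ≤ K
    occ-walks xs xs∈ v with ∈-map⁻ fullWalk xs∈
    ... | d , _ , refl = occ-fullWalk d v

    module _ (χ : Vec Bool r) (D : ℕ) (balanced : ∀ xs → xs ∈ walks → ∀ ys zs → xs ≡ ys ++ zs → ∣ S (signs χ) ys ∣ ≤ D) where

      f : ℕ → ℤ
      f = unfold (signs χ)

      f-periodic : Periodic r f
      f-periodic = unfold-periodic (signs χ)

      segment-bound : ∀ d → d < r → ∀ c → c < gcd r d → ∀ l → l ≤ period d → ∣ A l d f c ∣ ≤ D + D
      segment-bound d d<r c c<g l l≤π = subst (λ z → ∣ z ∣ ≤ D + D) difference (∣-∣≤ {S v (W ++ segment d c l)} {S v W} (prefix (W ++ segment d c l) (proj₁ long) (proj₂ long)) (prefix W (proj₁ short) (proj₂ short)))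
        where
        π g : ℕ
        π = period d
        g = gcd r d
        v : Fin r → ℤ
        v = signs χ
        W : List (Literal r)
        W = walk d π c
        prefix : ∀ ys zs → fullWalk d ≡ ys ++ zs → ∣ S v ys ∣ ≤ D
        prefix = balanced (fullWalk d) (∈-map⁺ fullWalk (∈-upTo⁺ d<r))
        short : ∃ λ zs → fullWalk d ≡ W ++ zs
        short = subst (λ z → ∃ λ zs → walk d π z ≡ W ++ zs) (ℕ.m+[n∸m]≡n (ℕ.<⇒≤ c<g)) (walk-prefix d π c (g ∸ c))
        whole : ∃ λ zs → fullWalk d ≡ (W ++ segment d c π) ++ zs
        whole = subst (λ z → ∃ λ zs → walk d π z ≡ (W ++ segment d c π) ++ zs) (ℕ.m+[n∸m]≡n c<g) (walk-prefix d π (suc c) (g ∸ suc c))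
        part : ∃ λ zs → segment d c π ≡ segment d c l ++ zs
        part = subst (λ z → ∃ λ zs → segment d c z ≡ segment d c l ++ zs) (ℕ.m+[n∸m]≡n l≤π) (segment-prefix d c l (π ∸ l))
        long : ∃ λ zs → fullWalk d ≡ (W ++ segment d c l) ++ zs
        long = proj₁ part ++ proj₁ whole , trans (proj₂ whole) (trans (cong (λ z → (W ++ z) ++ proj₁ whole) (proj₂ part))
          (trans (cong (_++ proj₁ whole) (sym (List.++-assoc W (segment d c l) (proj₁ part)))) (List.++-assoc (W ++ segment d c l) (proj₁ part) (proj₁ whole))))
        cancel : ∀ a b → a +ᶻ b -ᶻ a ≡ b
        cancel = ℤ-ring
        difference : S v (W ++ segment d c l) -ᶻ S v W ≡ A l d f c
        difference = trans (cong (_-ᶻ S v W) (S-++ v W (segment d c l))) (trans (cancel (S v W) (S v (segment d c l))) (S-segment v d c l))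

      cycle-bound : ∀ d c → ∣ ∑ (period d) (λ k → f (c + k * d)) ∣ ≤ 1
      cycle-bound d c = subst (λ z → ∣ z ∣ ≤ 1) (sym (cycle-gcd d f f-periodic c)) (collapsed (coset (gcd r d) (period d) (sym (period-gcd d)) c))
        where
        collapsed : Collapses (λ χ → ∑ (period d) (λ j → unfold χ (c + j * gcd r d))) → ∣ ∑ (period d) (λ j → f (c + j * gcd r d)) ∣ ≤ 1
        collapsed (inj₁ z)           = ℕ.≤-trans (ℕ.≤-reflexive (cong ∣_∣ (z (signs χ)))) z≤n
        collapsed (inj₂ (s , v , h)) = ℕ.≤-reflexive (trans (cong ∣_∣ (h (signs χ))) (trans (ℤ.abs-* (sign s) (signs χ v)) (cong₂ _*_ (∣sign∣ s) (∣sign∣ (lookup χ v)))))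

      f-congruent : ∀ x y u w → x + u * r ≡ y + w * r → f x ≡ f y
      f-congruent x y u w eq = trans (sym (periodic-* f-periodic u x)) (trans (cong f eq) (periodic-* f-periodic w y))

      cycles : ∀ d c t ρ → A (t * period d + ρ) d f c ≡ + t *ᶻ A (period d) d f c +ᶻ A ρ d f c
      cycles d c t ρ = trans (∑-split (t * π) ρ (λ k → f (c + k * d))) (cong₂ _+ᶻ_
          (trans (∑-blocks t π (λ k → f (c + k * d))) (trans (∑-cong t (λ i → ∑-cong π (λ k → shift i k))) (∑-const t (A π d f c))))
          (∑-cong ρ (λ k → shift t k)))
        where
        π : ℕ
        π = period d
        d∣ : gcd r d ∣ d
        d∣ = gcd[m,n]∣n r d
        e : ℕ
        e = Data.Nat.Divisibility.quotient d∣
        lem : ∀ c i π k e g → c + (i * π + k) * (e * g) ≡ c + k * (e * g) + i * e * (π * g)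
        lem = ℕ-ring
        shift : ∀ i k → f (c + (i * π + k) * d) ≡ f (c + k * d)
        shift i k = f-congruent (c + (i * π + k) * d) (c + k * d) 0 (i * e) (trans (ℕ.+-identityʳ _)
          (trans (cong (λ z → c + (i * π + k) * z) (Data.Nat.Divisibility._∣_.equality d∣)) (trans (lem c i π k e (gcd r d))
            (cong₂ (λ y z → c + k * y + i * e * z) (sym (Data.Nat.Divisibility._∣_.equality d∣)) (sym (period-gcd d))))))

      -- The progression is the difference of two stretches that begin at the origin of the cycle.
      -- The longer one consists of at most `q` full cycles, worth 1 each, and a partial cycle; each
      -- partial cycle costs two prefixes.
      cycle-AP-bound : ∀ q d → d < r → ∀ c → c < gcd r d → ∀ k₀ → k₀ < period d → ∀ l → l ≤ q * period d →
        ∣ ∑ l (λ k → f (c + (k₀ + k) * d)) ∣ ≤ q + (D + D) + (D + D)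
      cycle-AP-bound q d d<r c c<g k₀ k₀<π l l≤ = subst (λ z → ∣ z ∣ ≤ q + (D + D) + (D + D)) difference
          (∣-∣≤ {A (k₀ + l) d f c} {A k₀ d f c} long (segment-bound d d<r c c<g k₀ (ℕ.<⇒≤ k₀<π)))
        where
        π t ρ : ℕ
        π = period d
        instance
          π≢0 : NonZero π
          π≢0 = period≢0 d
        t = (k₀ + l) / π
        ρ = (k₀ + l) % π
        split : k₀ + l ≡ t * π + ρ
        split = trans (m≡m%n+[m/n]*n (k₀ + l) π) (ℕ.+-comm ρ (t * π))
        -- Because k₀ < π, moving the start back to the origin cannot complete a further cycle. This
        -- keeps the main term at `q` instead of q + 1.
        t≤q : t ≤ q
        t≤q = ℕ.≤-pred (ℕ.*-cancelʳ-< π t (suc q) (ℕ.≤-<-trans (m/n*n≤m (k₀ + l) π) (ℕ.+-mono-<-≤ k₀<π l≤)))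
        long : ∣ A (k₀ + l) d f c ∣ ≤ q + (D + D)
        long = subst (λ z → ∣ z ∣ ≤ q + (D + D)) (sym (trans (cong (λ z → A z d f c) split) (cycles d c t ρ)))
          (ℕ.≤-trans (ℤ.∣i+j∣≤∣i∣+∣j∣ (+ t *ᶻ A π d f c) (A ρ d f c)) (ℕ.+-mono-≤
            (ℕ.≤-trans (ℕ.≤-reflexive (ℤ.abs-* (+ t) (A π d f c))) (ℕ.≤-trans (ℕ.*-mono-≤ t≤q (cycle-bound d c)) (ℕ.≤-reflexive (ℕ.*-identityʳ q))))
            (segment-bound d d<r c c<g ρ (ℕ.<⇒≤ (m%n<n (k₀ + l) π)))))
        cancel : ∀ a b → a +ᶻ b -ᶻ a ≡ b
        cancel = ℤ-ring
        difference : A (k₀ + l) d f c -ᶻ A k₀ d f c ≡ ∑ l (λ k → f (c + (k₀ + k) * d))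
        difference = trans (cong (_-ᶻ A k₀ d f c) (∑-split k₀ l (λ k → f (c + k * d)))) (cancel (A k₀ d f c) _)

      locate : ∀ d c t → Σ ℕ λ k → Σ ℕ λ u → Σ ℕ λ w → c + k * d + u * r ≡ c + t * gcd r d + w * r
      locate d c t = go (Bézout.identity (gcd-GCD r d))
        where
        go : ∀ {g} → Bézout.Identity g r d → Σ ℕ λ k → Σ ℕ λ u → Σ ℕ λ w → c + k * d + u * r ≡ c + t * g + w * r
        go {g} (Bézout.-+ x y eq) = t * y , 0 , t * x , trans (lem₁ c t y d r) (trans (cong (λ z → c + t * z) (sym eq)) (lem₂ c t g x r))
          where
          lem₁ : ∀ c t y d r → c + t * y * d + 0 * r ≡ c + t * (y * d)
          lem₁ = ℕ-ring
          lem₂ : ∀ c t g x r → c + t * (g + x * r) ≡ c + t * g + t * x * r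
          lem₂ = ℕ-ring
        -- Here g ≡ -y d modulo r; the negative coefficient is replaced by y (r - 1).
        go {g} (Bézout.+- x y eq) = t * y * ℕ.pred r , t * x , t * y * d ,
            trans (cong (λ z → c + t * y * ℕ.pred r * d + z) (trans (ℕ.*-assoc t x r) (cong (t *_) (sym eq)))) (trans (lem₁ c t y (ℕ.pred r) d g) (cong (λ z → c + t * g + t * y * d * z) (ℕ.suc-pred r)))
          where
          lem₁ : ∀ c t y p d g → c + t * y * p * d + t * (g + y * d) ≡ c + t * g + t * y * d * suc p
          lem₁ = ℕ-ring

      AP-bound : ∀ q d → d < r → ∀ a l → l * gcd r d ≤ q * r → ∣ A l d f a ∣ ≤ q + (D + D) + (D + D)
      AP-bound q d d<r a l l≤ = subst (λ z → ∣ z ∣ ≤ q + (D + D) + (D + D)) (∑-cong l same)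
          (cycle-AP-bound q d d<r c (m%n<n a g) k₀ (m%n<n k π) l l≤qπ)
        where
        g π : ℕ
        g = gcd r d
        π = period d
        instance
          π≢0 : NonZero π
          π≢0 = period≢0 d
          g≢0 : NonZero g
          g≢0 = ℕ.≢-nonZero (gcd[m,n]≢0 r d (inj₁ (ℕ.≢-nonZero⁻¹ r)))
        c t k k₀ u w e : ℕ
        c = a % g
        t = a / g
        k = proj₁ (locate d c t)
        u = proj₁ (proj₂ (locate d c t))
        w = proj₁ (proj₂ (proj₂ (locate d c t)))
        k₀ = k % π
        e = Data.Nat.Divisibility.quotient (gcd[m,n]∣n r d)
        located : c + k * d + u * r ≡ a + w * r
        located = trans (proj₂ (proj₂ (proj₂ (locate d c t)))) (cong (_+ w * r) (sym (m≡m%n+[m/n]*n a g)))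
        l≤qπ : l ≤ q * π
        l≤qπ = ℕ.*-cancelʳ-≤ l (q * π) g (ℕ.≤-trans l≤ (ℕ.≤-reflexive (trans (cong (q *_) (period-gcd d)) (sym (ℕ.*-assoc q π g)))))
        kd : k * d ≡ k₀ * d + (k / π) * e * r
        kd = trans (cong (_* d) (m≡m%n+[m/n]*n k π)) (trans (lem k₀ (k / π) π d) (cong (λ z → k₀ * d + z) (trans (cong (λ z → (k / π) * (π * z)) (Data.Nat.Divisibility._∣_.equality (gcd[m,n]∣n r d))) (trans (lem₂ (k / π) π e g) (cong ((k / π) * e *_) (sym (period-gcd d)))))))
          where
          lem : ∀ k₀ j π d → (k₀ + j * π) * d ≡ k₀ * d + j * (π * d)
          lem = ℕ-ring
          lem₂ : ∀ j π e g → j * (π * (e * g)) ≡ j * e * (π * g)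
          lem₂ = ℕ-ring
        same : ∀ i → f (c + (k₀ + i) * d) ≡ f (a + i * d)
        same i = f-congruent (c + (k₀ + i) * d) (a + i * d) ((k / π) * e + u) w (begin
          c + (k₀ + i) * d + ((k / π) * e + u) * r ≡⟨ lem₃ c k₀ i d ((k / π) * e) u r ⟩
          c + (k₀ * d + (k / π) * e * r) + u * r + i * d ≡⟨ cong (λ z → c + z + u * r + i * d) kd ⟨
          c + k * d + u * r + i * d ≡⟨ cong (_+ i * d) located ⟩
          a + w * r + i * d ≡⟨ lem₄ a (w * r) (i * d) ⟩
          a + i * d + w * r ∎)
          where
          open ≡-Reasoning
          lem₃ : ∀ c k i d m u r → c + (k + i) * d + (m + u) * r ≡ c + (k * d + m * r) + u * r + i * d
          lem₃ = ℕ-ring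
          lem₄ : ∀ a b c → a + b + c ≡ a + c + b
          lem₄ = ℕ-ring

  power-of-64 : ∀ x → 0 < x → Σ ℕ λ L → (x ≤ 64 ^ L) × (64 ^ L ≤ x * 64)
  power-of-64 (suc zero)    _ = 0 , s≤s z≤n , s≤s z≤n
  power-of-64 (suc x@(suc _)) _ with power-of-64 x (s≤s z≤n)
  ... | L , lo , hi = choose (ℕ.≤-<-connex (suc x) (64 ^ L))
    where
    choose : (suc x ≤ 64 ^ L) ⊎ (64 ^ L < suc x) → Σ ℕ λ L → (suc x ≤ 64 ^ L) × (64 ^ L ≤ suc x * 64)
    choose (inj₁ le) = L , le , ℕ.≤-trans hi (ℕ.*-monoˡ-≤ 64 (ℕ.n≤1+n x))
    choose (inj₂ gt) = suc L , ℕ.≤-trans (s≤s lo) (ℕ.≤-trans (ℕ.+-monoˡ-≤ (64 ^ L) (ℕ.m^n>0 64 L)) (ℕ.+-monoʳ-≤ (64 ^ L) (ℕ.m≤m+n (64 ^ L) _))) ,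
      ℕ.≤-trans (ℕ.≤-reflexive (ℕ.*-comm 64 (64 ^ L))) (ℕ.*-monoˡ-≤ 64 (ℕ.<⇒≤ gt))

  root-of-2^ : ∀ w → Σ ℕ λ s → NonZero s × (2 ^ w ≤ s * s) × (s * s ≤ 2 ^ w * 2)
  root-of-2^ zero          = 1 , _ , s≤s z≤n , s≤s z≤n
  root-of-2^ (suc zero)    = 2 , _ , s≤s (s≤s z≤n) , ℕ.≤-refl
  root-of-2^ (suc (suc w)) with root-of-2^ w
  ... | s , s≢0 , lo , hi = 2 * s , ℕ.m*n≢0 2 s {{_}} {{s≢0}} , ℕ.≤-trans (ℕ.*-monoʳ-≤ 2 (ℕ.*-monoʳ-≤ 2 lo)) (ℕ.≤-reflexive (lem₁ s)) ,
      ℕ.≤-trans (ℕ.≤-reflexive (sym (lem₁ s))) (ℕ.≤-trans (ℕ.*-monoʳ-≤ 2 (ℕ.*-monoʳ-≤ 2 hi)) (ℕ.≤-reflexive (lem₂ (2 ^ w))))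
    where
    lem₁ : ∀ s → 2 * (2 * (s * s)) ≡ 2 * s * (2 * s)
    lem₁ = ℕ-ring
    lem₂ : ∀ x → 2 * (2 * (x * 2)) ≡ 2 * (2 * x) * 2
    lem₂ = ℕ-ring

  -- Hides the auxiliary s and L. The factor 128 is 2·64, lost when K is rounded up to a square and
  -- r K to a power of 64.
  Balance₀ : ℕ → ℕ → Set
  Balance₀ r K = Σ ℕ λ X → (X * X ≤ K * K * r * 128) × (∀ (Ls : List (List (Literal r))) → length Ls ≤ r → (∀ xs → xs ∈ Ls → ∀ v → occ v xs ≤ K) → Balanced (X * 64576) Ls)

  balance-omega : ∀ r → 0 < r → ∀ w → Balance₀ r (2 ^ w)
  balance-omega r 0<r w = go (root-of-2^ w) (power-of-64 (r * 2 ^ w) (ℕ.*-mono-≤ 0<r (ℕ.m^n>0 2 w)))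
    where
    K : ℕ
    K = 2 ^ w
    go : (Σ ℕ λ s → NonZero s × (K ≤ s * s) × (s * s ≤ K * 2)) → (Σ ℕ λ L → (r * K ≤ 64 ^ L) × (64 ^ L ≤ r * K * 64)) → Balance₀ r K
    go (s , s≢0 , s-lo , s-hi) (L , L-lo , L-hi) = s * (P * P * P) , X²≤ , λ Ls len occs →
        Iterate.exists-balanced r K s L {{ℕ.m^n≢0 2 w}} {{s≢0}} L-lo s-lo 0<r r ℕ.≤-refl Ls len occs
      where
      P : ℕ
      P = 2 ^ L
      lem₁ : ∀ s P → s * (P * P * P) * (s * (P * P * P)) ≡ s * s * (P * P * P * (P * P * P))
      lem₁ = ℕ-ring
      lem₂ : ∀ K r → K * 2 * (r * K * 64) ≡ K * K * r * 128
      lem₂ = ℕ-ring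
      X²≤ : s * (P * P * P) * (s * (P * P * P)) ≤ K * K * r * 128
      X²≤ = ℕ.≤-trans (ℕ.≤-reflexive (trans (lem₁ s P) (cong (s * s *_) (sym (64^≡ L))))) (ℕ.≤-trans (ℕ.*-mono-≤ s-hi L-hi) (ℕ.≤-reflexive (lem₂ K r)))

  module _ (m q r : ℕ) .{{r≢0 : NonZero r}} (qr : q * r ≡ suc m) where

    private
      n : ℕ
      n = suc m

    disc-upper : ∀ {K} (F : Fold r K) (χ : Vec Bool r) D → (∀ xs → xs ∈ Walks.walks F → ∀ ys zs → xs ≡ ys ++ zs → ∣ S (signs χ) ys ∣ ≤ D) →
      disc n ≤ q + (D + D) + (D + D)
    disc-upper F χ D balanced = ℕ.≤-trans (min-lower (maxAP m) _ (allVecs n) (∈-allVecs χ′)) (maxAP-least m χ′ _ bound)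
      where
      open Fold F
      module W = Walks F
      f : ℕ → ℤ
      f = unfold (signs χ)
      f-periodic : Periodic r f
      f-periodic = unfold-periodic (signs χ)
      bit : ℕ → Bool
      bit x = sgn x ⊙ lookup χ (rep x)
      χ′ : Vec Bool n
      χ′ = tabulate (λ i → bit (toℕ i))
      colour≡f : ∀ x → colour m χ′ x ≡ f x
      colour≡f x = trans (cong sign (trans (Vec.lookup∘tabulate (λ i → bit (toℕ i)) (fromℕ< (m%n<n x n))) (cong bit (Fin.toℕ-fromℕ< (m%n<n x n)))))
        (trans (sign-⊙ (sgn (x % n)) (lookup χ (rep (x % n)))) (periodic-% n (subst (λ z → Periodic z f) qr (periodic-* f-periodic q)) x))
      bound : ∀ {a d l} → (a , d , l) ∈ allAPs m → ∣ χAP m χ′ a d l ∣ ≤ q + (D + D) + (D + D)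
      bound {a} {d} {l} p = subst (λ z → ∣ z ∣ ≤ q + (D + D) + (D + D)) (sym (trans (χAP-A m χ′ a d l) (trans (A-cong l d colour≡f a) (sym reduced))))
          (W.AP-bound χ D balanced q (d % r) (m%n<n d r) (a % r) l length-ok)
        where
        reduced : A l (d % r) f (a % r) ≡ A l d f a
        reduced = A-mod r f f-periodic l d a
        -- `gcd r d` divides `gcd n d`, so a progression without repetition modulo n goes at most
        -- `q` times around its cycle modulo r.
        length-ok : l * gcd r (d % r) ≤ q * r
        length-ok = ℕ.≤-trans (ℕ.*-monoʳ-≤ l (ℕ.≤-trans (ℕ.≤-reflexive (gcd-mod r d)) (∣⇒≤ {{gcd≢0 m d}} (gcd-greatest (∣-trans (gcd[m,n]∣m r d) (divides q (sym qr))) (gcd[m,n]∣n r d)))))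
          (ℕ.≤-trans (allAPs-length m {a} {d} {l} p) (ℕ.≤-reflexive (sym qr)))

  square-bound : ∀ x q X C c b → x ≤ q + X * C → C * 12 ≤ c → X * X ≤ b * 128 → LeSumSqrt x q (c * c * b)
  square-bound x q X C c b x≤ c≥ X² = inj₂ (begin
    (x ∸ q) * (x ∸ q) ≤⟨ ℕ.*-mono-≤ d≤ d≤ ⟩
    X * C * (X * C) ≡⟨ lem₁ X C ⟩
    X * X * (C * C) ≤⟨ ℕ.*-monoˡ-≤ (C * C) X² ⟩
    b * 128 * (C * C) ≤⟨ ℕ.*-monoˡ-≤ (C * C) (ℕ.*-monoʳ-≤ b (ℕ.m≤m+n 128 16)) ⟩
    b * 144 * (C * C) ≡⟨ lem₂ b C ⟩
    C * 12 * (C * 12) * b ≤⟨ ℕ.*-monoˡ-≤ b (ℕ.*-mono-≤ c≥ c≥) ⟩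
    c * c * b ∎)
    where
    open ℕ.≤-Reasoning
    d≤ : x ∸ q ≤ X * C
    d≤ = ℕ.m≤n+o⇒m∸n≤o x q x≤
    lem₁ : ∀ X C → X * C * (X * C) ≡ X * X * (C * C)
    lem₁ = ℕ-ring
    lem₂ : ∀ b C → b * 144 * (C * C) ≡ C * 12 * (C * 12) * b
    lem₂ = ℕ-ring

  -- The three factors of the constant: 64576 from the balanced colouring, 4 for the four prefixes
  -- that describe a progression, and 12 because 12^2 = 144 exceeds the 128 lost in rounding.
  upper-bound : ∀ c → 64576 * 4 * 12 ≤ c → (n : ℕ) → 0 < n → (q r : ℕ) → q * r ≡ n → LeSumSqrt (disc n) q (c * c * (4 ^ omega r) * r)
  upper-bound c c≥ n@(suc m) _ q zero      qr = ⊥-elim (ℕ.0≢1+n (trans (sym (ℕ.*-zeroʳ q)) qr))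
  upper-bound c c≥ n@(suc m) _ q r@(suc _) qr = go (balance-omega r (s≤s z≤n) (omega r))
    where
    K : ℕ
    K = 2 ^ omega r
    F : Fold r K
    F = fold-omega r (s≤s z≤n)
    go : Balance₀ r K → LeSumSqrt (disc n) q (c * c * (4 ^ omega r) * r)
    go (X , X² , balance) = subst (LeSumSqrt (disc n) q) (trans (cong (λ z → c * c * (z * r)) (sym (*-^-distrib (omega r) 2 2))) (sym (ℕ.*-assoc (c * c) (4 ^ omega r) r)))
        (square-bound (disc n) q X (64576 * 4) c (K * K * r) (ℕ.≤-trans (disc-upper m q r qr F (proj₁ χ) (X * 64576) (proj₂ χ)) (ℕ.≤-reflexive (lem q X 64576))) c≥ X²)
      where
      χ : Balanced (X * 64576) (Walks.walks F)
      χ = balance (Walks.walks F) (ℕ.≤-reflexive (Walks.length-walks F)) (Walks.occ-walks F)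
      lem : ∀ q X C → q + (X * C + X * C) + (X * C + X * C) ≡ q + X * (C * 4)
      lem = ℕ-ring

theorem1p1 :
  ((n : ℕ) → 0 < n →
    Σ ℕ (λ q → Σ ℕ (λ r → (q * r ≡ n) ×
      SumSqrtLe q r (64 * (disc n * disc n) * numDiv n))))
  ×
  Σ ℕ (λ c → (0 < c) × ((n : ℕ) → 0 < n → (q r : ℕ) → q * r ≡ n →
    LeSumSqrt (disc n) q (c * c * (4 ^ omega r) * r)))
theorem1p1 = Disc.lower-bound , 64576 * 4 * 12 , s≤s z≤n , Upper.upper-bound (64576 * 4 * 12) ℕ.≤-refl
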